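{- Let $n \in \mathbb{N}$ and $d \in \mathbb{N}_0$ satisfy: (i) $n$ and $d$ are both even, and at least one of them is divisible by $4$; and (ii) $d \ge 4$ and $n \ge d+4$. Then there exists a $d$-regular nut graph of order $n$ of the form $\mathrm{Cay}(\Gamma, C)$ where $\Gamma$ is either a cyclic group or a dihedral group.
   Context: For a finite group $\Gamma$ with identity $e$ and $C \subseteq \Gamma\setminus\{e\}$ closed under inversion, $\mathrm{Cay}(\Gamma, C)$ is the graph with vertex set $\Gamma$ in which $u,v$ are adjacent iff $vu^{ -1}\in C$. The dihedral group of order $2m$ ($m\ge3$) is $\langle r, s \mid r^m = s^2 = e,\ srs = r^{ -1}\rangle$. A nut graph is a graph with at least two vertices whose adjacency matrix has eigenvalue $0$ with multiplicity exactly one, such that the corresponding eigenvector has no zero entries. -}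

module Defs where

open import Algebra.Bundles using (Group)
open import Algebra.Morphism.Structures using (module GroupMorphisms)
import Algebra.Properties.Group as GroupProperties
open import Data.Bool.Base using (if_then_else_)
open import Data.Fin.Base using (Fin)
open import Data.Integer.Base as ℤ using (ℤ)
open import Data.List.Base using (filter; length; tabulate)
open import Data.Nat.Base as ℕ using (ℕ; suc)
open import Data.Product.Base using (∃; ∃-syntax; _,_; _×_)
open import Data.Rational.Base as ℚ using (ℚ; 0ℚ; 1ℚ)
open import Data.Vec.Functional using (Vector)
open import Function.Bundles using (Inverse)
open import Level using (0ℓ)
open import Relation.Binary.Bundles using (Setoid)
open import Relation.Binary.Core using (Rel)
open import Relation.Binary.Definitions
  using (Decidable; Irreflexive; Symmetric; _Respects_; _Respects₂_)
open import Relation.Binary.PropositionalEquality.Core using (_≡_; _≢_)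
open import Relation.Binary.PropositionalEquality.Properties using (setoid)
open import Relation.Nullary using (¬_; does)
import Relation.Unary as Unary

module _ (G : Group 0ℓ 0ℓ) where
  open Group G
  open import Algebra.Definitions.RawMonoid rawMonoid using () renaming (_×_ to _⊗_)

  -- k ⊗ g is the product of k copies of g.
  power : Carrier → ℤ → Carrier
  power g (ℤ.+ k)    = k ⊗ g
  power g ℤ.-[1+ k ] = (suc k ⊗ g) ⁻¹

  IsCyclic : Set
  IsCyclic = ∃[ g ] ∀ x → ∃[ k ] x ≈ power g k

module Presentation (X : Set) where

  infixl 7 _·_
  infix  8 _⁻

  data Word : Set where
    gen : X → Word
    e   : Word
    _·_ : Word → Word → Word
    _⁻  : Word → Word

  infixr 9 _^_

  _^_ : Word → ℕ → Word
  w ^ 0     = e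
  w ^ suc k = w · w ^ k

  -- The least congruence on words that contains the group axioms and
  -- the relations R.
  data Eq (R : Rel Word 0ℓ) : Rel Word 0ℓ where
    rel      : ∀ {u v} → R u v → Eq R u v
    refl     : ∀ {u} → Eq R u u
    sym      : ∀ {u v} → Eq R u v → Eq R v u
    trans    : ∀ {u v w} → Eq R u v → Eq R v w → Eq R u w
    ·-cong   : ∀ {u u′ v v′} → Eq R u u′ → Eq R v v′ → Eq R (u · v) (u′ · v′)
    ⁻-cong   : ∀ {u v} → Eq R u v → Eq R (u ⁻) (v ⁻)
    assoc    : ∀ u v w → Eq R ((u · v) · w) (u · (v · w))
    identityˡ : ∀ u → Eq R (e · u) u
    identityʳ : ∀ u → Eq R (u · e) u
    inverseˡ : ∀ u → Eq R (u ⁻ · u) e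
    inverseʳ : ∀ u → Eq R (u · u ⁻) e

  presentedGroup : Rel Word 0ℓ → Group 0ℓ 0ℓ
  presentedGroup R = record
    { Carrier = Word
    ; _≈_     = Eq R
    ; _∙_     = _·_
    ; ε       = e
    ; _⁻¹     = _⁻
    ; isGroup = record
      { isMonoid = record
        { isSemigroup = record
          { isMagma = record
            { isEquivalence = record { refl = refl ; sym = sym ; trans = trans }
            ; ∙-cong        = ·-cong
            }
          ; assoc = assoc
          }
        ; identity = identityˡ , identityʳ
        }
      ; inverse = inverseˡ , inverseʳ
      ; ⁻¹-cong = ⁻-cong
      }
    }

data DihedralGenerator : Set where
  r s : DihedralGenerator

module _ where
  open Presentation DihedralGenerator

  data DihedralRelation (m : ℕ) : Rel Word 0ℓ where
    rᵐ≈e   : DihedralRelation m (gen r ^ m) e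
    s²≈e   : DihedralRelation m (gen s ^ 2) e
    srs≈r⁻ : DihedralRelation m (gen s · gen r · gen s) (gen r ⁻)

  Dihedral : ℕ → Group 0ℓ 0ℓ
  Dihedral m = presentedGroup (DihedralRelation m)

_≅_ : Group 0ℓ 0ℓ → Group 0ℓ 0ℓ → Set
G ≅ H = ∃[ f ] IsGroupIsomorphism f
  where open GroupMorphisms (Group.rawGroup G) (Group.rawGroup H)

IsDihedral : Group 0ℓ 0ℓ → Set
IsDihedral G = ∃[ m ] (3 ℕ.≤ m × Dihedral m ≅ G)

HasOrder : Setoid 0ℓ 0ℓ → ℕ → Set
HasOrder S n = Inverse (setoid (Fin n)) S

record Graph (n : ℕ) : Set₁ where
  field
    vertices  : Setoid 0ℓ 0ℓ
    order     : HasOrder vertices n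

  open Setoid vertices public using () renaming (Carrier to Vertex; _≈_ to _≈ᵥ_)

  field
    Adjacent  : Rel Vertex 0ℓ
    adjacent? : Decidable Adjacent
    resp      : Adjacent Respects₂ _≈ᵥ_
    symmetric : Symmetric Adjacent
    loopless  : Irreflexive _≈ᵥ_ Adjacent

  vertex : Fin n → Vertex
  vertex = Inverse.to order

  degree : Vertex → ℕ
  degree v = length (filter (adjacent? v) (tabulate vertex))

  IsRegular : ℕ → Set
  IsRegular d = ∀ v → degree v ≡ d

record ConnectionSet (G : Group 0ℓ 0ℓ) : Set₁ where
  open Group G
  field
    C         : Unary.Pred Carrier 0ℓ
    C?        : Unary.Decidable C
    C-resp    : C Respects _≈_
    ε∉C       : ¬ C ε
    C-inverse : ∀ {x} → C x → C (x ⁻¹)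

Cay : ∀ {n} (Γ : Group 0ℓ 0ℓ) → HasOrder (Group.setoid Γ) n → ConnectionSet Γ → Graph n
Cay Γ Γ-order conn = record
  { vertices  = Γ.setoid
  ; order     = Γ-order
  ; Adjacent  = λ u v → C (v Γ.∙ u Γ.⁻¹)
  ; adjacent? = λ u v → C? (v Γ.∙ u Γ.⁻¹)
  ; resp      = (λ v≈v′ → C-resp (Γ.∙-congʳ v≈v′))
              , (λ u≈u′ → C-resp (Γ.∙-congˡ (Γ.⁻¹-cong u≈u′)))
  ; symmetric = λ {u} {v} vu⁻¹∈C → C-resp (flip-∙ u v) (C-inverse vu⁻¹∈C)
  ; loopless  = λ {u} {v} u≈v vu⁻¹∈C →
      ε∉C (C-resp (Γ.trans (Γ.∙-congʳ (Γ.sym u≈v)) (Γ.inverseʳ u)) vu⁻¹∈C)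
  }
  where
  module Γ = Group Γ
  open ConnectionSet conn
  open GroupProperties Γ using (⁻¹-anti-homo-∙; ⁻¹-involutive)

  flip-∙ : ∀ u v → (v Γ.∙ u Γ.⁻¹) Γ.⁻¹ Γ.≈ u Γ.∙ v Γ.⁻¹
  flip-∙ u v = Γ.trans (⁻¹-anti-homo-∙ v (u Γ.⁻¹)) (Γ.∙-congʳ (⁻¹-involutive u))

Matrix : ℕ → Set
Matrix n = Fin n → Fin n → ℚ

∑ : ∀ {n} → Vector ℚ n → ℚ
∑ = sum
  where open import Algebra.Definitions.RawMonoid ℚ.+-0-rawMonoid using (sum)

infixr 7 _*ᵥ_

_*ᵥ_ : ∀ {n} → Matrix n → Vector ℚ n → Vector ℚ n
(A *ᵥ x) i = ∑ λ j → A i j ℚ.* x j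

InEigenspace : ∀ {n} → Matrix n → ℚ → Vector ℚ n → Set
InEigenspace A μ x = ∀ i → (A *ᵥ x) i ≡ μ ℚ.* x i

IsEigenvector : ∀ {n} → Matrix n → ℚ → Vector ℚ n → Set
IsEigenvector A μ x = InEigenspace A μ x × ∃[ i ] x i ≢ 0ℚ

combination : ∀ {k n} → Vector ℚ k → Vector (Vector ℚ n) k → Vector ℚ n
combination c b i = ∑ λ j → c j ℚ.* b j i

record IsEigenbasis {k n} (A : Matrix n) (μ : ℚ) (b : Vector (Vector ℚ n) k) : Set where
  field
    inEigenspace : ∀ j → InEigenspace A μ (b j)
    independent  : ∀ c → (∀ i → combination c b i ≡ 0ℚ) → ∀ j → c j ≡ 0ℚ
    spanning     : ∀ x → InEigenspace A μ x → ∃[ c ] ∀ i → x i ≡ combination c b i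

-- The dimension of the eigenspace.  Adjacency matrices are symmetric, so
-- this is also the multiplicity as a root of the characteristic
-- polynomial; as their entries are rational, the dimension for a rational
-- eigenvalue is the same over ℚ as over ℝ.
HasMultiplicity : ∀ {n} → Matrix n → ℚ → ℕ → Set
HasMultiplicity {n} A μ k = ∃ λ (b : Vector (Vector ℚ n) k) → IsEigenbasis A μ b

adjacencyMatrix : ∀ {n} → Graph n → Matrix n
adjacencyMatrix G i j = if does (adjacent? (vertex i) (vertex j)) then 1ℚ else 0ℚ
  where open Graph G

record IsNutGraph {n} (G : Graph n) : Set where
  field
    nontrivial   : 2 ℕ.≤ n
    multiplicity : HasMultiplicity (adjacencyMatrix G) 0ℚ 1
    full         : ∀ x → IsEigenvector (adjacencyMatrix G) 0ℚ x → ∀ i → x i ≢ 0ℚ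

{-# OPTIONS --safe #-}

-- Write n = 2m and let Γ be dihedral.  If A, B ⊆ ℤ/m are the rotations and the
-- reflections of the connection set and P, Q are convolution with A and B, the
-- adjacency matrix is [[P, Q*], [Q, P]].  The sets are chosen so that (χ , - χ)
-- spans its kernel, where χ is the alternating character if 8 ∣ n and 4 ∤ d, and
-- χ = 1 otherwise.  After clearing denominators, kernel vectors are pairs of
-- m-periodic integer functions; let S be the shift by 1.
--
-- If m = 2h, then A and B agree, up to a few points, with a union C of cosets of
-- {0 , h}.  On functions with w (x + h) = - w x the operator of C is 0, and only an
-- explicit equation with a few terms is left.  On h-periodic functions it is twice
-- an integral operator, and elimination leads either to r = 2 M r with M integral,
-- or, if h is odd, to (1 + S²) w ≡ 0 or (1 + S²)(1 + S⁴) w ≡ 0 modulo 2 where w has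
-- sum 0 over a period; both force divisibility by every power of 2.  If m is odd,
-- then A = C ∪ {± 1} and B = C ∪ {± 3}, where P - Q is - S⁻³ (S⁴ - 1) (S² - 1) and
-- P + Q is S⁻³ (1 + S²) (1 + S⁴) modulo 2.
module Submission where

open import Defs hiding (r; s)
open import Algebra.Bundles using (Group)
import Algebra.Properties.Group as GroupProperties
open import Data.Bool.Base using (Bool; true; false; if_then_else_; _xor_)
open import Data.Bool.Properties using (xor-assoc)
open import Data.Empty using (⊥; ⊥-elim)
open import Data.Fin.Base using (Fin; zero; suc; toℕ; fromℕ<; splitAt; join; _↑ˡ_; _↑ʳ_)
open import Data.Fin.Properties
  using (toℕ-fromℕ<; toℕ<n; toℕ-injective; splitAt-join; join-splitAt; splitAt-↑ˡ; splitAt-↑ʳ)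
open import Data.Integer.Base hiding (suc; _<_; _≤_; NonZero; _^_)
open import Data.Integer.DivMod using (_%ℕ_; _/ℕ_; n%ℕd<d; a≡a%ℕn+[a/ℕn]*n)
open import Data.Integer.Divisibility.Signed
open import Data.Integer.Properties
open import Data.Integer.Tactic.RingSolver using (solve-∀)
open import Data.List.Base using (List; []; _∷_; filter; length; tabulate)
open import Data.Nat.Base as ℕ using (ℕ; zero; suc; NonZero)
open import Data.Nat.Coprimality as Coprime using (1-coprimeTo)
open import Data.Nat.DivMod using (m≡m%n+[m/n]*n)
import Data.Nat.Divisibility as ℕ∣
import Data.Nat.Properties as ℕ
import Data.Nat.Tactic.RingSolver as ℕ-Solver
open import Data.Product.Base using (Σ; _×_; _,_; proj₁; proj₂)
open import Data.Rational.Base as ℚ using (ℚ; mkℚ; 0ℚ; 1ℚ)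
import Data.Rational.Properties as ℚ
open import Data.Rational.Unnormalised.Base using (*≡*)
import Data.Rational.Unnormalised.Properties as ℚᵘ
open import Data.Sum.Base as Sum using (_⊎_; inj₁; inj₂)
open import Function.Base using (_∘_)
open import Function.Bundles using (Inverse)
open import Level using (0ℓ)
open import Relation.Binary.PropositionalEquality
open import Relation.Nullary using (¬_; Dec; yes; no; does)
open import Relation.Nullary.Decidable using (dec-true; dec-false)

open import Algebra.Definitions.RawMonoid +-0-rawMonoid using (sum)
open import Algebra.Properties.AbelianGroup +-0-abelianGroup
  using () renaming (∙-cancelʳ to +-cancelʳ; ∙-cancelˡ to +-cancelˡ)
import Algebra.Properties.Group ℚ.+-0-group as ℚ-Group

-- The obstacle is parity. `A` is symmetric and omits 0, so its size is even unless it contains an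
-- involution, and ℤ/m has one only for m = 2h, namely `h`. With χ = 1 the vector (χ , - χ) is in
-- the kernel only if |A| = |B| = d/2. Hence for 4 ∤ d and χ = 1 the set `A` must contain `h`, and
-- cannot be a union of cosets of {0 , h}. For `h` even the alternating character is h-periodic and
-- removes the constraint |A| = |B|: `A` stays a union of cosets and `B` has two points more or two
-- points less. For `h` odd that character is not h-periodic; instead `h` joins `A` as an extra
-- point, and `h + 1` joins `B`. The same count decides d ≡ 4 modulo 8: a union of cosets of size
-- d/2 consists of an odd number d/4 of classes modulo `h`. For `h` even, h/2 is an involution
-- modulo `h` and makes this possible. For `h` odd there is none, and the cosets are supplemented by
-- ± 1 in `A` and by {0 , h} in `B`.

-- Finite sums of functions on ℤ

sumTo : ℕ → (ℤ → ℤ) → ℤ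
sumTo zero    f = 0ℤ
sumTo (suc n) f = sumTo n f + f (+ n)

sumTo-cong< : ∀ n {f g} → (∀ i → i ℕ.< n → f (+ i) ≡ g (+ i)) → sumTo n f ≡ sumTo n g
sumTo-cong< zero    eq = refl
sumTo-cong< (suc n) eq = cong₂ _+_ (sumTo-cong< n λ i i<n → eq i (ℕ.m<n⇒m<1+n i<n)) (eq n ℕ.≤-refl)

sumTo-cong : ∀ n {f g} → (∀ x → f x ≡ g x) → sumTo n f ≡ sumTo n g
sumTo-cong n eq = sumTo-cong< n λ i _ → eq (+ i)

sumTo-zero : ∀ n → sumTo n (λ _ → 0ℤ) ≡ 0ℤ
sumTo-zero zero    = refl
sumTo-zero (suc n) = trans (+-identityʳ _) (sumTo-zero n)

sumTo-+ : ∀ n f g → sumTo n (λ x → f x + g x) ≡ sumTo n f + sumTo n g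
sumTo-+ zero    f g = refl
sumTo-+ (suc n) f g = trans (cong (_+ (f (+ n) + g (+ n))) (sumTo-+ n f g))
  (interchange (sumTo n f) (sumTo n g) (f (+ n)) (g (+ n)))
  where
  interchange : ∀ a b c d → (a + b) + (c + d) ≡ (a + c) + (b + d)
  interchange = solve-∀

sumTo-* : ∀ n k f → sumTo n (λ x → k * f x) ≡ k * sumTo n f
sumTo-* zero    k f = sym (*-zeroʳ k)
sumTo-* (suc n) k f = trans (cong (_+ k * f (+ n)) (sumTo-* n k f)) (sym (*-distribˡ-+ k (sumTo n f) (f (+ n))))

sumTo-const : ∀ n k → sumTo n (λ _ → k) ≡ + n * k
sumTo-const zero    k = refl
sumTo-const (suc n) k = trans (cong (_+ k) (sumTo-const n k))
  (trans (+-comm (+ n * k) k) (sym (suc-* (+ n) k)))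

sumTo-swap : ∀ m n (f : ℤ → ℤ → ℤ) →
  sumTo m (λ i → sumTo n (f i)) ≡ sumTo n (λ j → sumTo m (λ i → f i j))
sumTo-swap zero    n f = sym (sumTo-zero n)
sumTo-swap (suc m) n f = trans (cong (_+ sumTo n (f (+ m))) (sumTo-swap m n f))
  (sym (sumTo-+ n (λ j → sumTo m (λ i → f i j)) (f (+ m))))

+n+1 : ∀ n → + n + 1ℤ ≡ + suc n
+n+1 n = cong +_ (ℕ.+-comm n 1)

-- Both sides are the sum of `g` over 0, ..., n, split at the first and at the last term.
sumTo-step : ∀ n g → sumTo n (λ z → g (z + 1ℤ)) + g 0ℤ ≡ sumTo n g + g (+ n)
sumTo-step zero    g = refl
sumTo-step (suc n) g = begin
  (sumTo n g⁺ + g⁺ (+ n)) + g 0ℤ ≡⟨ swap (sumTo n g⁺) (g⁺ (+ n)) (g 0ℤ) ⟩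
  (sumTo n g⁺ + g 0ℤ) + g⁺ (+ n) ≡⟨ cong₂ _+_ (sumTo-step n g) (cong g (+n+1 n)) ⟩
  sumTo (suc n) g + g (+ suc n)  ∎
  where
  open ≡-Reasoning
  g⁺ : ℤ → ℤ
  g⁺ z = g (z + 1ℤ)
  swap : ∀ a b c → (a + b) + c ≡ (a + c) + b
  swap = solve-∀

sumTo-head : ∀ n g → sumTo (suc n) g ≡ g 0ℤ + sumTo n (λ z → g (z + 1ℤ))
sumTo-head n g = trans (sym (sumTo-step n g)) (+-comm _ (g 0ℤ))

sumTo-split : ∀ m n g → sumTo (n ℕ.+ m) g ≡ sumTo m g + sumTo n (λ z → g (z + + m))
sumTo-split m zero    g = sym (+-identityʳ _)
sumTo-split m (suc n) g =
  trans (cong (_+ g (+ (n ℕ.+ m))) (sumTo-split m n g)) (+-assoc (sumTo m g) _ _)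

-- Periodic functions

Periodic : ℕ → (ℤ → ℤ) → Set
Periodic m f = ∀ x → f (x + + m) ≡ f x

ℤ-induction : (P : ℤ → Set) → P 0ℤ → (∀ x → P x → P (x + 1ℤ)) → (∀ x → P (x + 1ℤ) → P x) → ∀ x → P x
ℤ-induction P p0 up down (+ zero)  = p0
ℤ-induction P p0 up down (+ suc n) = subst P (+n+1 n) (up (+ n) (ℤ-induction P p0 up down (+ n)))
ℤ-induction P p0 up down -[1+ zero ]  = down -[1+ 0 ] p0
ℤ-induction P p0 up down -[1+ suc n ] = down -[1+ suc n ] (ℤ-induction P p0 up down -[1+ n ])

shift-invariant⇒const : ∀ {f : ℤ → ℤ} → (∀ x → f (x + 1ℤ) ≡ f x) → ∀ x → f x ≡ f 0ℤ
shift-invariant⇒const {f} inv = ℤ-induction (λ x → f x ≡ f 0ℤ) refl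
  (λ x eq → trans (inv x) eq) (λ x eq → trans (sym (inv x)) eq)

module _ {m : ℕ} {f : ℤ → ℤ} (per : Periodic m f) where

  periodic-* : ∀ x k → f (x + k * + m) ≡ f x
  periodic-* x = ℤ-induction (λ k → f (x + k * + m) ≡ f x)
    (cong f (+-identityʳ x))
    (λ k eq → trans (cong f (lem x k (+ m))) (trans (per _) eq))
    (λ k eq → trans (sym (trans (cong f (lem x k (+ m))) (per _))) eq)
    where
    lem : ∀ x k m → x + (k + 1ℤ) * m ≡ (x + k * m) + m
    lem = solve-∀

  periodic-≡ : ∀ {x y} → + m ∣ x - y → f x ≡ f y
  periodic-≡ {x} {y} (divides k eq) =
    trans (cong f (trans (lem x y) (cong (_+_ y) eq))) (periodic-* y k)
    where
    lem : ∀ x y → x ≡ y + (x - y)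
    lem = solve-∀

  -- Passing from `a` to `a + 1` drops the term `f a` and adds `f (a + m)`, the same by periodicity.
  -- This one step serves both directions of `ℤ-induction`.
  sumTo-shift : ∀ a → sumTo m (λ z → f (z + a)) ≡ sumTo m f
  sumTo-shift = ℤ-induction (λ a → sumTo m (λ z → f (z + a)) ≡ sumTo m f)
    (sumTo-cong m λ z → cong f (+-identityʳ z))
    (λ a eq → trans (step a) eq) (λ a eq → trans (sym (step a)) eq)
    where
    lem : ∀ z a → z + (a + 1ℤ) ≡ (z + 1ℤ) + a
    lem = solve-∀
    lem₂ : ∀ m a → m + a ≡ (0ℤ + a) + m
    lem₂ = solve-∀
    step : ∀ a → sumTo m (λ z → f (z + (a + 1ℤ))) ≡ sumTo m (λ z → f (z + a))
    step a = trans (sumTo-cong m λ z → cong f (lem z a))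
      (+-cancelʳ (f (0ℤ + a)) _ _
        (trans (sumTo-step m λ z → f (z + a))
          (cong (_+_ (sumTo m (λ z → f (z + a)))) (trans (cong f (lem₂ (+ m) a)) (per _)))))

  sumTo-reflect : sumTo m (λ z → f (- z)) ≡ sumTo m f
  sumTo-reflect = trans (reverse m) (sumTo-shift _)
    where
    lem : ∀ z n → (z + 1ℤ) + (1ℤ - (1ℤ + n)) ≡ z + (1ℤ - n)
    lem = solve-∀
    lem₂ : ∀ n → 0ℤ + (1ℤ - (1ℤ + n)) ≡ - n
    lem₂ = solve-∀
    -- Reversing the order of summation needs no periodicity. It leaves a translate by 1 - n, which
    -- `sumTo-shift` removes for n = m.
    reverse : ∀ n → sumTo n (λ z → f (- z)) ≡ sumTo n (λ z → f (z + (1ℤ - + n)))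
    reverse zero    = refl
    reverse (suc n) = begin
      sumTo n (λ z → f (- z)) + f (- + n)
        ≡⟨ +-comm _ (f (- + n)) ⟩
      f (- + n) + sumTo n (λ z → f (- z))
        ≡⟨ cong₂ _+_ (cong f (sym (lem₂ (+ n))))
             (trans (reverse n) (sumTo-cong n λ z → cong f (sym (lem z (+ n))))) ⟩
      f (0ℤ + (1ℤ - + suc n)) + sumTo n (λ z → f ((z + 1ℤ) + (1ℤ - + suc n)))
        ≡⟨ sumTo-head n (λ z → f (z + (1ℤ - + suc n))) ⟨
      sumTo (suc n) (λ z → f (z + (1ℤ - + suc n))) ∎
      where open ≡-Reasoning

periodic-+ : ∀ {m f g} → Periodic m f → Periodic m g → Periodic m (λ x → f x + g x)
periodic-+ pf pg x = cong₂ _+_ (pf x) (pg x)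

periodic-shift : ∀ {m f} → Periodic m f → ∀ a → Periodic m (λ x → f (x + a))
periodic-shift {m} {f} pf a x = trans (cong f (lem x (+ m) a)) (pf _)
  where
  lem : ∀ x m a → (x + m) + a ≡ (x + a) + m
  lem = solve-∀

periodic-- : ∀ {m f} → Periodic m f → Periodic m (λ x → f (- x))
periodic-- {m} {f} pf x = sym (trans (cong f (lem x (+ m))) (pf _))
  where
  lem : ∀ x m → - x ≡ - (x + m) + m
  lem = solve-∀

-- Convolutions, and the indicator δ m p of the class of p modulo m

conv : ℕ → (ℤ → ℤ) → (ℤ → ℤ) → ℤ → ℤ
conv m f w a = sumTo m (λ c → f c * w (a + c))

opaque
  δ : ℕ → ℤ → ℤ → ℤ
  δ m p z = if does (+ m ∣? z - p) then 1ℤ else 0ℤ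

  δ-yes : ∀ {m p z} → + m ∣ z - p → δ m p z ≡ 1ℤ
  δ-yes {m} {p} {z} d = cong (if_then 1ℤ else 0ℤ) (dec-true (+ m ∣? z - p) d)

  δ-no : ∀ {m p z} → ¬ + m ∣ z - p → δ m p z ≡ 0ℤ
  δ-no {m} {p} {z} d = cong (if_then 1ℤ else 0ℤ) (dec-false (+ m ∣? z - p) d)

∣0 : ∀ {m} x → m ∣ x - x
∣0 x = divides 0ℤ (+-inverseʳ x)

δ-self : ∀ m p → δ m p p ≡ 1ℤ
δ-self m p = δ-yes (∣0 p)

δ-periodic : ∀ m p → Periodic m (δ m p)
δ-periodic m p z = by-cases (+ m ∣? z - p)
  where
  lem : ∀ z p m → (z - p) + m ≡ (z + m) - p
  lem = solve-∀
  lem₂ : ∀ z p m → ((z + m) - p) - m ≡ z - p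
  lem₂ = solve-∀
  by-cases : Dec (+ m ∣ z - p) → δ m p (z + + m) ≡ δ m p z
  by-cases (yes d) = trans (δ-yes (subst (+ m ∣_) (lem z p (+ m)) (∣m∣n⇒∣m+n d ∣-refl))) (sym (δ-yes d))
  by-cases (no ¬d) = trans
    (δ-no λ d → ¬d (subst (+ m ∣_) (lem₂ z p (+ m)) (∣m∣n⇒∣m-n d ∣-refl))) (sym (δ-no ¬d))

conv-congʳ : ∀ m f {v w} → (∀ x → v x ≡ w x) → ∀ a → conv m f v a ≡ conv m f w a
conv-congʳ m f eq a = sumTo-cong m λ c → cong (f c *_) (eq _)

conv-congˡ : ∀ m {f g} w → (∀ x → f x ≡ g x) → ∀ a → conv m f w a ≡ conv m g w a
conv-congˡ m w eq a = sumTo-cong m λ c → cong (_* w _) (eq c)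

conv-+ˡ : ∀ m f g w a → conv m (λ x → f x + g x) w a ≡ conv m f w a + conv m g w a
conv-+ˡ m f g w a = trans (sumTo-cong m λ c → *-distribʳ-+ (w (a + c)) (f c) (g c)) (sumTo-+ m _ _)

conv-+ʳ : ∀ m f v w a → conv m f (λ x → v x + w x) a ≡ conv m f v a + conv m f w a
conv-+ʳ m f v w a = trans (sumTo-cong m λ c → *-distribˡ-+ (f c) (v (a + c)) (w (a + c))) (sumTo-+ m _ _)

conv-*ˡ : ∀ m k f w a → conv m (λ x → k * f x) w a ≡ k * conv m f w a
conv-*ˡ m k f w a = trans (sumTo-cong m λ c → *-assoc k (f c) (w (a + c))) (sumTo-* m k _)

conv-*ʳ : ∀ m k f w a → conv m f (λ x → k * w x) a ≡ k * conv m f w a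
conv-*ʳ m k f w a = trans (sumTo-cong m λ c → lem (f c) k (w (a + c))) (sumTo-* m k _)
  where
  lem : ∀ a b c → a * (b * c) ≡ b * (a * c)
  lem = solve-∀

conv-shift : ∀ m f w b a → conv m f (λ x → w (x + b)) a ≡ conv m f w (a + b)
conv-shift m f w b a = sumTo-cong m λ c → cong (λ z → f c * w z) (lem a c b)
  where
  lem : ∀ a c b → (a + c) + b ≡ (a + b) + c
  lem = solve-∀

-- Starting the period at `p` instead of 0 puts the only nonzero term first; the others sit at p +
-- 1, ..., p + m - 1, where the indicator vanishes.
conv-δ : ∀ m .{{_ : NonZero m}} p {w} → Periodic m w → ∀ a → conv m (δ m p) w a ≡ w (a + p)
conv-δ m@(suc k) p {w} pw a = begin
  sumTo m g                        ≡⟨ sumTo-shift g-periodic p ⟨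
  sumTo m (λ z → g (z + p))        ≡⟨ sumTo-head k (λ z → g (z + p)) ⟩
  g (0ℤ + p) + sumTo k (λ z → g ((z + 1ℤ) + p))
    ≡⟨ cong₂ _+_ head (trans (sumTo-cong< k tail) (sumTo-zero k)) ⟩
  w (a + p) + 0ℤ                   ≡⟨ +-identityʳ _ ⟩
  w (a + p)                        ∎
  where
  open ≡-Reasoning
  g : ℤ → ℤ
  g c = δ m p c * w (a + c)
  lem₁ : ∀ a x m → a + (x + m) ≡ (a + x) + m
  lem₁ = solve-∀
  g-periodic : Periodic m g
  g-periodic x = cong₂ _*_ (δ-periodic m p x) (trans (cong w (lem₁ a x (+ m))) (pw _))
  head : g (0ℤ + p) ≡ w (a + p)
  head = trans (cong g (+-identityˡ p)) (trans (cong (_* w (a + p)) (δ-self m p)) (*-identityˡ _))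
  lem₂ : ∀ z p → ((z + 1ℤ) + p) - p ≡ z + 1ℤ
  lem₂ = solve-∀
  tail : ∀ i → i ℕ.< k → g ((+ i + 1ℤ) + p) ≡ 0ℤ
  tail i i<k = cong (_* w (a + ((+ i + 1ℤ) + p))) (δ-no λ d →
    ℕ.<⇒≱ (ℕ.s<s i<k) (ℕ∣.∣⇒≤ (∣⇒∣ᵤ (subst (+ m ∣_) (trans (lem₂ (+ i) p) (+n+1 i)) d))))

conv-periodic : ∀ m f {w n} → Periodic n w → Periodic n (conv m f w)
conv-periodic m f {w} {n} pw a = trans (sym (conv-shift m f w (+ n) a)) (conv-congʳ m f pw a)

-- After exchanging the sums, each inner sum is a translate of `w` over a full period. Equations
-- between convolutions thus become equations between sizes, from which the vanishing of sums over a
-- period is derived.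
sumTo-conv : ∀ n m f {w} → Periodic n w → sumTo n (conv m f w) ≡ sumTo m f * sumTo n w
sumTo-conv n m f {w} pw = begin
  sumTo n (λ a → sumTo m (λ c → f c * w (a + c)))  ≡⟨ sumTo-swap n m (λ a c → f c * w (a + c)) ⟩
  sumTo m (λ c → sumTo n (λ a → f c * w (a + c)))
    ≡⟨ sumTo-cong m (λ c → trans (sumTo-* n (f c) _) (cong (f c *_) (sumTo-shift pw c))) ⟩
  sumTo m (λ c → f c * sumTo n w)                  ≡⟨ sumTo-cong m (λ c → *-comm (f c) _) ⟩
  sumTo m (λ c → sumTo n w * f c)                  ≡⟨ sumTo-* m (sumTo n w) f ⟩
  sumTo n w * sumTo m f                            ≡⟨ *-comm (sumTo n w) _ ⟩
  sumTo m f * sumTo n w                            ∎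
  where open ≡-Reasoning

conv-reflect : ∀ m {f w} → Periodic m f → Periodic m w →
  ∀ a → sumTo m (λ c → f c * w (a - c)) ≡ conv m (λ c → f (- c)) w a
conv-reflect m {f} {w} pf pw a = trans
  (sumTo-cong m λ c → cong (λ z → f z * w (a - c)) (sym (neg-involutive c)))
  (sumTo-reflect {f = λ c → f (- c) * w (a + c)} λ c →
    cong₂ _*_ (periodic-- pf c) (trans (cong w (sym (+-assoc a c (+ m)))) (pw _)))

-- An h-periodic `f` describes a union of cosets of {0 , h}, which sees only `w` folded along the
-- shift by `h`. The fold is 0 if `w` is antiperiodic and 2 w if `w` is h-periodic.
conv-double : ∀ h {f} → Periodic h f → ∀ w a →
  conv (h ℕ.+ h) f w a ≡ conv h f (λ z → w z + w (z + + h)) a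
conv-double h {f} pf w a = trans (sumTo-split h h _)
  (trans (cong (_+_ (conv h f w a)) (sumTo-cong h λ c → cong₂ _*_ (pf c) (cong w (sym (+-assoc a c (+ h))))))
    (sym (conv-+ʳ h f w (λ z → w (z + + h)) a)))

sumTo-δ : ∀ m .{{_ : NonZero m}} p → sumTo m (δ m p) ≡ 1ℤ
sumTo-δ m p = trans (sumTo-cong m λ c → sym (*-identityʳ (δ m p c)))
  (conv-δ m p {λ _ → 1ℤ} (λ _ → refl) 0ℤ)

-- Infinite descent

2ℤ : ℤ
2ℤ = + 2

double-cancel : ∀ {x y} → 2ℤ * x ≡ 2ℤ * y → x ≡ y
double-cancel {x} {y} = *-cancelˡ-≡ 2ℤ x y

2m≤1+n⇒m≤n : ∀ m n → 2 ℕ.* m ℕ.≤ suc n → m ℕ.≤ n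
2m≤1+n⇒m≤n zero    n le = ℕ.z≤n
2m≤1+n⇒m≤n (suc m) n (ℕ.s≤s le) = ℕ.≤-trans (ℕ.≤-trans (ℕ.m≤n+m (suc m) m) (ℕ.≤-reflexive (cong (m ℕ.+_) (sym (ℕ.+-identityʳ (suc m)))))) le

-- At a fixed `x` every round halves the absolute value of `w x`, so a bound for it runs out. The
-- predicate `Φ` is carried along because the halved function must again be divisible by 2.
descent : (Φ : (ℤ → ℤ) → Set) →
  (∀ w → Φ w → Σ (ℤ → ℤ) λ w′ → (∀ x → w x ≡ 2ℤ * w′ x) × Φ w′) →
  ∀ w → Φ w → ∀ x → w x ≡ 0ℤ
descent Φ halve w φ x = bounded ∣ w x ∣ w φ ℕ.≤-refl
  where
  bounded : ∀ n w → Φ w → ∣ w x ∣ ℕ.≤ n → w x ≡ 0ℤ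
  bounded zero    w φ le = ∣i∣≡0⇒i≡0 (ℕ.n≤0⇒n≡0 le)
  bounded (suc n) w φ le with halve w φ
  ... | w′ , eq , φ′ = trans (eq x) (trans (cong (2ℤ *_) (bounded n w′ φ′ w′x≤n)) (*-zeroʳ 2ℤ))
    where
    w′x≤n : ∣ w′ x ∣ ℕ.≤ n
    w′x≤n = 2m≤1+n⇒m≤n ∣ w′ x ∣ n
      (subst (ℕ._≤ suc n) (trans (cong ∣_∣ (eq x)) (abs-* 2ℤ (w′ x))) le)

telescope : ∀ (w : ℤ → ℤ) n a → w a - w (a + + n) ≡ sumTo n (λ i → w (a + i) - w (a + i + 1ℤ))
telescope w zero    a = trans (cong (λ z → w a - w z) (+-identityʳ a)) (+-inverseʳ (w a))
telescope w (suc n) a = begin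
  w a - w (a + + suc n)
    ≡⟨ cong (λ z → w a - w z) (trans (cong (_+_ a) (sym (+n+1 n))) (sym (+-assoc a (+ n) 1ℤ))) ⟩
  w a - w (a + + n + 1ℤ)
    ≡⟨ lem (w a) (w (a + + n)) (w (a + + n + 1ℤ)) ⟩
  (w a - w (a + + n)) + (w (a + + n) - w (a + + n + 1ℤ))
    ≡⟨ cong (_+ (w (a + + n) - w (a + + n + 1ℤ))) (telescope w n a) ⟩
  sumTo (suc n) (λ i → w (a + i) - w (a + i + 1ℤ)) ∎
  where
  open ≡-Reasoning
  lem : ∀ x y z → x - z ≡ (x - y) + (y - z)
  lem = solve-∀

nonZero⇒≢0 : ∀ n .{{_ : NonZero n}} → + n ≢ 0ℤ
nonZero⇒≢0 (suc n) ()

nonZero-product : ∀ {x y} → x ≢ 0ℤ → x * y ≡ 0ℤ → y ≡ 0ℤ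
nonZero-product {x} x≢0 eq with i*j≡0⇒i≡0∨j≡0 x eq
... | inj₁ x≡0 = ⊥-elim (x≢0 x≡0)
... | inj₂ y≡0 = y≡0

-- The two equations on h-periodic functions

module _ (h : ℕ) .{{_ : NonZero h}} (f U V : ℤ → ℤ) (y : ℕ) (η : ℤ)
  (Σf≢0 : sumTo h f ≢ 0ℤ) (η² : η * η ≡ 1ℤ)
  (perU : Periodic h U) (perV : Periodic h V)
  (eqV : ∀ a → 2ℤ * conv h f (λ z → U z + V z) a + η * (V (a - + y) - V (a - + y - 1ℤ)) ≡ 0ℤ)
  (eqU : ∀ a → 2ℤ * conv h f (λ z → U z + V z) a + η * (U (a + + y) - U (a + + y + 1ℤ)) ≡ 0ℤ)
  where

  private
    s K r : ℤ → ℤ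
    s z = U z + V z
    K a = V (a - + y - 1ℤ) + U (a + + y)
    r z = U z - U (z + 1ℤ)

    per-s : Periodic h s
    per-s = periodic-+ perU perV

    unit-solve : ∀ x z → x + η * z ≡ 0ℤ → z ≡ - (η * x)
    unit-solve x z eq = begin
      z                            ≡⟨ *-identityˡ z ⟨
      1ℤ * z                       ≡⟨ cong (_* z) η² ⟨
      (η * η) * z                  ≡⟨ lem η x z ⟩
      η * (x + η * z) - η * x      ≡⟨ cong (λ t → η * t - η * x) eq ⟩
      η * 0ℤ - η * x               ≡⟨ cong (_- η * x) (*-zeroʳ η) ⟩
      0ℤ - η * x                   ≡⟨ +-identityˡ _ ⟩
      - (η * x)                    ∎
      where
      open ≡-Reasoning
      lem : ∀ e x z → (e * e) * z ≡ e * (x + e * z) - e * x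
      lem = solve-∀

    -- Subtracting the two equations cancels the convolution; as `η` is a unit, what is left
    -- compares `K` at `a` and at `a + 1`.
    K-invariant : ∀ a → K (a + 1ℤ) ≡ K a
    K-invariant a = begin
      V (a + 1ℤ - + y - 1ℤ) + U (a + 1ℤ + + y)
        ≡⟨ cong₂ (λ p q → V p + U q) (lem₁ a (+ y)) (lem₂ a (+ y)) ⟩
      V (a - + y) + U (a + + y + 1ℤ)
        ≡⟨ lem₃ (V (a - + y)) (V (a - + y - 1ℤ)) (U (a + + y + 1ℤ)) ⟩
      (V (a - + y) - V (a - + y - 1ℤ)) + (V (a - + y - 1ℤ) + U (a + + y + 1ℤ))
        ≡⟨ cong (_+ (V (a - + y - 1ℤ) + U (a + + y + 1ℤ)))
             (trans (unit-solve (2ℤ * conv h f s a) _ (eqV a)) (sym (unit-solve (2ℤ * conv h f s a) _ (eqU a)))) ⟩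
      (U (a + + y) - U (a + + y + 1ℤ)) + (V (a - + y - 1ℤ) + U (a + + y + 1ℤ))
        ≡⟨ lem₄ (U (a + + y)) (U (a + + y + 1ℤ)) (V (a - + y - 1ℤ)) ⟩
      K a ∎
      where
      open ≡-Reasoning
      lem₁ : ∀ a y → a + 1ℤ - y - 1ℤ ≡ a - y
      lem₁ = solve-∀
      lem₂ : ∀ a y → a + 1ℤ + y ≡ a + y + 1ℤ
      lem₂ = solve-∀
      lem₃ : ∀ a b c → a + c ≡ (a - b) + (b + c)
      lem₃ = solve-∀
      lem₄ : ∀ a b c → (a - b) + (c + b) ≡ c + a
      lem₄ = solve-∀

    -- Over a full period the difference of two translates of `U` sums to 0, so `eqU` sums to 2 (Σ
    -- f) (Σ s) = 0. This is where Σ f ≢ 0 enters.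
    Σs≡0 : sumTo h s ≡ 0ℤ
    Σs≡0 = nonZero-product Σf≢0 (double-cancel (begin
      2ℤ * (sumTo h f * sumTo h s)
        ≡⟨ cong (2ℤ *_) (sumTo-conv h h f per-s) ⟨
      2ℤ * sumTo h (conv h f s)
        ≡⟨ lem _ η (sumTo h U) ⟩
      2ℤ * sumTo h (conv h f s) + η * (sumTo h U + - 1ℤ * sumTo h U)
        ≡⟨ cong₂ (λ p q → 2ℤ * sumTo h (conv h f s) + η * (p + - 1ℤ * q))
             (sumTo-shift perU (+ y)) (sumTo-shift perU (+ y + 1ℤ)) ⟨
      2ℤ * sumTo h (conv h f s) + η * (sumTo h (λ a → U (a + + y)) + - 1ℤ * sumTo h (λ a → U (a + (+ y + 1ℤ))))
        ≡⟨ cong (λ p → 2ℤ * sumTo h (conv h f s) + η * (sumTo h (λ a → U (a + + y)) + p)) (sumTo-* h (- 1ℤ) _) ⟨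
      2ℤ * sumTo h (conv h f s) + η * (sumTo h (λ a → U (a + + y)) + sumTo h (λ a → - 1ℤ * U (a + (+ y + 1ℤ))))
        ≡⟨ cong₂ (λ p q → p + η * q) (sumTo-* h 2ℤ _) (sumTo-+ h _ _) ⟨
      sumTo h (λ a → 2ℤ * conv h f s a) + η * sumTo h (λ a → U (a + + y) + - 1ℤ * U (a + (+ y + 1ℤ)))
        ≡⟨ cong (_+_ (sumTo h (λ a → 2ℤ * conv h f s a))) (sumTo-* h η _) ⟨
      sumTo h (λ a → 2ℤ * conv h f s a) + sumTo h (λ a → η * (U (a + + y) + - 1ℤ * U (a + (+ y + 1ℤ))))
        ≡⟨ sumTo-+ h _ _ ⟨
      sumTo h (λ a → 2ℤ * conv h f s a + η * (U (a + + y) + - 1ℤ * U (a + (+ y + 1ℤ))))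
        ≡⟨ sumTo-cong h (λ a → trans (cong (λ p → 2ℤ * conv h f s a + η * (U (a + + y) + p))
             (trans (-1*i≡-i _) (cong (λ z → - U z) (sym (+-assoc a (+ y) 1ℤ))))) (eqU a)) ⟩
      sumTo h (λ _ → 0ℤ) ≡⟨ sumTo-zero h ⟩
      0ℤ                 ≡⟨⟩
      2ℤ * 0ℤ            ∎))
      where
      open ≡-Reasoning
      lem : ∀ a e x → 2ℤ * a ≡ 2ℤ * a + e * (x + - 1ℤ * x)
      lem = solve-∀

    K≡0 : ∀ a → K a ≡ 0ℤ
    K≡0 a = trans (shift-invariant⇒const K-invariant a) (nonZero-product (nonZero⇒≢0 h) (begin
      + h * K 0ℤ         ≡⟨ sumTo-const h (K 0ℤ) ⟨
      sumTo h (λ _ → K 0ℤ) ≡⟨ sumTo-cong h (shift-invariant⇒const K-invariant) ⟨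
      sumTo h K          ≡⟨ sumTo-+ h _ _ ⟩
      sumTo h (λ a → V (a - + y - 1ℤ)) + sumTo h (λ a → U (a + + y))
        ≡⟨ cong₂ _+_ (trans (sumTo-cong h λ a → cong V (+-assoc a (- + y) (- 1ℤ))) (sumTo-shift perV _)) (sumTo-shift perU _) ⟩
      sumTo h V + sumTo h U ≡⟨ +-comm (sumTo h V) _ ⟩
      sumTo h U + sumTo h V ≡⟨ sumTo-+ h U V ⟨
      sumTo h s          ≡⟨ Σs≡0 ⟩
      0ℤ                 ∎))
      where
      open ≡-Reasoning

    -- The distance between the two arguments in `K`: (a + y) - (a - y - 1) = 2 y + 1.
    N : ℕ
    N = y ℕ.+ suc y

    V≡-U : ∀ a → V a ≡ - U (a + + N)
    V≡-U a = begin
      V a ≡⟨ lem₃ (V a) (U (a + + N)) ⟩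
      (V a + U (a + + N)) - U (a + + N)
        ≡⟨ cong₂ (λ p q → (V p + U q) - U (a + + N)) (lem₁ a (+ y)) (lem₂ a (+ y)) ⟩
      K (a + + suc y) - U (a + + N)
        ≡⟨ cong (_- U (a + + N)) (K≡0 (a + + suc y)) ⟩
      0ℤ - U (a + + N) ≡⟨ +-identityˡ _ ⟩
      - U (a + + N) ∎
      where
      open ≡-Reasoning
      lem₁ : ∀ a y → a ≡ a + (1ℤ + y) - y - 1ℤ
      lem₁ = solve-∀
      lem₂ : ∀ a y → a + (y + (1ℤ + y)) ≡ a + (1ℤ + y) + y
      lem₂ = solve-∀
      lem₃ : ∀ a b → a ≡ (a + b) - b
      lem₃ = solve-∀

    -- Now V is eliminated, and r = U - S U satisfies r = 2 M r.
    windowed : (ℤ → ℤ) → ℤ → ℤ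
    windowed g x = sumTo N (λ i → g (x + i))

    M : (ℤ → ℤ) → ℤ → ℤ
    M g a = - (η * conv h f (windowed g) (a - + y))

    M-double : ∀ g g′ → (∀ x → g x ≡ 2ℤ * g′ x) → ∀ x → M g x ≡ 2ℤ * M g′ x
    M-double g g′ eq x = trans (cong (λ t → - (η * t)) (trans
      (conv-congʳ h f (λ z → trans (sumTo-cong N λ i → eq (z + i)) (sumTo-* N 2ℤ _)) (x - + y))
      (conv-*ʳ h 2ℤ f (windowed g′) (x - + y)))) (lem η _)
      where
      lem : ∀ e t → - (e * (2ℤ * t)) ≡ 2ℤ * (- (e * t))
      lem = solve-∀

    -- With `V` replaced, `s` is U x - U (x + N), which telescopes into `N` consecutive differences.
    s≡windowed-r : ∀ x → s x ≡ windowed r x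
    s≡windowed-r x = trans (cong (_+_ (U x)) (V≡-U x)) (telescope U N x)

    r≡2Mr : ∀ x → r x ≡ 2ℤ * M r x
    r≡2Mr x = begin
      U x - U (x + 1ℤ)
        ≡⟨ cong (λ z → U z - U (z + 1ℤ)) (lem x (+ y)) ⟩
      U (x - + y + + y) - U (x - + y + + y + 1ℤ)
        ≡⟨ unit-solve (2ℤ * conv h f s (x - + y)) _ (eqU (x - + y)) ⟩
      - (η * (2ℤ * conv h f s (x - + y)))
        ≡⟨ lem₂ η _ ⟩
      2ℤ * - (η * conv h f s (x - + y))
        ≡⟨ cong (λ t → 2ℤ * - (η * t)) (conv-congʳ h f s≡windowed-r (x - + y)) ⟩
      2ℤ * M r x ∎
      where
      open ≡-Reasoning
      lem : ∀ x y → x ≡ x - y + y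
      lem = solve-∀
      lem₂ : ∀ e t → - (e * (2ℤ * t)) ≡ 2ℤ * (- (e * t))
      lem₂ = solve-∀

    -- `M` commutes with doubling, so if r = 2 M r then `M r` solves the same equation, and it is
    -- half of `r`.
    r≡0 : ∀ x → r x ≡ 0ℤ
    r≡0 = descent (λ r → ∀ x → r x ≡ 2ℤ * M r x)
      (λ r φ → M r , φ , M-double r (M r) φ) r r≡2Mr

  coset-kernel-U : ∀ a → U a ≡ U 0ℤ
  coset-kernel-U = shift-invariant⇒const λ x → sym (i-j≡0⇒i≡j (U x) _ (r≡0 x))

  coset-kernel-V : ∀ a → V a ≡ - U 0ℤ
  coset-kernel-V a = trans (V≡-U a) (cong -_ (coset-kernel-U _))

-- Correlation, the adjoint of convolution, and the data of a nut graph

corr : ℕ → (ℤ → ℤ) → (ℤ → ℤ) → ℤ → ℤ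
corr m f w a = sumTo m (λ c → f c * w (a - c))

corr≡conv : ∀ m f w a → corr m f w a ≡ conv m f (w ∘ -_) (- a)
corr≡conv m f w a = sumTo-cong m λ c → cong (λ z → f c * w z) (lem a c)
  where
  lem : ∀ a c → a - c ≡ - (- a + c)
  lem = solve-∀

corr-even : ∀ m {f w} → Periodic m f → (∀ z → f (- z) ≡ f z) → Periodic m w →
  ∀ a → corr m f w a ≡ conv m f w a
corr-even m {f} {w} pf ev pw a = trans (conv-reflect m pf pw a) (conv-congˡ m w ev a)

corr-δ : ∀ m .{{_ : NonZero m}} p {w} → Periodic m w → ∀ a → corr m (δ m p) w a ≡ w (a - p)
corr-δ m p {w} pw a = trans (corr≡conv m (δ m p) w a)
  (trans (conv-δ m p (periodic-- pw) (- a)) (cong w (lem a p)))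
  where
  lem : ∀ a p → - (- a + p) ≡ a - p
  lem = solve-∀

corr-+ˡ : ∀ m f g w a → corr m (λ x → f x + g x) w a ≡ corr m f w a + corr m g w a
corr-+ˡ m f g w a = trans (sumTo-cong m λ c → *-distribʳ-+ (w (a - c)) (f c) (g c)) (sumTo-+ m _ _)

corr-*ˡ : ∀ m k f w a → corr m (λ x → k * f x) w a ≡ k * corr m f w a
corr-*ˡ m k f w a = trans (sumTo-cong m λ c → *-assoc k (f c) (w (a - c))) (sumTo-* m k _)

corr-congˡ : ∀ m {f g} w → (∀ x → f x ≡ g x) → ∀ a → corr m f w a ≡ corr m g w a
corr-congˡ m w eq a = sumTo-cong m λ c → cong (_* w _) (eq c)

-- Indicators are integer-valued, so that inserting a point is adding `δ`, sizes are sums, and a set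
-- acts on functions by `conv`.
record Subset (m : ℕ) : Set where
  field
    ind      : ℤ → ℤ
    periodic : Periodic m ind
    zero-one : ∀ z → ind z ≡ 0ℤ ⊎ ind z ≡ 1ℤ

  size : ℤ
  size = sumTo m ind

open Subset public

-- Only real characters, with values ± 1, occur. Such a χ is even, hence has the same eigenvalue
-- under `conv` and `corr`, and it has no zero.
record Character (m : ℕ) : Set where
  field
    χ     : ℤ → ℤ
    χ-+   : ∀ x y → χ (x + y) ≡ χ x * χ y
    χ²    : ∀ x → χ x * χ x ≡ 1ℤ
    χ-per : Periodic m χ

  χ-0 : χ 0ℤ ≡ 1ℤ
  χ-0 = trans (χ-+ 0ℤ 0ℤ) (χ² 0ℤ)

  χ-neg : ∀ x → χ (- x) ≡ χ x
  χ-neg x = begin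
    χ (- x)               ≡⟨ *-identityʳ _ ⟨
    χ (- x) * 1ℤ          ≡⟨ cong (χ (- x) *_) (χ² x) ⟨
    χ (- x) * (χ x * χ x) ≡⟨ *-assoc (χ (- x)) (χ x) (χ x) ⟨
    χ (- x) * χ x * χ x   ≡⟨ cong (_* χ x) (χ-+ (- x) x) ⟨
    χ (- x + x) * χ x     ≡⟨ cong (λ z → χ z * χ x) (+-inverseˡ x) ⟩
    χ 0ℤ * χ x            ≡⟨ cong (_* χ x) χ-0 ⟩
    1ℤ * χ x              ≡⟨ *-identityˡ _ ⟩
    χ x                   ∎
    where open ≡-Reasoning

-- (χ , - χ) spans the kernel of [[A, B*], [B, A]]: in the graph, u lives on the
-- rotations, and v z is the value at the reflection r⁻ᶻ s.
record NutPair (m : ℕ) (d : ℕ) : Set where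
  field
    A B       : Subset m
    A-even    : ∀ z → ind A (- z) ≡ ind A z
    0∉A       : ind A 0ℤ ≡ 0ℤ
    sizes     : size A + size B ≡ + d
    character : Character m
  open Character character public
  field
    balance   : conv m (ind A) χ 0ℤ ≡ conv m (ind B) χ 0ℤ
    unique    : ∀ u v → Periodic m u → Periodic m v →
      (∀ a → conv m (ind A) u a + corr m (ind B) v a ≡ 0ℤ) →
      (∀ a → conv m (ind B) u a + conv m (ind A) v a ≡ 0ℤ) →
      ∀ a → u a ≡ χ a * u 0ℤ × v a ≡ - (χ a * u 0ℤ)

-- Splitting along the shift by half a period

Antiperiodic : ℕ → (ℤ → ℤ) → Set
Antiperiodic h w = ∀ x → w (x + + h) ≡ - w x

module Halves (h : ℕ) where

  infix 9 _⁺ _⁻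
  _⁺ _⁻ : (ℤ → ℤ) → ℤ → ℤ
  (w ⁺) z = w z + w (z + + h)
  (w ⁻) z = w z - w (z + + h)

  module _ {w : ℤ → ℤ} (pw : Periodic (h ℕ.+ h) w) where

    wrap : ∀ z → w (z + + h + + h) ≡ w z
    wrap z = trans (cong w (+-assoc z (+ h) (+ h))) (pw z)

    ⁺-periodic : Periodic h (w ⁺)
    ⁺-periodic z = trans (cong (_+_ (w (z + + h))) (wrap z)) (+-comm (w (z + + h)) (w z))

    ⁻-antiperiodic : Antiperiodic h (w ⁻)
    ⁻-antiperiodic z = trans (cong (λ t → w (z + + h) - t) (wrap z)) (lem (w (z + + h)) (w z))
      where
      lem : ∀ a b → a - b ≡ - (b - a)
      lem = solve-∀

  halves : ∀ (w : ℤ → ℤ) z → 2ℤ * w z ≡ (w ⁺) z + (w ⁻) z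
  halves w z = lem (w z) (w (z + + h))
    where
    lem : ∀ a b → 2ℤ * a ≡ (a + b) + (a - b)
    lem = solve-∀

  periodic-double : ∀ {w} → Periodic h w → Periodic (h ℕ.+ h) w
  periodic-double {w} pw z = trans (cong w (sym (+-assoc z (+ h) (+ h)))) (trans (pw _) (pw z))

  anti-const⇒0 : ∀ {w} → Antiperiodic h w → (∀ x → w (x + 1ℤ) ≡ w x) → ∀ x → w x ≡ 0ℤ
  anti-const⇒0 {w} anti inv x = double-cancel (begin
    2ℤ * w x              ≡⟨ lem (w x) ⟩
    w x - - w x           ≡⟨ cong (λ t → w x - t) (anti x) ⟨
    w x - w (x + + h)     ≡⟨ cong₂ _-_ (const x) (const (x + + h)) ⟩
    w 0ℤ - w 0ℤ           ≡⟨ +-inverseʳ (w 0ℤ) ⟩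
    0ℤ                    ∎)
    where
    open ≡-Reasoning
    const = shift-invariant⇒const inv
    lem : ∀ a → 2ℤ * a ≡ a - - a
    lem = solve-∀

-- τ is a shift by one, up to the sign ε on antiperiodic functions.
data Twist (h : ℕ) : (ε τ : ℤ) → Set where
  straight : Twist h 1ℤ 1ℤ
  twisted  : Twist h -1ℤ (1ℤ + + h)

twist² : ∀ {h ε τ} → Twist h ε τ → ε * ε ≡ 1ℤ
twist² straight = refl
twist² twisted  = refl

twist⁺ : ∀ {h ε τ} → Twist h ε τ → ∀ {w} → Periodic h w → ∀ z → w (z + τ) ≡ w (z + 1ℤ)
twist⁺ straight pw z = refl
twist⁺ {h} twisted {w} pw z = trans (cong w (sym (+-assoc z 1ℤ (+ h)))) (pw (z + 1ℤ))

twist⁻ : ∀ {h ε τ} → Twist h ε τ → ∀ {w} → Antiperiodic h w → ∀ z → ε * w (z + τ) ≡ w (z + 1ℤ)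
twist⁻ straight aw z = *-identityˡ _
twist⁻ {h} twisted {w} aw z = begin
  -1ℤ * w (z + (1ℤ + + h)) ≡⟨ -1*i≡-i _ ⟩
  - w (z + (1ℤ + + h))     ≡⟨ cong (λ x → - w x) (+-assoc z 1ℤ (+ h)) ⟨
  - w (z + 1ℤ + + h)       ≡⟨ cong -_ (aw (z + 1ℤ)) ⟩
  - - w (z + 1ℤ)           ≡⟨ neg-involutive _ ⟩
  w (z + 1ℤ)               ∎
  where open ≡-Reasoning

module _ {h ε τ} (t : Twist h ε τ) where

  back₁ : ∀ z → z - τ - 1ℤ + 1ℤ ≡ z - τ
  back₁ z = lem z τ
    where
    lem : ∀ z t → z - t - 1ℤ + 1ℤ ≡ z - t
    lem = solve-∀

  back₂ : ∀ z → z - τ - 1ℤ + τ ≡ z - 1ℤ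
  back₂ z = lem z τ
    where
    lem : ∀ z t → z - t - 1ℤ + t ≡ z - 1ℤ
    lem = solve-∀

  -- The rule for a forward step, read at z - τ - 1.
  untwist⁺ : ∀ {w} → Periodic h w → ∀ z → w (z - τ) ≡ w (z - 1ℤ)
  untwist⁺ {w} pw z = trans (cong w (sym (back₁ z)))
    (trans (sym (twist⁺ t pw (z - τ - 1ℤ))) (cong w (back₂ z)))

  untwist⁻ : ∀ {w} → Antiperiodic h w → ∀ z → ε * w (z - τ) ≡ w (z - 1ℤ)
  untwist⁻ {w} aw z = begin
    ε * w (z - τ)            ≡⟨ cong (λ x → ε * w x) (back₁ z) ⟨
    ε * w (z - τ - 1ℤ + 1ℤ)  ≡⟨ cong (ε *_) (twist⁻ t aw (z - τ - 1ℤ)) ⟨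
    ε * (ε * w (z - τ - 1ℤ + τ)) ≡⟨ *-assoc ε ε _ ⟨
    ε * ε * w (z - τ - 1ℤ + τ)   ≡⟨ cong (_* w (z - τ - 1ℤ + τ)) (twist² t) ⟩
    1ℤ * w (z - τ - 1ℤ + τ)      ≡⟨ *-identityˡ _ ⟩
    w (z - τ - 1ℤ + τ)           ≡⟨ cong w (back₂ z) ⟩
    w (z - 1ℤ)                   ∎
    where open ≡-Reasoning

-- Unions of cosets, changed in two points

+-nonZero : ∀ h .{{_ : NonZero h}} → NonZero (h ℕ.+ h)
+-nonZero (suc h) = _

-- For ε = 1 the set `B` exchanges one point of `A` for another; for ε = -1 it has two points more
-- (η = 1) or less (η = -1). With S the shift by 1, the extra operator is η S^y (1 - ε S^τ). The
-- twist makes 1 - ε S^τ equal to 1 - S on antiperiodic functions. On h-periodic ones it is 1 - ε S,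
-- and multiplication by a character with value `ε` at 1 conjugates this to 1 - S. `unbalanced` is
-- the condition Σ f ≢ 0 of the elimination after this conjugation.
module CosetFamily
  (h : ℕ) .{{_ : NonZero h}} (E : Subset h)
  (E-even : ∀ z → ind E (- z) ≡ ind E z) (0∉E : ind E 0ℤ ≡ 0ℤ)
  {ε τ : ℤ} (twist : Twist h ε τ) (y : ℕ) (η : ℤ) (η² : η * η ≡ 1ℤ)
  (ψ : Character h) (ψ-1 : Character.χ ψ 1ℤ ≡ ε)
  (unbalanced : sumTo h (λ z → Character.χ ψ z * ind E z) ≢ 0ℤ)
  (B : Subset (h ℕ.+ h))
  (B-def : ∀ z → ind B z ≡ ind E z + η * (δ (h ℕ.+ h) (+ y) z + - ε * δ (h ℕ.+ h) (+ y + τ) z))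
  where

  open Character ψ
  open Halves h

  private
    f : ℤ → ℤ
    f = ind E

    m : ℕ
    m = h ℕ.+ h

    instance
      m≢0 : NonZero m
      m≢0 = +-nonZero h

  A : Subset m
  A = record { ind = f ; periodic = periodic-double (periodic E) ; zero-one = zero-one E }

  size-A : size A ≡ size E + size E
  size-A = trans (sumTo-split h h f) (cong (_+_ (size E)) (sumTo-cong h (periodic E)))

  size-B : size B ≡ size A + η * (1ℤ - ε)
  size-B = begin
    size B ≡⟨ sumTo-cong m B-def ⟩
    sumTo m (λ z → f z + η * (δ m (+ y) z + - ε * δ m (+ y + τ) z)) ≡⟨ sumTo-+ m f _ ⟩
    size A + sumTo m (λ z → η * (δ m (+ y) z + - ε * δ m (+ y + τ) z)) ≡⟨ cong (_+_ (size A)) (sumTo-* m η _) ⟩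
    size A + η * sumTo m (λ z → δ m (+ y) z + - ε * δ m (+ y + τ) z) ≡⟨ cong (λ t → size A + η * t) (sumTo-+ m _ _) ⟩
    size A + η * (sumTo m (δ m (+ y)) + sumTo m (λ z → - ε * δ m (+ y + τ) z))
      ≡⟨ cong₂ (λ s t → size A + η * (s + t)) (sumTo-δ m (+ y))
           (trans (sumTo-* m (- ε) _) (trans (cong (- ε *_) (sumTo-δ m (+ y + τ))) (*-identityʳ (- ε)))) ⟩
    size A + η * (1ℤ - ε) ∎
    where open ≡-Reasoning

  module _ {w : ℤ → ℤ} (pw : Periodic m w) (a : ℤ) where

    conv-B : conv m (ind B) w a ≡ conv h f (w ⁺) a + η * (w (a + + y) + - ε * w (a + (+ y + τ)))
    conv-B = begin
      conv m (ind B) w a ≡⟨ conv-congˡ m w B-def a ⟩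
      conv m (λ z → f z + η * (δ m (+ y) z + - ε * δ m (+ y + τ) z)) w a ≡⟨ conv-+ˡ m f _ w a ⟩
      conv m f w a + conv m (λ z → η * (δ m (+ y) z + - ε * δ m (+ y + τ) z)) w a
        ≡⟨ cong₂ _+_ (conv-double h (periodic E) w a) (conv-*ˡ m η _ w a) ⟩
      conv h f (w ⁺) a + η * conv m (λ z → δ m (+ y) z + - ε * δ m (+ y + τ) z) w a
        ≡⟨ cong (λ t → conv h f (w ⁺) a + η * t) (trans (conv-+ˡ m (δ m (+ y)) _ w a)
             (cong₂ _+_ (conv-δ m (+ y) pw a) (trans (conv-*ˡ m (- ε) (δ m (+ y + τ)) w a)
               (cong (- ε *_) (conv-δ m (+ y + τ) pw a))))) ⟩
      conv h f (w ⁺) a + η * (w (a + + y) + - ε * w (a + (+ y + τ))) ∎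
      where open ≡-Reasoning

    corr-B : corr m (ind B) w a ≡ conv h f (w ⁺) a + η * (w (a - + y) + - ε * w (a - (+ y + τ)))
    corr-B = begin
      corr m (ind B) w a ≡⟨ corr-congˡ m w B-def a ⟩
      corr m (λ z → f z + η * (δ m (+ y) z + - ε * δ m (+ y + τ) z)) w a ≡⟨ corr-+ˡ m f _ w a ⟩
      corr m f w a + corr m (λ z → η * (δ m (+ y) z + - ε * δ m (+ y + τ) z)) w a
        ≡⟨ cong₂ _+_ (trans (corr-even m (periodic A) E-even pw a) (conv-double h (periodic E) w a))
             (corr-*ˡ m η _ w a) ⟩
      conv h f (w ⁺) a + η * corr m (λ z → δ m (+ y) z + - ε * δ m (+ y + τ) z) w a
        ≡⟨ cong (λ t → conv h f (w ⁺) a + η * t) (trans (corr-+ˡ m (δ m (+ y)) _ w a)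
             (cong₂ _+_ (corr-δ m (+ y) pw a) (trans (corr-*ˡ m (- ε) (δ m (+ y + τ)) w a)
               (cong (- ε *_) (corr-δ m (+ y + τ) pw a))))) ⟩
      conv h f (w ⁺) a + η * (w (a - + y) + - ε * w (a - (+ y + τ))) ∎
      where open ≡-Reasoning

  χ-τ : χ τ ≡ ε
  χ-τ = trans (trans (cong χ (sym (+-identityˡ τ))) (twist⁺ twist χ-per 0ℤ)) ψ-1

  -- The two changed points contribute χ y - ε χ (y + τ) = χ y (1 - ε²) = 0.
  balanced : conv m f χ 0ℤ ≡ conv m (ind B) χ 0ℤ
  balanced = begin
    conv m f χ 0ℤ ≡⟨ conv-double h (periodic E) χ 0ℤ ⟩
    conv h f (χ ⁺) 0ℤ ≡⟨ lem (conv h f (χ ⁺) 0ℤ) η (χ (+ y)) ⟩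
    conv h f (χ ⁺) 0ℤ + η * (χ (+ y) + - (χ (+ y) * 1ℤ))
      ≡⟨ cong (λ t → conv h f (χ ⁺) 0ℤ + η * (χ (+ y) + - (χ (+ y) * t))) (twist² twist) ⟨
    conv h f (χ ⁺) 0ℤ + η * (χ (+ y) + - (χ (+ y) * (ε * ε)))
      ≡⟨ cong (λ t → conv h f (χ ⁺) 0ℤ + η * (χ (+ y) + t)) (lem₂ (χ (+ y)) ε) ⟩
    conv h f (χ ⁺) 0ℤ + η * (χ (+ y) + - ε * (χ (+ y) * ε))
      ≡⟨ cong (λ t → conv h f (χ ⁺) 0ℤ + η * (χ (+ y) + - ε * t))
           (trans (χ-+ (+ y) τ) (cong (χ (+ y) *_) χ-τ)) ⟨
    conv h f (χ ⁺) 0ℤ + η * (χ (+ y) + - ε * χ (+ y + τ))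
      ≡⟨ cong₂ (λ p q → conv h f (χ ⁺) 0ℤ + η * (χ p + - ε * χ q)) (+-identityˡ (+ y)) (+-identityˡ (+ y + τ)) ⟨
    conv h f (χ ⁺) 0ℤ + η * (χ (0ℤ + + y) + - ε * χ (0ℤ + (+ y + τ)))
      ≡⟨ conv-B (periodic-double χ-per) 0ℤ ⟨
    conv m (ind B) χ 0ℤ ∎
    where
    open ≡-Reasoning
    lem : ∀ c e x → c ≡ c + e * (x + - (x * 1ℤ))
    lem = solve-∀
    lem₂ : ∀ x e → - (x * (e * e)) ≡ - e * (x * e)
    lem₂ = solve-∀

  module _ (u v : ℤ → ℤ) (pu : Periodic m u) (pv : Periodic m v)
    (eq₁ : ∀ a → conv m f u a + corr m (ind B) v a ≡ 0ℤ)
    (eq₂ : ∀ a → conv m (ind B) u a + conv m f v a ≡ 0ℤ) where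

    private
      σ : ℤ → ℤ
      σ z = (u ⁺) z + (v ⁺) z

      σ-periodic : Periodic h σ
      σ-periodic = periodic-+ (⁺-periodic pu) (⁺-periodic pv)

      eqV : ∀ a → conv h f σ a + η * (v (a + - + y) + - ε * v (a + - (+ y + τ))) ≡ 0ℤ
      eqV a = trans (trans (cong (_+ η * (v (a + - + y) + - ε * v (a + - (+ y + τ)))) (conv-+ʳ h f (u ⁺) (v ⁺) a))
        (trans (+-assoc (conv h f (u ⁺) a) _ _)
          (sym (cong₂ _+_ (conv-double h (periodic E) u a) (corr-B pv a))))) (eq₁ a)

      eqU : ∀ a → conv h f σ a + η * (u (a + + y) + - ε * u (a + (+ y + τ))) ≡ 0ℤ
      eqU a = trans (trans (cong (_+ η * (u (a + + y) + - ε * u (a + (+ y + τ)))) (conv-+ʳ h f (u ⁺) (v ⁺) a))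
        (trans (lem (conv h f (u ⁺) a) _ _)
          (sym (cong₂ _+_ (conv-B pu a) (conv-double h (periodic E) v a))))) (eq₂ a)
        where
        lem : ∀ a b c → (a + b) + c ≡ (a + c) + b
        lem = solve-∀

      module Split (w : ℤ → ℤ) (p p′ : ℤ)
        (eq : ∀ a → conv h f σ a + η * (w (a + p) + - ε * w (a + p′)) ≡ 0ℤ) where

        swap : ∀ a p → a + + h + p ≡ a + p + + h
        swap a p = lem a (+ h) p
          where
          lem : ∀ a h p → a + h + p ≡ a + p + h
          lem = solve-∀

        -- Since `σ` is h-periodic, the equation at `a + h` has the same convolution term. It
        -- disappears from the difference of the two equations, `minus`, and doubles in their sum,
        -- `plus`.
        eq′ : ∀ a → conv h f σ a + η * (w (a + p + + h) + - ε * w (a + p′ + + h)) ≡ 0ℤ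
        eq′ a = trans (sym (cong₂ (λ s t → s + η * t) (conv-periodic h f σ-periodic a)
          (cong₂ (λ p q → w p + - ε * w q) (swap a p) (swap a p′)))) (eq (a + + h))

        minus : ∀ a → (w ⁻) (a + p) ≡ ε * (w ⁻) (a + p′)
        minus a = i-j≡0⇒i≡j _ _ (begin
          (w ⁻) (a + p) - ε * (w ⁻) (a + p′)
            ≡⟨ *-identityˡ _ ⟨
          1ℤ * ((w ⁻) (a + p) - ε * (w ⁻) (a + p′))
            ≡⟨ cong (_* ((w ⁻) (a + p) - ε * (w ⁻) (a + p′))) η² ⟨
          η * η * ((w ⁻) (a + p) - ε * (w ⁻) (a + p′))
            ≡⟨ lem η ε (conv h f σ a) (w (a + p)) (w (a + p + + h)) (w (a + p′)) (w (a + p′ + + h)) ⟩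
          η * ((conv h f σ a + η * (w (a + p) + - ε * w (a + p′)))
             - (conv h f σ a + η * (w (a + p + + h) + - ε * w (a + p′ + + h))))
            ≡⟨ cong₂ (λ s t → η * (s - t)) (eq a) (eq′ a) ⟩
          η * 0ℤ ≡⟨ *-zeroʳ η ⟩
          0ℤ ∎)
          where
          open ≡-Reasoning
          lem : ∀ n e c x x′ y y′ → n * n * ((x - x′) - e * (y - y′)) ≡
            n * ((c + n * (x + - e * y)) - (c + n * (x′ + - e * y′)))
          lem = solve-∀

        plus : ∀ a → 2ℤ * conv h f σ a + η * ((w ⁺) (a + p) - ε * (w ⁺) (a + p′)) ≡ 0ℤ
        plus a = trans
          (lem η ε (conv h f σ a) (w (a + p)) (w (a + p + + h)) (w (a + p′)) (w (a + p′ + + h)))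
          (cong₂ _+_ (eq a) (eq′ a))
          where
          lem : ∀ n e c x x′ y y′ → 2ℤ * c + n * ((x + x′) - e * (y + y′)) ≡
            (c + n * (x + - e * y)) + (c + n * (x′ + - e * y′))
          lem = solve-∀

      module SplitU = Split u (+ y) (+ y + τ) eqU
      module SplitV = Split v (- + y) (- (+ y + τ)) eqV

      -- By `minus` the antiperiodic part is invariant under the twisted step, which on such
      -- functions is the shift by 1; a constant that changes sign is 0.
      u⁻≡0 : ∀ x → (u ⁻) x ≡ 0ℤ
      u⁻≡0 = anti-const⇒0 (⁻-antiperiodic pu) λ x → sym (begin
        (u ⁻) x                       ≡⟨ cong (u ⁻) (lem x (+ y)) ⟩
        (u ⁻) (x - + y + + y)         ≡⟨ SplitU.minus (x - + y) ⟩
        ε * (u ⁻) (x - + y + (+ y + τ)) ≡⟨ cong (λ z → ε * (u ⁻) z) (lem₂ x (+ y) τ) ⟩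
        ε * (u ⁻) (x + τ)             ≡⟨ twist⁻ twist (⁻-antiperiodic pu) x ⟩
        (u ⁻) (x + 1ℤ)                ∎)
        where
        open ≡-Reasoning
        lem : ∀ x y → x ≡ x - y + y
        lem = solve-∀
        lem₂ : ∀ x y t → x - y + (y + t) ≡ x + t
        lem₂ = solve-∀

      v⁻≡0 : ∀ x → (v ⁻) x ≡ 0ℤ
      v⁻≡0 = anti-const⇒0 (⁻-antiperiodic pv) λ x → begin
        (v ⁻) (x + 1ℤ)                          ≡⟨ cong (v ⁻) (lem x (+ y)) ⟩
        (v ⁻) (x + 1ℤ + + y + - + y)            ≡⟨ SplitV.minus (x + 1ℤ + + y) ⟩
        ε * (v ⁻) (x + 1ℤ + + y + - (+ y + τ))  ≡⟨ cong (λ z → ε * (v ⁻) z) (lem₂ x (+ y) τ) ⟩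
        ε * (v ⁻) (x + 1ℤ - τ)                  ≡⟨ untwist⁻ twist (⁻-antiperiodic pv) (x + 1ℤ) ⟩
        (v ⁻) (x + 1ℤ - 1ℤ)                     ≡⟨ cong (v ⁻) (lem₃ x) ⟩
        (v ⁻) x                                 ∎
        where
        open ≡-Reasoning
        lem : ∀ x y → x + 1ℤ ≡ x + 1ℤ + y + - y
        lem = solve-∀
        lem₂ : ∀ x y t → x + 1ℤ + y + - (y + t) ≡ x + 1ℤ - t
        lem₂ = solve-∀
        lem₃ : ∀ x → x + 1ℤ - 1ℤ ≡ x
        lem₃ = solve-∀

      F U V : ℤ → ℤ
      F z = χ z * f z
      U z = χ z * (u ⁺) z
      V z = χ z * (v ⁺) z

      conv-twist : ∀ a → conv h F (λ z → U z + V z) a ≡ χ a * conv h f σ a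
      conv-twist a = trans (sumTo-cong h λ c → begin
        χ c * f c * (χ (a + c) * (u ⁺) (a + c) + χ (a + c) * (v ⁺) (a + c))
          ≡⟨ cong (λ t → χ c * f c * (t * (u ⁺) (a + c) + t * (v ⁺) (a + c))) (χ-+ a c) ⟩
        χ c * f c * (χ a * χ c * (u ⁺) (a + c) + χ a * χ c * (v ⁺) (a + c))
          ≡⟨ lem (χ c) (f c) (χ a) ((u ⁺) (a + c)) ((v ⁺) (a + c)) ⟩
        χ c * χ c * (χ a * (f c * σ (a + c)))
          ≡⟨ cong (_* (χ a * (f c * σ (a + c)))) (χ² c) ⟩
        1ℤ * (χ a * (f c * σ (a + c)))
          ≡⟨ *-identityˡ _ ⟩
        χ a * (f c * σ (a + c)) ∎) (sumTo-* h (χ a) _)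
        where
        open ≡-Reasoning
        lem : ∀ c f a u v → c * f * (a * c * u + a * c * v) ≡ c * c * (a * (f * (u + v)))
        lem = solve-∀

      η′ : ℤ
      η′ = η * χ (+ y)

      η′² : η′ * η′ ≡ 1ℤ
      η′² = trans (lem η (χ (+ y))) (cong₂ _*_ η² (χ² (+ y)))
        where
        lem : ∀ a b → a * b * (a * b) ≡ a * a * (b * b)
        lem = solve-∀

      -- Multiplying the equation on h-periodic functions by χ a turns the coefficient ε into 1.
      twist-equation : ∀ (w : ℤ → ℤ) p p′ a → χ p ≡ χ (+ y) → χ p′ ≡ χ (+ y) * ε →
        2ℤ * conv h f σ a + η * (w (a + p) - ε * w (a + p′)) ≡ 0ℤ →
        2ℤ * conv h F (λ z → U z + V z) a
          + η′ * (χ (a + p) * w (a + p) - χ (a + p′) * w (a + p′)) ≡ 0ℤ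
      twist-equation w p p′ a χp χp′ eq = begin
        2ℤ * conv h F (λ z → U z + V z) a + η′ * (χ (a + p) * w (a + p) - χ (a + p′) * w (a + p′))
          ≡⟨ cong (λ t → 2ℤ * t + η′ * (χ (a + p) * w (a + p) - χ (a + p′) * w (a + p′))) (conv-twist a) ⟩
        2ℤ * (χ a * conv h f σ a) + η′ * (χ (a + p) * w (a + p) - χ (a + p′) * w (a + p′))
          ≡⟨ cong₂ (λ s t → 2ℤ * (χ a * conv h f σ a) + η′ * (s * w (a + p) - t * w (a + p′)))
               (trans (χ-+ a p) (cong (χ a *_) χp)) (trans (χ-+ a p′) (cong (χ a *_) χp′)) ⟩
        2ℤ * (χ a * conv h f σ a) + η′ * (χ a * χ (+ y) * w (a + p) - χ a * (χ (+ y) * ε) * w (a + p′))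
          ≡⟨ lem (χ a) (conv h f σ a) η (χ (+ y)) ε (w (a + p)) (w (a + p′)) ⟩
        χ a * (2ℤ * conv h f σ a + χ (+ y) * χ (+ y) * η * (w (a + p) - ε * w (a + p′)))
          ≡⟨ cong (λ t → χ a * (2ℤ * conv h f σ a + t * η * (w (a + p) - ε * w (a + p′)))) (χ² (+ y)) ⟩
        χ a * (2ℤ * conv h f σ a + 1ℤ * η * (w (a + p) - ε * w (a + p′)))
          ≡⟨ cong (λ t → χ a * (2ℤ * conv h f σ a + t * (w (a + p) - ε * w (a + p′)))) (*-identityˡ η) ⟩
        χ a * (2ℤ * conv h f σ a + η * (w (a + p) - ε * w (a + p′)))
          ≡⟨ cong (χ a *_) eq ⟩
        χ a * 0ℤ ≡⟨ *-zeroʳ (χ a) ⟩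
        0ℤ ∎
        where
        open ≡-Reasoning
        lem : ∀ k c n t e w w′ → 2ℤ * (k * c) + n * t * (k * t * w - k * (t * e) * w′) ≡
          k * (2ℤ * c + t * t * n * (w - e * w′))
        lem = solve-∀

      equationU : ∀ a → 2ℤ * conv h F (λ z → U z + V z) a + η′ * (U (a + + y) - U (a + + y + 1ℤ)) ≡ 0ℤ
      equationU a = trans
        (cong (λ z → 2ℤ * conv h F (λ z → U z + V z) a + η′ * (U (a + + y) - U z)) (+-assoc a (+ y) 1ℤ))
        (twist-equation (u ⁺) (+ y) (+ y + 1ℤ) a refl (trans (χ-+ (+ y) 1ℤ) (cong (χ (+ y) *_) ψ-1))
          (trans (cong (λ t → 2ℤ * conv h f σ a + η * ((u ⁺) (a + + y) - ε * t))
            (trans (cong (u ⁺) (sym (+-assoc a (+ y) 1ℤ)))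
              (trans (sym (twist⁺ twist (⁺-periodic pu) (a + + y))) (cong (u ⁺) (+-assoc a (+ y) τ)))))
            (SplitU.plus a)))

      equationV : ∀ a → 2ℤ * conv h F (λ z → U z + V z) a + η′ * (V (a - + y) - V (a - + y - 1ℤ)) ≡ 0ℤ
      equationV a = trans
        (cong (λ z → 2ℤ * conv h F (λ z → U z + V z) a + η′ * (V (a - + y) - V z)) (lem a (+ y) 1ℤ))
        (twist-equation (v ⁺) (- + y) (- (+ y + 1ℤ)) a (χ-neg (+ y))
          (trans (χ-neg (+ y + 1ℤ)) (trans (χ-+ (+ y) 1ℤ) (cong (χ (+ y) *_) ψ-1)))
          (trans (cong (λ t → 2ℤ * conv h f σ a + η * ((v ⁺) (a - + y) - ε * t))
            (trans (cong (v ⁺) (sym (lem a (+ y) 1ℤ)))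
              (trans (sym (untwist⁺ twist (⁺-periodic pv) (a - + y))) (cong (v ⁺) (lem a (+ y) τ)))))
            (SplitV.plus a)))
        where
        lem : ∀ a y t → a - y - t ≡ a + - (y + t)
        lem = solve-∀

      U-periodic : Periodic h U
      U-periodic z = cong₂ _*_ (χ-per z) (⁺-periodic pu z)

      V-periodic : Periodic h V
      V-periodic z = cong₂ _*_ (χ-per z) (⁺-periodic pv z)

      -- Where `w ⁻` vanishes, `w ⁺` is 2 w, and χ² = 1 undoes the multiplication by χ.
      recover : ∀ w k → (∀ x → (w ⁻) x ≡ 0ℤ) → (∀ x → χ x * (w ⁺) x ≡ 2ℤ * k) → ∀ a → w a ≡ χ a * k
      recover w k w⁻≡0 eq a = double-cancel (begin
        2ℤ * w a                  ≡⟨ halves w a ⟩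
        (w ⁺) a + (w ⁻) a         ≡⟨ cong (_+_ ((w ⁺) a)) (w⁻≡0 a) ⟩
        (w ⁺) a + 0ℤ              ≡⟨ +-identityʳ _ ⟩
        (w ⁺) a                   ≡⟨ *-identityˡ _ ⟨
        1ℤ * (w ⁺) a              ≡⟨ cong (_* (w ⁺) a) (χ² a) ⟨
        χ a * χ a * (w ⁺) a       ≡⟨ *-assoc (χ a) (χ a) _ ⟩
        χ a * (χ a * (w ⁺) a)     ≡⟨ cong (χ a *_) (eq a) ⟩
        χ a * (2ℤ * k)            ≡⟨ lem (χ a) k ⟩
        2ℤ * (χ a * k)            ∎)
        where
        open ≡-Reasoning
        lem : ∀ a k → a * (2ℤ * k) ≡ 2ℤ * (a * k)
        lem = solve-∀

      U-0 : U 0ℤ ≡ 2ℤ * u 0ℤ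
      U-0 = begin
        χ 0ℤ * (u ⁺) 0ℤ       ≡⟨ cong (_* (u ⁺) 0ℤ) χ-0 ⟩
        1ℤ * (u ⁺) 0ℤ         ≡⟨ *-identityˡ _ ⟩
        (u ⁺) 0ℤ              ≡⟨ +-identityʳ _ ⟨
        (u ⁺) 0ℤ + 0ℤ         ≡⟨ cong (_+_ ((u ⁺) 0ℤ)) (u⁻≡0 0ℤ) ⟨
        (u ⁺) 0ℤ + (u ⁻) 0ℤ   ≡⟨ halves u 0ℤ ⟨
        2ℤ * u 0ℤ             ∎
        where open ≡-Reasoning

    kernel : ∀ a → u a ≡ χ a * u 0ℤ × v a ≡ - (χ a * u 0ℤ)
    kernel a =
        recover u (u 0ℤ) u⁻≡0
          (λ x → trans (coset-kernel-U h F U V y η′ unbalanced η′² U-periodic V-periodic equationV equationU x) U-0) a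
      , trans (recover v (- u 0ℤ) v⁻≡0
          (λ x → trans (coset-kernel-V h F U V y η′ unbalanced η′² U-periodic V-periodic equationV equationU x)
            (trans (cong -_ U-0) (neg-distribʳ-* 2ℤ (u 0ℤ)))) a)
          (sym (neg-distribʳ-* (χ a) (u 0ℤ)))

  nutPair : ∀ {d} → + 4 * size E + η * (1ℤ - ε) ≡ + d → NutPair m d
  nutPair eq = record
    { A = A ; B = B ; A-even = E-even ; 0∉A = 0∉E
    ; sizes = trans (cong₂ _+_ size-A (trans size-B (cong (_+ η * (1ℤ - ε)) size-A))) (trans (lem (size E) _) eq)
    ; character = record { χ = χ ; χ-+ = χ-+ ; χ² = χ² ; χ-per = periodic-double χ-per }
    ; balance = balanced
    ; unique = kernel
    }
    where
    lem : ∀ s t → (s + s) + ((s + s) + t) ≡ + 4 * s + t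
    lem = solve-∀

-- Odd periods

odd : ℕ → ℕ
odd p = suc (p ℕ.+ p)

Invertible : ℕ → ℕ → Set
Invertible q m = Σ ℤ λ j → Σ ℤ λ l → j * + q ≡ 1ℤ + l * + m

invertible-2 : ∀ p → Invertible 2 (odd p)
invertible-2 p = 1ℤ + + p , 1ℤ , lem (+ p)
  where
  lem : ∀ p → (1ℤ + p) * + 2 ≡ 1ℤ + 1ℤ * (1ℤ + (p + p))
  lem = solve-∀

invertible-4 : ∀ p → Invertible 4 (odd p)
-- The square of 2 (1 + p) = 1 + m, where m = 1 + 2 p: 4 (1 + p)² = 1 + (2 + m) m.
invertible-4 p = (1ℤ + + p) * (1ℤ + + p) , + 3 + (+ p + + p) , lem (+ p)
  where
  lem : ∀ p → (1ℤ + p) * (1ℤ + p) * + 4 ≡ 1ℤ + (+ 3 + (p + p)) * (1ℤ + (p + p))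
  lem = solve-∀

periodic⇒invariant : ∀ {q m w} → Invertible q m → Periodic q w → Periodic m w → ∀ x → w (x + 1ℤ) ≡ w x
periodic⇒invariant {q} {m} {w} (j , l , eq) pq pm x = begin
  w (x + 1ℤ)           ≡⟨ periodic-* pm (x + 1ℤ) l ⟨
  w (x + 1ℤ + l * + m) ≡⟨ cong w (trans (+-assoc x 1ℤ _) (cong (_+_ x) (sym eq))) ⟩
  w (x + j * + q)      ≡⟨ periodic-* pq x j ⟩
  w x                  ∎
  where open ≡-Reasoning

sumTo-∣ : ∀ n {k f} → (∀ x → k ∣ f x) → k ∣ sumTo n f
sumTo-∣ zero    dvd = divides 0ℤ refl
sumTo-∣ (suc n) dvd = ∣m∣n⇒∣m+n (sumTo-∣ n dvd) (dvd (+ n))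

2∣double : ∀ x → 2ℤ ∣ 2ℤ * x
2∣double x = divides x (*-comm 2ℤ x)

module _ (p : ℕ) {q : ℕ} (inv : Invertible q (odd p)) {w : ℤ → ℤ}
  (pw : Periodic (odd p) w) (Σw≡0 : sumTo (odd p) w ≡ 0ℤ)
  (step : ∀ x → 2ℤ ∣ w x + w (x + + q)) where

  private
    iterate : ∀ x k → 2ℤ ∣ w x - w (x + k * + q)
    iterate x = ℤ-induction (λ k → 2ℤ ∣ w x - w (x + k * + q))
      (subst (2ℤ ∣_) (sym (trans (cong (λ z → w x - w z) (+-identityʳ x)) (+-inverseʳ (w x)))) (divides 0ℤ refl))
      (λ k d → subst (2ℤ ∣_) (up (w x) _ _)
        (∣m∣n⇒∣m-n (∣m∣n⇒∣m+n d (next k)) (2∣double _)))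
      (λ k d → subst (2ℤ ∣_) (down (w x) _ _)
        (∣m∣n⇒∣m-n (∣m∣n⇒∣m+n d (next k)) (2∣double _)))
      where
      lem : ∀ x k q → x + k * q + q ≡ x + (k + 1ℤ) * q
      lem = solve-∀
      next : ∀ k → 2ℤ ∣ w (x + k * + q) + w (x + (k + 1ℤ) * + q)
      next k = subst (λ z → 2ℤ ∣ w (x + k * + q) + w z) (lem x k (+ q)) (step (x + k * + q))
      up : ∀ a b c → (a - b) + (b + c) - 2ℤ * c ≡ a - c
      up = solve-∀
      down : ∀ a b c → (a - c) + (b + c) - 2ℤ * b ≡ a - b
      down = solve-∀

    adjacent : ∀ x → 2ℤ ∣ w x - w (x + 1ℤ)
    adjacent x = let j , l , eq = inv in
      subst (λ z → 2ℤ ∣ w x - z)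
        (trans (cong (λ z → w (x + z)) eq)
          (trans (cong w (sym (+-assoc x 1ℤ _))) (periodic-* pw (x + 1ℤ) l)))
        (iterate x j)

    from-0 : ∀ x → 2ℤ ∣ w x - w 0ℤ
    from-0 = ℤ-induction (λ x → 2ℤ ∣ w x - w 0ℤ) (∣0 (w 0ℤ))
      (λ x d → subst (2ℤ ∣_) (up (w x) _ _) (∣m∣n⇒∣m-n d (adjacent x)))
      (λ x d → subst (2ℤ ∣_) (down (w x) (w 0ℤ) (w (x + 1ℤ))) (∣m∣n⇒∣m+n d (adjacent x)))
      where
      up : ∀ a b c → (a - b) - (a - c) ≡ c - b
      up = solve-∀
      down : ∀ a b c → (c - b) + (a - c) ≡ a - b
      down = solve-∀

    -- All w x - w 0 are even, and their sum over the period is - (2 p + 1) (w 0).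
    even-0 : 2ℤ ∣ w 0ℤ
    even-0 = subst (2ℤ ∣_) (lem (w 0ℤ) (+ p))
      (∣m∣n⇒∣m-n (subst (2ℤ ∣_) Σ-eq (sumTo-∣ (odd p) from-0)) (2∣double (- ((1ℤ + + p) * w 0ℤ))))
      where
      lem : ∀ w p → (1ℤ + (p + p)) * - w - 2ℤ * - ((1ℤ + p) * w) ≡ w
      lem = solve-∀
      Σ-eq : sumTo (odd p) (λ x → w x - w 0ℤ) ≡ + odd p * - w 0ℤ
      Σ-eq = trans (sumTo-+ (odd p) w _)
        (trans (cong₂ _+_ Σw≡0 (sumTo-const (odd p) (- w 0ℤ))) (+-identityˡ _))

  -- Modulo 2 the hypothesis says that `w` is invariant under the step `q`. A multiple of `q` is 1
  -- modulo the period, so all values have the same parity; an odd number of them has sum 0.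
  odd-period-even : ∀ x → 2ℤ ∣ w x
  odd-period-even x = subst (2ℤ ∣_) (lem (w x) (w 0ℤ)) (∣m∣n⇒∣m+n (from-0 x) even-0)
    where
    lem : ∀ a b → a - b + b ≡ a
    lem = solve-∀

-- w ↦ Σ w (a ± k), the adjacency operator of the connection set ± ks

shifts : List ℤ → (ℤ → ℤ) → ℤ → ℤ
shifts []       w a = 0ℤ
shifts (k ∷ ks) w a = (w (a + k) + w (a - k)) + shifts ks w a

shifts-linear : ∀ ks b c (v w : ℤ → ℤ) a →
  shifts ks (λ x → b * v x + c * w x) a ≡ b * shifts ks v a + c * shifts ks w a
shifts-linear []       b c v w a = sym (cong₂ _+_ (*-zeroʳ b) (*-zeroʳ c))
shifts-linear (k ∷ ks) b c v w a = trans
  (cong (_+_ ((b * v (a + k) + c * w (a + k)) + (b * v (a - k) + c * w (a - k)))) (shifts-linear ks b c v w a))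
  (lem b c (v (a + k)) (w (a + k)) (v (a - k)) (w (a - k)) (shifts ks v a) (shifts ks w a))
  where
  lem : ∀ b c v w v′ w′ s t → ((b * v + c * w) + (b * v′ + c * w′)) + (b * s + c * t) ≡
    b * ((v + v′) + s) + c * ((w + w′) + t)
  lem = solve-∀

shifts-cong : ∀ ks {v w} → (∀ x → v x ≡ w x) → ∀ a → shifts ks v a ≡ shifts ks w a
shifts-cong []       eq a = refl
shifts-cong (k ∷ ks) eq a = cong₂ _+_ (cong₂ _+_ (eq _) (eq _)) (shifts-cong ks eq a)

shifts-+ : ∀ ks (v w : ℤ → ℤ) a → shifts ks (λ x → v x + w x) a ≡ shifts ks v a + shifts ks w a
shifts-+ ks v w a = trans (shifts-cong ks (λ x → sym (cong₂ _+_ (*-identityˡ (v x)) (*-identityˡ (w x)))) a)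
  (trans (shifts-linear ks 1ℤ 1ℤ v w a) (cong₂ _+_ (*-identityˡ (shifts ks v a)) (*-identityˡ _)))

shifts-− : ∀ ks (v w : ℤ → ℤ) a → shifts ks (λ x → v x - w x) a ≡ shifts ks v a - shifts ks w a
shifts-− ks v w a = trans (shifts-cong ks (λ x → sym (cong₂ _+_ (*-identityˡ (v x)) (-1*i≡-i (w x)))) a)
  (trans (shifts-linear ks 1ℤ -1ℤ v w a) (cong₂ _+_ (*-identityˡ (shifts ks v a)) (-1*i≡-i _)))

shifts-double : ∀ ks (w : ℤ → ℤ) a → shifts ks (λ x → 2ℤ * w x) a ≡ 2ℤ * shifts ks w a
shifts-double ks w a = trans (shifts-cong ks (λ x → sym (+-identityʳ (2ℤ * w x))) a)
  (trans (shifts-linear ks 2ℤ 0ℤ w w a) (+-identityʳ _))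

shifts-translate : ∀ ks (w : ℤ → ℤ) b a → shifts ks (λ x → w (x + b)) a ≡ shifts ks w (a + b)
shifts-translate []       w b a = refl
shifts-translate (k ∷ ks) w b a =
  cong₂ _+_ (cong₂ (λ x y → w x + w y) (lem a k b) (lem a (- k) b)) (shifts-translate ks w b a)
  where
  lem : ∀ a k b → a + k + b ≡ a + b + k
  lem = solve-∀

-- Injectivity modulo 2. The condition on the sum excludes the constant 1, which every `shifts ks`
-- sends to an even constant.
Reflects-even : ℕ → List ℤ → Set
Reflects-even m ks = ∀ {w} → Periodic m w → sumTo m w ≡ 0ℤ → (∀ a → 2ℤ ∣ shifts ks w a) → ∀ x → 2ℤ ∣ w x

-- S + S⁻¹ = S⁻¹ (1 + S²), and 2 is invertible modulo the odd period.
reflects-even-1 : ∀ p → Reflects-even (odd p) (1ℤ ∷ [])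
reflects-even-1 p {w} pw Σw dvd = odd-period-even p (invertible-2 p) pw Σw λ x →
  subst (2ℤ ∣_) (trans (+-identityʳ _) (trans (+-comm (w (x + 1ℤ + 1ℤ)) _)
    (cong₂ (λ y z → w y + w z) (lem₁ x) (lem₂ x)))) (dvd (x + 1ℤ))
  where
  lem₁ : ∀ x → x + 1ℤ - 1ℤ ≡ x
  lem₁ = solve-∀
  lem₂ : ∀ x → x + 1ℤ + 1ℤ ≡ x + + 2
  lem₂ = solve-∀

-- The factorization S + S⁻¹ + S³ + S⁻³ = S⁻³ (1 + S²) (1 + S⁴); evaluation at x + 3 absorbs S⁻³.
shifts-13 : ∀ (w : ℤ → ℤ) x → shifts (1ℤ ∷ + 3 ∷ []) w (x + + 3) ≡
  (w x + w (x + + 4)) + (w (x + + 2) + w (x + + 2 + + 4))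
shifts-13 w x = begin
  (w (x + + 3 + 1ℤ) + w (x + + 3 - 1ℤ)) + ((w (x + + 3 + + 3) + w (x + + 3 - + 3)) + 0ℤ)
    ≡⟨ lem₀ (w (x + + 3 + 1ℤ)) (w (x + + 3 - 1ℤ)) (w (x + + 3 + + 3)) (w (x + + 3 - + 3)) ⟩
  (w (x + + 3 - + 3) + w (x + + 3 + 1ℤ)) + (w (x + + 3 - 1ℤ) + w (x + + 3 + + 3))
    ≡⟨ cong₂ _+_ (cong₂ (λ y z → w y + w z) (lem₁ x) (lem₂ x)) (cong₂ (λ y z → w y + w z) (lem₃ x) (lem₄ x)) ⟩
  (w x + w (x + + 4)) + (w (x + + 2) + w (x + + 2 + + 4)) ∎
  where
  open ≡-Reasoning
  lem₀ : ∀ a b c d → (a + b) + ((c + d) + 0ℤ) ≡ (d + a) + (b + c)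
  lem₀ = solve-∀
  lem₁ : ∀ x → x + + 3 - + 3 ≡ x
  lem₁ = solve-∀
  lem₂ : ∀ x → x + + 3 + 1ℤ ≡ x + + 4
  lem₂ = solve-∀
  lem₃ : ∀ x → x + + 3 - 1ℤ ≡ x + + 2
  lem₃ = solve-∀
  lem₄ : ∀ x → x + + 3 + + 3 ≡ x + + 2 + + 4
  lem₄ = solve-∀

-- The factor 1 + S² is cancelled first: it acts on w + S⁴ w, which also has sum 0. Then 1 + S⁴ is
-- cancelled.
reflects-even-13 : ∀ p → Reflects-even (odd p) (1ℤ ∷ + 3 ∷ [])
reflects-even-13 p {w} pw Σw dvd = odd-period-even p (invertible-4 p) pw Σw
  (odd-period-even p (invertible-2 p) pg
    (trans (sumTo-+ (odd p) w _) (cong₂ _+_ Σw (trans (sumTo-shift pw (+ 4)) Σw)))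
    λ x → subst (2ℤ ∣_) (shifts-13 w x) (dvd (x + + 3)))
  where
  pg : Periodic (odd p) (λ x → w x + w (x + + 4))
  pg = periodic-+ pw (periodic-shift pw (+ 4))

-- Modulo 2 the convolution term disappears, so `reflects` makes `w` even. All the conditions are
-- linear, hence pass to the half.
shifts-descent : ∀ {m} ks → Reflects-even m ks → ∀ f w → Periodic m w → sumTo m w ≡ 0ℤ →
  (∀ a → shifts ks w a + 2ℤ * conv m f w a ≡ 0ℤ) → ∀ x → w x ≡ 0ℤ
shifts-descent {m} ks reflects f w pw Σw eq = descent Φ halve w (pw , Σw , eq)
  where
  Φ : (ℤ → ℤ) → Set
  Φ w = Periodic m w × sumTo m w ≡ 0ℤ × (∀ a → shifts ks w a + 2ℤ * conv m f w a ≡ 0ℤ)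
  halve : ∀ w → Φ w → Σ (ℤ → ℤ) λ w′ → (∀ x → w x ≡ 2ℤ * w′ x) × Φ w′
  halve w (pw , Σw , eq) = w′ , w≡2w′ ,
      (λ x → double-cancel (trans (sym (w≡2w′ _)) (trans (pw x) (w≡2w′ x))))
    , double-cancel (trans (sym (sumTo-* m 2ℤ w′)) (trans (sumTo-cong m λ x → sym (w≡2w′ x)) Σw))
    , λ a → double-cancel (begin
        2ℤ * (shifts ks w′ a + 2ℤ * conv m f w′ a)
          ≡⟨ lem (shifts ks w′ a) (conv m f w′ a) ⟩
        2ℤ * shifts ks w′ a + 2ℤ * (2ℤ * conv m f w′ a)
          ≡⟨ cong₂ (λ s t → s + 2ℤ * t)
               (trans (shifts-cong ks w≡2w′ a) (shifts-double ks w′ a))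
               (trans (conv-congʳ m f w≡2w′ a) (conv-*ʳ m 2ℤ f w′ a)) ⟨
        shifts ks w a + 2ℤ * conv m f w a
          ≡⟨ eq a ⟩
        0ℤ ∎)
    where
    open ≡-Reasoning
    lem : ∀ a b → 2ℤ * (a + 2ℤ * b) ≡ 2ℤ * a + 2ℤ * (2ℤ * b)
    lem = solve-∀
    lem₂ : ∀ a b → (a + 2ℤ * b) - 2ℤ * b ≡ a
    lem₂ = solve-∀
    even : ∀ x → 2ℤ ∣ w x
    even = reflects pw Σw λ a → subst (2ℤ ∣_) (lem₂ (shifts ks w a) (conv m f w a))
      (∣m∣n⇒∣m-n (subst (2ℤ ∣_) (sym (eq a)) (divides 0ℤ refl)) (2∣double (conv m f w a)))
    w′ : ℤ → ℤ
    w′ x = quotient (even x)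
    w≡2w′ : ∀ x → w x ≡ 2ℤ * w′ x
    w≡2w′ x = trans (_∣_.equality (even x)) (*-comm (w′ x) 2ℤ)

anti⇒periodic : ∀ {k w} → Antiperiodic k w → Periodic (k ℕ.+ k) w
anti⇒periodic {k} {w} aw x = begin
  w (x + (+ k + + k)) ≡⟨ cong w (+-assoc x (+ k) (+ k)) ⟨
  w (x + + k + + k)   ≡⟨ aw (x + + k) ⟩
  - w (x + + k)       ≡⟨ cong -_ (aw x) ⟩
  - - w x             ≡⟨ neg-involutive (w x) ⟩
  w x                 ∎
  where open ≡-Reasoning

-x≡x⇒x≡0 : ∀ {x} → - x ≡ x → x ≡ 0ℤ
-x≡x⇒x≡0 {x} eq = double-cancel (trans (lem x) (trans (cong (λ t → x - t) eq) (+-inverseʳ x)))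
  where
  lem : ∀ x → 2ℤ * x ≡ x - - x
  lem = solve-∀

-- Going (odd p) (q + q) steps flips the sign when done in units of q + q,
-- but not when done in units of odd p.
anti-anti⇒0 : ∀ p q {w} → Antiperiodic (odd p) w → Antiperiodic (q ℕ.+ q) w → ∀ x → w x ≡ 0ℤ
anti-anti⇒0 p q {w} ap aq x = -x≡x⇒x≡0 (begin
  - w x                     ≡⟨ aq x ⟨
  w (x + (+ q + + q))       ≡⟨ periodic-* (anti⇒periodic aq) _ (+ p) ⟨
  w (x + (+ q + + q) + + p * (+ q + + q + (+ q + + q))) ≡⟨ cong w (lem x (+ p) (+ q)) ⟩
  w (x + + q * (1ℤ + (+ p + + p) + (1ℤ + (+ p + + p)))) ≡⟨ periodic-* (anti⇒periodic ap) x (+ q) ⟩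
  w x                       ∎)
  where
  open ≡-Reasoning
  lem : ∀ x p q → x + (q + q) + p * (q + q + (q + q)) ≡ x + q * (1ℤ + (p + p) + (1ℤ + (p + p)))
  lem = solve-∀

Anti-injective : ℕ → List ℤ → Set
Anti-injective h ks = ∀ {w} → Antiperiodic h w → (∀ a → shifts ks w a ≡ 0ℤ) → ∀ x → w x ≡ 0ℤ

x+y≡0⇒y≡-x : ∀ {x y} → x + y ≡ 0ℤ → y ≡ - x
x+y≡0⇒y≡-x {x} {y} eq = trans (lem x y) (trans (cong (_- x) eq) (+-identityˡ (- x)))
  where
  lem : ∀ x y → y ≡ (x + y) - x
  lem = solve-∀

-- If 1 + S² kills `w`, then `w` changes sign under the step 2 as well as under the odd step.
anti-injective-1 : ∀ p → Anti-injective (odd p) (1ℤ ∷ [])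
anti-injective-1 p {w} aw eq = anti-anti⇒0 p 1 aw λ x → x+y≡0⇒y≡-x (begin
  w x + w (x + + 2)                          ≡⟨ cong₂ (λ y z → w y + w z) (lem₁ x) (lem₂ x) ⟨
  w (x + 1ℤ - 1ℤ) + w (x + 1ℤ + 1ℤ)          ≡⟨ +-comm (w (x + 1ℤ - 1ℤ)) _ ⟩
  w (x + 1ℤ + 1ℤ) + w (x + 1ℤ - 1ℤ)          ≡⟨ +-identityʳ _ ⟨
  shifts (1ℤ ∷ []) w (x + 1ℤ)                ≡⟨ eq (x + 1ℤ) ⟩
  0ℤ                                         ∎)
  where
  open ≡-Reasoning
  lem₁ : ∀ x → x + 1ℤ - 1ℤ ≡ x
  lem₁ = solve-∀
  lem₂ : ∀ x → x + 1ℤ + 1ℤ ≡ x + + 2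
  lem₂ = solve-∀

-- The same two factors as modulo 2: (1 + S⁴) w is antiperiodic and killed by 1 + S², hence 0. So
-- `w` changes sign under the step 4 as well.
anti-injective-13 : ∀ p → Anti-injective (odd p) (1ℤ ∷ + 3 ∷ [])
anti-injective-13 p {w} aw eq = anti-anti⇒0 p 2 aw λ x → x+y≡0⇒y≡-x (g≡0 x)
  where
  g : ℤ → ℤ
  g x = w x + w (x + + 4)
  lem : ∀ x h → x + h + + 4 ≡ x + + 4 + h
  lem = solve-∀
  g-anti : Antiperiodic (odd p) g
  g-anti x = trans (cong₂ _+_ (aw x) (trans (cong w (lem x (+ odd p))) (aw _)))
    (sym (neg-distrib-+ (w x) _))
  g≡0 : ∀ x → g x ≡ 0ℤ
  g≡0 = anti-anti⇒0 p 1 g-anti λ x → x+y≡0⇒y≡-x (trans (sym (shifts-13 w x)) (eq (x + + 3)))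

-- Building subsets

δ-cong : ∀ m {p q z w} → + m ∣ (z - p) - (w - q) → δ m p z ≡ δ m q w
δ-cong m {p} {q} {z} {w} d with + m ∣? w - q
... | yes e = trans (δ-yes (subst (+ m ∣_) (lem (z - p) (w - q)) (∣m∣n⇒∣m+n d e))) (sym (δ-yes e))
  where
  lem : ∀ a b → a - b + b ≡ a
  lem = solve-∀
... | no ¬e = trans (δ-no λ e → ¬e (subst (+ m ∣_) (lem (z - p) (w - q)) (∣m∣n⇒∣m-n e d))) (sym (δ-no ¬e))
  where
  lem : ∀ a b → a - (a - b) ≡ b
  lem = solve-∀

δ-flip : ∀ m p z → δ m p (- z) ≡ δ m (- p) z
δ-flip m p z with + m ∣? - z - p
... | yes d = trans (δ-yes d) (sym (δ-yes (subst (+ m ∣_) (lem z p) (∣m⇒∣-m d))))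
  where
  lem : ∀ z p → - (- z - p) ≡ z - - p
  lem = solve-∀
... | no ¬d = trans (δ-no ¬d) (sym (δ-no λ e → ¬d (subst (+ m ∣_) (lem z p) (∣m⇒∣-m e))))
  where
  lem : ∀ z p → - (z - - p) ≡ - z - p
  lem = solve-∀

infix 4 _∤_
_∤_ : ℕ → ℤ → Set
m ∤ z = ¬ + m ∣ z

∤-small : ∀ {m} n → suc n ℕ.< m → ∀ {z} → ∣ z ∣ ≡ suc n → ¬ + m ∣ z
∤-small {m} n n<m {z} eq d = ℕ.<⇒≱ n<m (ℕ∣.∣⇒≤ (subst (m ℕ∣.∣_) eq (∣⇒∣ᵤ d)))

module _ {m : ℕ} where

  insert : (S : Subset m) (p : ℤ) → ind S p ≡ 0ℤ → Subset m
  insert S p p∉S = record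
    { ind      = λ z → ind S z + δ m p z
    ; periodic = periodic-+ (periodic S) (δ-periodic m p)
    ; zero-one = zero-one′
    }
    where
    zero-one′ : ∀ z → ind S z + δ m p z ≡ 0ℤ ⊎ ind S z + δ m p z ≡ 1ℤ
    zero-one′ z with + m ∣? z - p
    ... | yes d = inj₂ (cong₂ _+_ (trans (periodic-≡ (periodic S) d) p∉S) (δ-yes d))
    ... | no ¬d with zero-one S z
    ...   | inj₁ eq = inj₁ (cong₂ _+_ eq (δ-no ¬d))
    ...   | inj₂ eq = inj₂ (cong₂ _+_ eq (δ-no ¬d))

  delete : (S : Subset m) (p : ℤ) → ind S p ≡ 1ℤ → Subset m
  delete S p p∈S = record
    { ind      = λ z → ind S z - δ m p z
    ; periodic = λ z → cong₂ _-_ (periodic S z) (δ-periodic m p z)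
    ; zero-one = zero-one′
    }
    where
    zero-one′ : ∀ z → ind S z - δ m p z ≡ 0ℤ ⊎ ind S z - δ m p z ≡ 1ℤ
    zero-one′ z with + m ∣? z - p
    ... | yes d = inj₁ (cong₂ _-_ (trans (periodic-≡ (periodic S) d) p∈S) (δ-yes d))
    ... | no ¬d with zero-one S z
    ...   | inj₁ eq = inj₁ (cong₂ _-_ eq (δ-no ¬d))
    ...   | inj₂ eq = inj₂ (cong₂ _-_ eq (δ-no ¬d))

  ∅ : Subset m
  ∅ = record { ind = λ _ → 0ℤ ; periodic = λ _ → refl ; zero-one = λ _ → inj₁ refl }

  module _ .{{_ : NonZero m}} (S : Subset m) {p : ℤ} (p∉S : ind S p ≡ 0ℤ) where

    size-insert : size (insert S p p∉S) ≡ size S + 1ℤ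
    size-insert = trans (sumTo-+ m (ind S) (δ m p)) (cong (_+_ (size S)) (sumTo-δ m p))

    conv-insert : ∀ {w} → Periodic m w → ∀ a →
      conv m (ind (insert S p p∉S)) w a ≡ conv m (ind S) w a + w (a + p)
    conv-insert {w} pw a = trans (conv-+ˡ m (ind S) (δ m p) w a) (cong (_+_ (conv m (ind S) w a)) (conv-δ m p pw a))

    corr-insert : ∀ {w} → Periodic m w → ∀ a →
      corr m (ind (insert S p p∉S)) w a ≡ corr m (ind S) w a + w (a - p)
    corr-insert {w} pw a = trans (corr-+ˡ m (ind S) (δ m p) w a) (cong (_+_ (corr m (ind S) w a)) (corr-δ m p pw a))

Even : (ℤ → ℤ) → Set
Even f = ∀ z → f (- z) ≡ f z

-- The condition on k + k keeps `k` and `- k` distinct, so that adding both indicators still gives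
-- values 0 and 1.
module _ {m : ℕ} (S : Subset m) (S-even : Even (ind S)) {k : ℤ}
  (k∉S : ind S k ≡ 0ℤ) (2k≢0 : m ∤ k + k) where

  private
    -k∉ : ind (insert S k k∉S) (- k) ≡ 0ℤ
    -k∉ = cong₂ _+_ (trans (S-even k) k∉S)
      (δ-no λ d → 2k≢0 (subst (+ m ∣_) (lem k) (∣m⇒∣-m d)))
      where
      lem : ∀ k → - (- k - k) ≡ k + k
      lem = solve-∀

  insertPair : Subset m
  insertPair = insert (insert S k k∉S) (- k) -k∉

  insertPair-even : Even (ind insertPair)
  insertPair-even z = trans
    (cong₂ _+_ (cong₂ _+_ (S-even z) (δ-flip m k z))
      (trans (δ-flip m (- k) z) (cong (λ x → δ m x z) (neg-involutive k))))
    (lem (ind S z) (δ m (- k) z) (δ m k z))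
    where
    lem : ∀ a b c → a + b + c ≡ a + c + b
    lem = solve-∀

  insertPair-∈ : ind insertPair k ≡ 1ℤ
  insertPair-∈ = cong₂ _+_ (cong₂ _+_ k∉S (δ-self m k))
    (δ-no λ d → 2k≢0 (subst (+ m ∣_) (cong (_+_ k) (neg-involutive k)) d))

  insertPair-∌ : ∀ {z} → ind S z ≡ 0ℤ → m ∤ z - k → m ∤ z + k → ind insertPair z ≡ 0ℤ
  insertPair-∌ {z} z∉S d e = cong₂ _+_ (cong₂ _+_ z∉S (δ-no d))
    (δ-no λ f → e (subst (+ m ∣_) (cong (_+_ z) (neg-involutive k)) f))

  insertPair-⊇ : ∀ {z} → ind S z ≡ 1ℤ → ind insertPair z ≡ 1ℤ
  insertPair-⊇ {z} z∈S = cong₂ _+_ (cong₂ _+_ z∈S (δ-no (absurd k∉S))) (δ-no (absurd (trans (S-even k) k∉S)))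
    where
    absurd : ∀ {p} → ind S p ≡ 0ℤ → m ∤ z - p
    absurd p∉S d with trans (sym z∈S) (trans (periodic-≡ (periodic S) d) p∉S)
    ... | ()

  module _ .{{_ : NonZero m}} where

    size-insertPair : size insertPair ≡ size S + + 2
    size-insertPair = trans (size-insert (insert S k k∉S) -k∉)
      (trans (cong (_+ 1ℤ) (size-insert S k∉S)) (+-assoc (size S) 1ℤ 1ℤ))

    conv-insertPair : ∀ {w} → Periodic m w → ∀ a →
      conv m (ind insertPair) w a ≡ conv m (ind S) w a + (w (a + k) + w (a - k))
    conv-insertPair {w} pw a = trans (conv-insert (insert S k k∉S) -k∉ pw a)
      (trans (cong (_+ w (a - k)) (conv-insert S k∉S pw a)) (+-assoc (conv m (ind S) w a) _ _))

-- The set ± g {s + 1, ..., s + t} in ℤ/m, with its 2 t elements distinct.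
record Multiples (m g s t : ℕ) : Set where
  field
    set    : Subset m
    even   : Even (ind set)
    size≡  : size set ≡ + (t ℕ.+ t)
    ∉      : ∀ {z} → (∀ i → s ℕ.< i → i ℕ.≤ s ℕ.+ t → m ∤ z - + g * + i × m ∤ z + + g * + i) → ind set z ≡ 0ℤ
    ∈      : ∀ i → s ℕ.< i → i ℕ.≤ s ℕ.+ t → ind set (+ g * + i) ≡ 1ℤ

<⇒∃ : ∀ {i n} → i ℕ.≤ n → Σ ℕ λ k → n ≡ i ℕ.+ k
<⇒∃ {i} {n} i≤n = n ℕ.∸ i , sym (ℕ.m+[n∸m]≡n i≤n)

-- `cancel` says that `g` is not a zero divisor modulo `m`, so a collision among the ± g i would
-- give m ∣ i + j or m ∣ i - j with i ≠ j. The bound 2 (s + t) < m excludes both.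
multiples : ∀ m .{{_ : NonZero m}} g s t → (∀ x → + m ∣ + g * x → + m ∣ x) →
  (s ℕ.+ t) ℕ.+ (s ℕ.+ t) ℕ.< m → Multiples m g s t
multiples m g s zero    cancel bound = record
  { set = ∅ ; even = λ _ → refl ; size≡ = sumTo-zero m ; ∉ = λ _ → refl
  ; ∈ = λ i s<i i≤s → ⊥-elim (ℕ.<⇒≱ s<i (subst (i ℕ.≤_) (ℕ.+-identityʳ s) i≤s)) }
multiples m g s (suc t) cancel bound = record
  { set   = insertPair S S-even k∉S 2k≢0
  ; even  = insertPair-even S S-even k∉S 2k≢0
  ; size≡ = trans (size-insertPair S S-even k∉S 2k≢0) (trans (cong (_+ + 2) (Multiples.size≡ M))
      (cong +_ (trans (ℕ.+-comm (t ℕ.+ t) 2) (cong suc (sym (ℕ.+-suc t t))))))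
  ; ∉     = λ away → insertPair-∌ S S-even k∉S 2k≢0
      (Multiples.∉ M λ i s<i i≤n → away i s<i (ℕ.≤-trans i≤n (ℕ.≤-trans (ℕ.n≤1+n n) (ℕ.≤-reflexive (sym n+1)))))
      (proj₁ (away (suc n) (ℕ.s≤s (ℕ.m≤m+n s t)) (ℕ.≤-reflexive (sym n+1))))
      (proj₂ (away (suc n) (ℕ.s≤s (ℕ.m≤m+n s t)) (ℕ.≤-reflexive (sym n+1))))
  ; ∈     = λ i s<i i≤ → ∈′ i s<i (ℕ.m≤n⇒m<n∨m≡n (subst (i ℕ.≤_) n+1 i≤))
  }
  where
  n : ℕ
  n = s ℕ.+ t
  n+1 : s ℕ.+ suc t ≡ suc n
  n+1 = ℕ.+-suc s t
  bound′ : suc n ℕ.+ suc n ℕ.< m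
  bound′ = subst (λ x → x ℕ.+ x ℕ.< m) n+1 bound
  small : ∀ {i} → i ℕ.≤ suc n → suc n ℕ.+ i ℕ.< m
  small i≤ = ℕ.≤-<-trans (ℕ.+-monoʳ-≤ (suc n) i≤) bound′
  M : Multiples m g s t
  M = multiples m g s t cancel
    (ℕ.≤-<-trans (ℕ.+-mono-≤ (ℕ.n≤1+n n) (ℕ.n≤1+n n)) bound′)
  open Multiples M using () renaming (set to S; even to S-even)
  k : ℤ
  k = + g * + suc n
  k+i≢0 : ∀ i → i ℕ.≤ suc n → m ∤ k + + g * + i
  k+i≢0 i i≤ d = ∤-small _ (small i≤) refl (cancel (+ (suc n ℕ.+ i)) (subst (+ m ∣_) (sym (*-distribˡ-+ (+ g) (+ suc n) (+ i))) d))
  k-i≢0 : ∀ i → s ℕ.< i → i ℕ.≤ n → m ∤ k - + g * + i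
  k-i≢0 i s<i i≤n d with <⇒∃ i≤n
  ... | j , eq = ∤-small j (ℕ.≤-<-trans (ℕ.s≤s (ℕ.m≤n+m j i))
      (subst (λ x → suc x ℕ.< m) eq (ℕ.≤-<-trans (ℕ.m≤m+n (suc n) (suc n)) bound′))) refl
      (cancel (+ suc j) (subst (+ m ∣_) (trans (cong (λ x → + g * x - + g * + i) (cong +_ (cong suc eq))) (lem (+ g) (+ i) (+ j))) d))
    where
    lem : ∀ g i j → g * (1ℤ + (i + j)) - g * i ≡ g * (1ℤ + j)
    lem = solve-∀
  k∉S : ind S k ≡ 0ℤ
  k∉S = Multiples.∉ M λ i s<i i≤n → k-i≢0 i s<i i≤n , k+i≢0 i (ℕ.m≤n⇒m≤1+n i≤n)
  2k≢0 : m ∤ k + k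
  2k≢0 = k+i≢0 (suc n) ℕ.≤-refl
  ∈′ : ∀ i → s ℕ.< i → i ℕ.< suc n ⊎ i ≡ suc n → ind (insertPair S S-even k∉S 2k≢0) (+ g * + i) ≡ 1ℤ
  ∈′ i s<i (inj₁ i<) = insertPair-⊇ S S-even k∉S 2k≢0 (Multiples.∈ M i s<i (ℕ.≤-pred i<))
  ∈′ i s<i (inj₂ refl) = insertPair-∈ S S-even k∉S 2k≢0

-- Tools for the pairs with the trivial character

trivial : ∀ m → Character m
trivial m = record { χ = λ _ → 1ℤ ; χ-+ = λ _ _ → refl ; χ² = λ _ → refl ; χ-per = λ _ → refl }

-- Summing the increments over a period gives m c = 0.
periodic-primitive : ∀ {m} .{{_ : NonZero m}} {w} → Periodic m w → ∀ q c →
  (∀ x → w (x + q) - w x ≡ c) → ∀ x → w (x + q) ≡ w x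
periodic-primitive {m} {w} pw q c eq x = i-j≡0⇒i≡j _ _ (trans (eq x) (nonZero-product (nonZero⇒≢0 m) (begin
  + m * c                                        ≡⟨ sumTo-const m c ⟨
  sumTo m (λ _ → c)                              ≡⟨ sumTo-cong m eq ⟨
  sumTo m (λ x → w (x + q) - w x)                ≡⟨ sumTo-cong m (λ x → cong (_+_ (w (x + q))) (sym (-1*i≡-i (w x)))) ⟩
  sumTo m (λ x → w (x + q) + -1ℤ * w x)          ≡⟨ trans (sumTo-+ m _ _) (cong₂ _+_ (sumTo-shift pw q) (sumTo-* m -1ℤ w)) ⟩
  sumTo m w + -1ℤ * sumTo m w                    ≡⟨ cong (_+_ (sumTo m w)) (-1*i≡-i _) ⟩
  sumTo m w - sumTo m w                          ≡⟨ +-inverseʳ (sumTo m w) ⟩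
  0ℤ                                             ∎)))
  where open ≡-Reasoning

-- 2 u = (u + v) + (u - v) is constant, and 2 cancels. The factor `1ℤ` is the value of the trivial
-- character in the field `unique`.
antisymmetric-constant : ∀ {u v : ℤ → ℤ} → (∀ a → u a + v a ≡ 0ℤ) → (∀ a → u a - v a ≡ u 0ℤ - v 0ℤ) →
  ∀ a → u a ≡ 1ℤ * u 0ℤ × v a ≡ - (1ℤ * u 0ℤ)
antisymmetric-constant {u} {v} s≡0 t-const a =
  trans u-const (sym (*-identityˡ _)) , trans (v≡-u a) (cong -_ (trans u-const (sym (*-identityˡ _))))
  where
  v≡-u : ∀ a → v a ≡ - u a
  v≡-u a = x+y≡0⇒y≡-x (s≡0 a)
  lem : ∀ x → 2ℤ * x ≡ x - - x
  lem = solve-∀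
  u-const : u a ≡ u 0ℤ
  u-const = double-cancel (begin
    2ℤ * u a       ≡⟨ lem (u a) ⟩
    u a - - u a    ≡⟨ cong (λ z → u a - z) (v≡-u a) ⟨
    u a - v a      ≡⟨ t-const a ⟩
    u 0ℤ - v 0ℤ    ≡⟨ cong (λ z → u 0ℤ - z) (v≡-u 0ℤ) ⟩
    u 0ℤ - - u 0ℤ  ≡⟨ lem (u 0ℤ) ⟨
    2ℤ * u 0ℤ      ∎)
    where open ≡-Reasoning

sumTo-shifts-1 : ∀ m {w} → Periodic m w → sumTo m (shifts (1ℤ ∷ []) w) ≡ 2ℤ * sumTo m w
sumTo-shifts-1 m {w} pw = begin
  sumTo m (λ a → (w (a + 1ℤ) + w (a - 1ℤ)) + 0ℤ) ≡⟨ sumTo-cong m (λ a → +-identityʳ _) ⟩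
  sumTo m (λ a → w (a + 1ℤ) + w (a - 1ℤ))        ≡⟨ sumTo-+ m _ _ ⟩
  sumTo m (λ a → w (a + 1ℤ)) + sumTo m (λ a → w (a - 1ℤ)) ≡⟨ cong₂ _+_ (sumTo-shift pw 1ℤ) (sumTo-shift pw (- 1ℤ)) ⟩
  sumTo m w + sumTo m w                          ≡⟨ lem (sumTo m w) ⟩
  2ℤ * sumTo m w                                 ∎
  where
  open ≡-Reasoning
  lem : ∀ x → x + x ≡ 2ℤ * x
  lem = solve-∀

sumTo-shifts-13 : ∀ m {w} → Periodic m w → sumTo m (shifts (1ℤ ∷ + 3 ∷ []) w) ≡ + 4 * sumTo m w
sumTo-shifts-13 m {w} pw = begin
  sumTo m (shifts (1ℤ ∷ + 3 ∷ []) w)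
    ≡⟨ sumTo-cong m (λ a → lem₀ (w (a + 1ℤ)) (w (a - 1ℤ)) _) ⟩
  sumTo m (λ a → shifts (1ℤ ∷ []) w a + (w (a + + 3) + w (a - + 3) + 0ℤ))
    ≡⟨ sumTo-+ m _ _ ⟩
  sumTo m (shifts (1ℤ ∷ []) w) + sumTo m (λ a → w (a + + 3) + w (a - + 3) + 0ℤ)
    ≡⟨ cong₂ _+_ (sumTo-shifts-1 m pw) (trans (sumTo-cong m λ a → +-identityʳ _)
         (trans (sumTo-+ m _ _) (cong₂ _+_ (sumTo-shift pw (+ 3)) (sumTo-shift pw (- + 3))))) ⟩
  2ℤ * sumTo m w + (sumTo m w + sumTo m w)
    ≡⟨ lem (sumTo m w) ⟩
  + 4 * sumTo m w ∎
  where
  open ≡-Reasoning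
  lem₀ : ∀ a b c → (a + b) + c ≡ (a + b + 0ℤ) + c
  lem₀ = solve-∀
  lem : ∀ x → 2ℤ * x + (x + x) ≡ + 4 * x
  lem = solve-∀

-- Odd m: ± 1 against ± 3

module OddOrder (p : ℕ) (C : Subset (odd p)) (C-even : Even (ind C)) {c : ℕ} (size-C : size C ≡ + c)
  (0∉C : ind C 0ℤ ≡ 0ℤ) (1∉C : ind C 1ℤ ≡ 0ℤ) (3∉C : ind C (+ 3) ≡ 0ℤ)
  (1≢0 : odd p ∤ 1ℤ) (2≢0 : odd p ∤ + 2) (6≢0 : odd p ∤ + 6) where

  private
    m = odd p

    A B : Subset m
    A = insertPair C C-even 1∉C 2≢0
    B = insertPair C C-even 3∉C 6≢0

    U : (ℤ → ℤ) → ℤ → ℤ → ℤ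
    U w k a = w (a + k) + w (a - k)

    module _ {u v : ℤ → ℤ} (pu : Periodic m u) (pv : Periodic m v)
      (eq₁ : ∀ a → conv m (ind A) u a + corr m (ind B) v a ≡ 0ℤ)
      (eq₂ : ∀ a → conv m (ind B) u a + conv m (ind A) v a ≡ 0ℤ) where

      s t : ℤ → ℤ
      s a = u a + v a
      t a = u a - v a

      ps : Periodic m s
      ps = periodic-+ pu pv

      pt : Periodic m t
      pt x = cong₂ _-_ (pu x) (pv x)

      e₁ : ∀ a → (conv m (ind C) u a + U u 1ℤ a) + (conv m (ind C) v a + U v (+ 3) a) ≡ 0ℤ
      e₁ a = trans (sym (cong₂ _+_ (conv-insertPair C C-even 1∉C 2≢0 pu a)
        (trans (corr-even m (periodic B) (insertPair-even C C-even 3∉C 6≢0) pv a)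
          (conv-insertPair C C-even 3∉C 6≢0 pv a)))) (eq₁ a)

      e₂ : ∀ a → (conv m (ind C) u a + U u (+ 3) a) + (conv m (ind C) v a + U v 1ℤ a) ≡ 0ℤ
      e₂ a = trans (sym (cong₂ _+_ (conv-insertPair C C-even 3∉C 6≢0 pu a)
        (conv-insertPair C C-even 1∉C 2≢0 pv a))) (eq₂ a)

      s-eq : ∀ a → shifts (1ℤ ∷ + 3 ∷ []) s a + 2ℤ * conv m (ind C) s a ≡ 0ℤ
      s-eq a = trans (cong (λ z → shifts (1ℤ ∷ + 3 ∷ []) s a + 2ℤ * z) (conv-+ʳ m (ind C) u v a))
        (trans (lem (conv m (ind C) u a) (conv m (ind C) v a)
          (u (a + 1ℤ)) (u (a - 1ℤ)) (u (a + + 3)) (u (a - + 3)) (v (a + 1ℤ)) (v (a - 1ℤ)) (v (a + + 3)) (v (a - + 3)))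
          (cong₂ _+_ (e₁ a) (e₂ a)))
        where
        lem : ∀ c d u u′ x x′ v v′ y y′ →
          (((u + v) + (u′ + v′)) + (((x + y) + (x′ + y′)) + 0ℤ)) + 2ℤ * (c + d) ≡
          ((c + (u + u′)) + (d + (y + y′))) + ((c + (x + x′)) + (d + (v + v′)))
        lem = solve-∀

      -- Summing `s-eq` over a period multiplies Σ s by 4 + 2 c, the degree of the graph.
      Σs≡0 : sumTo m s ≡ 0ℤ
      Σs≡0 = nonZero-product {+ (4 ℕ.+ (c ℕ.+ c))} (λ ()) (begin
        + (4 ℕ.+ (c ℕ.+ c)) * sumTo m s
          ≡⟨ lem (+ c) (sumTo m s) ⟩
        + 4 * sumTo m s + 2ℤ * (+ c * sumTo m s)
          ≡⟨ cong (λ z → + 4 * sumTo m s + 2ℤ * (z * sumTo m s)) size-C ⟨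
        + 4 * sumTo m s + 2ℤ * (size C * sumTo m s)
          ≡⟨ cong₂ _+_ (sumTo-shifts-13 m ps) (trans (sumTo-* m 2ℤ _) (cong (2ℤ *_) (sumTo-conv m m (ind C) ps))) ⟨
        sumTo m (shifts (1ℤ ∷ + 3 ∷ []) s) + sumTo m (λ a → 2ℤ * conv m (ind C) s a)
          ≡⟨ sumTo-+ m _ _ ⟨
        sumTo m (λ a → shifts (1ℤ ∷ + 3 ∷ []) s a + 2ℤ * conv m (ind C) s a)
          ≡⟨ trans (sumTo-cong m s-eq) (sumTo-zero m) ⟩
        0ℤ ∎)
        where
        open ≡-Reasoning
        lem : ∀ c x → (+ 4 + (c + c)) * x ≡ + 4 * x + 2ℤ * (c * x)
        lem = solve-∀

      s≡0 : ∀ a → s a ≡ 0ℤ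
      s≡0 = shifts-descent (1ℤ ∷ + 3 ∷ []) (reflects-even-13 p) (ind C) s ps Σs≡0 s-eq

      g : ℤ → ℤ
      g x = t (x + + 2) - t x

      -- In `e₂` minus `e₁` the common set `C` cancels, and S⁻³ (S⁴ - 1) (S² - 1) t = 0 remains. It
      -- is read at x + 3.
      g-periodic-4 : Periodic 4 g
      g-periodic-4 x = i-j≡0⇒i≡j _ _ (begin
        g (x + + 4) - g x
          ≡⟨ cong (λ z → (t z - t (x + + 4)) - g x) (+-assoc x (+ 4) (+ 2)) ⟩
        (t (x + + 6) - t (x + + 4)) - (t (x + + 2) - t x)
          ≡⟨ cong₂ (λ y z → (t (x + + 6) - t y) - (t z - t x)) (+-assoc x (+ 3) 1ℤ) (+-assoc x (+ 3) (- 1ℤ)) ⟨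
        (t (x + + 6) - t (b + 1ℤ)) - (t (b - 1ℤ) - t x)
          ≡⟨ cong₂ (λ y z → (t y - t (b + 1ℤ)) - (t (b - 1ℤ) - t z)) (+-assoc x (+ 3) (+ 3)) (lem₀ x) ⟨
        (t (b + + 3) - t (b + 1ℤ)) - (t (b - 1ℤ) - t (b - + 3))
          ≡⟨ lem (conv m (ind C) u b) (conv m (ind C) v b)
               (u (b + 1ℤ)) (u (b - 1ℤ)) (u (b + + 3)) (u (b - + 3)) (v (b + 1ℤ)) (v (b - 1ℤ)) (v (b + + 3)) (v (b - + 3)) ⟩
        ((conv m (ind C) u b + U u (+ 3) b) + (conv m (ind C) v b + U v 1ℤ b))
          - ((conv m (ind C) u b + U u 1ℤ b) + (conv m (ind C) v b + U v (+ 3) b))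
          ≡⟨ cong₂ _-_ (e₂ b) (e₁ b) ⟩
        0ℤ ∎)
        where
        open ≡-Reasoning
        b = x + + 3
        lem₀ : ∀ x → x + + 3 - + 3 ≡ x
        lem₀ = solve-∀
        lem : ∀ c d u u′ x x′ v v′ y y′ →
          ((x - y) - (u - v)) - ((u′ - v′) - (x′ - y′)) ≡
          ((c + (x + x′)) + (d + (v + v′))) - ((c + (u + u′)) + (d + (y + y′)))
        lem = solve-∀

      pg : Periodic m g
      pg x = cong₂ _-_ (periodic-shift pt (+ 2) x) (pt x)

      -- The periods 4 and `m` together make `g` constant. A constant increment of a periodic
      -- function is 0, so `t` has the periods 2 and `m`.
      t-invariant : ∀ x → t (x + 1ℤ) ≡ t x
      t-invariant = periodic⇒invariant (invertible-2 p)
        (periodic-primitive pt (+ 2) (g 0ℤ)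
          (shift-invariant⇒const (periodic⇒invariant (invertible-4 p) g-periodic-4 pg))) pt

  nutPair : ∀ {d} → + (4 ℕ.+ (c ℕ.+ c)) ≡ + d → NutPair m d
  nutPair eq = record
    { A = A ; B = B
    ; A-even = insertPair-even C C-even 1∉C 2≢0
    ; 0∉A = insertPair-∌ C C-even 1∉C 2≢0 0∉C (λ d → 1≢0 (∣m⇒∣-m d)) 1≢0
    ; sizes = trans (cong₂ _+_ (trans (size-insertPair C C-even 1∉C 2≢0) (cong (_+ + 2) size-C))
        (trans (size-insertPair C C-even 3∉C 6≢0) (cong (_+ + 2) size-C))) (trans (lem (+ c)) eq)
    ; character = trivial m
    ; balance = trans (conv-insertPair C C-even 1∉C 2≢0 {λ _ → 1ℤ} (λ _ → refl) 0ℤ)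
        (sym (conv-insertPair C C-even 3∉C 6≢0 {λ _ → 1ℤ} (λ _ → refl) 0ℤ))
    ; unique = λ u v pu pv eq₁ eq₂ → antisymmetric-constant
        (s≡0 pu pv eq₁ eq₂) (shift-invariant⇒const (t-invariant pu pv eq₁ eq₂))
    }
    where
    lem : ∀ c → (c + + 2) + (c + + 2) ≡ + 4 + (c + c)
    lem = solve-∀

-- Twice an odd period

lift : ∀ {h} → Subset h → Subset (h ℕ.+ h)
lift {h} C = record
  { ind = ind C ; periodic = Halves.periodic-double h (periodic C) ; zero-one = zero-one C }

size-lift : ∀ {h} (C : Subset h) → size (lift C) ≡ size C + size C
size-lift {h} C = trans (sumTo-split h h (ind C)) (cong (_+_ (size C)) (sumTo-cong h (periodic C)))

module _ {h : ℕ} (ks : List ℤ) {w : ℤ → ℤ} (pw : Periodic (h ℕ.+ h) w) {G : ℤ → ℤ} (pG : Periodic h G)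
  (eq : ∀ a → G a + shifts ks w a ≡ 0ℤ) where

  open Halves h

  private
    eq′ : ∀ a → G a + shifts ks (λ x → w (x + + h)) a ≡ 0ℤ
    eq′ a = trans (cong₂ _+_ (sym (pG a)) (shifts-translate ks w (+ h) a)) (eq (a + + h))

  -- `G` is h-periodic, so it is the same in the equation at `a + h`: it drops out of the
  -- difference, and doubles in the sum, which is `split⁺`.
  split⁻ : ∀ a → shifts ks (w ⁻) a ≡ 0ℤ
  split⁻ a = trans (shifts-− ks w _ a) (trans (lem (G a) (shifts ks w a) _) (cong₂ _-_ (eq a) (eq′ a)))
    where
    lem : ∀ g s s′ → s - s′ ≡ (g + s) - (g + s′)
    lem = solve-∀

  split⁺ : ∀ a → shifts ks (w ⁺) a + 2ℤ * G a ≡ 0ℤ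
  split⁺ a = trans (cong (_+ 2ℤ * G a) (shifts-+ ks w _ a))
    (trans (lem (G a) (shifts ks w a) _) (cong₂ _+_ (eq a) (eq′ a)))
    where
    lem : ∀ g s s′ → (s + s′) + 2ℤ * g ≡ (g + s) + (g + s′)
    lem = solve-∀

halves≡0 : ∀ h {w : ℤ → ℤ} → (∀ x → Halves._⁺ h w x ≡ 0ℤ) → (∀ x → Halves._⁻ h w x ≡ 0ℤ) → ∀ x → w x ≡ 0ℤ
halves≡0 h {w} w⁺ w⁻ x = double-cancel (trans (Halves.halves h w x) (cong₂ _+_ (w⁺ x) (w⁻ x)))

module TwiceOdd (p : ℕ) (C : Subset (odd p)) (C-even : Even (ind C)) {c : ℕ} (size-C : size C ≡ + c) where

  private
    h m : ℕ
    h = odd p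
    m = h ℕ.+ h

  open Halves h

  -- D = C ∪ ± ks
  module _ (ks : List ℤ) (reflects : Reflects-even h ks) (injective : Anti-injective h ks)
    (D : Subset m) (D-even : Even (ind D))
    (conv-D : ∀ {w} → Periodic m w → ∀ a → conv m (ind D) w a ≡ conv h (ind C) (w ⁺) a + shifts ks w a)
    {e : ℕ} (size-D : size D ≡ + e)
    (0∉D : ind D 0ℤ ≡ 0ℤ) (h∉D : ind D (+ h) ≡ 0ℤ) (1+h∉D : ind D (1ℤ + + h) ≡ 0ℤ) where

    private
      -- On the h-periodic part the coset term carries a factor 2 and descent applies; on the
      -- antiperiodic part it vanishes, and `injective` applies.
      D-injective : ∀ {s} → Periodic m s → sumTo m s ≡ 0ℤ → (∀ a → conv m (ind D) s a ≡ 0ℤ) → ∀ a → s a ≡ 0ℤ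
      D-injective {s} ps Σs eq = halves≡0 h
        (shifts-descent ks reflects (ind C) (s ⁺) (⁺-periodic ps)
          (trans (sumTo-+ h s _) (trans (sym (sumTo-split h h s)) Σs)) (split⁺ ks ps pG eq′))
        (injective (⁻-antiperiodic ps) (split⁻ ks ps pG eq′))
        where
        pG : Periodic h (conv h (ind C) (s ⁺))
        pG = conv-periodic h (ind C) (⁺-periodic ps)
        eq′ : ∀ a → conv h (ind C) (s ⁺) a + shifts ks s a ≡ 0ℤ
        eq′ a = trans (sym (conv-D ps a)) (eq a)

      A B : Subset m
      -- `h` is its own negative modulo 2 h, so it can join `A` alone. The point 1 + h in `B` keeps
      -- the sizes equal.
      A = insert D (+ h) h∉D
      B = insert D (1ℤ + + h) 1+h∉D

      module _ {u v : ℤ → ℤ} (pu : Periodic m u) (pv : Periodic m v)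
        (eq₁ : ∀ a → conv m (ind A) u a + corr m (ind B) v a ≡ 0ℤ)
        (eq₂ : ∀ a → conv m (ind B) u a + conv m (ind A) v a ≡ 0ℤ) where

        s K : ℤ → ℤ
        s a = u a + v a
        K a = u (a + + h) + v (a - (1ℤ + + h))

        ps : Periodic m s
        ps = periodic-+ pu pv

        e₁ : ∀ a → conv m (ind D) s a + K a ≡ 0ℤ
        e₁ a = trans (cong (_+ K a) (conv-+ʳ m (ind D) u v a)) (trans
          (lem (conv m (ind D) u a) _ _ _)
          (trans (sym (cong₂ _+_ (conv-insert D h∉D pu a) (trans (corr-insert D 1+h∉D pv a)
            (cong (_+ v (a - (1ℤ + + h))) (corr-even m (periodic D) D-even pv a))))) (eq₁ a)))
          where
          lem : ∀ a b c d → (a + b) + (c + d) ≡ (a + c) + (b + d)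
          lem = solve-∀

        -- As - h ≡ h modulo 2 h, the extra points contribute to the second equation what they
        -- contribute to the first, moved by 1. This is the reason for choosing neighbours `h` and 1
        -- + h.
        K⁺ : ∀ a → K (a + 1ℤ) ≡ u (a + (1ℤ + + h)) + v (a + + h)
        K⁺ a = cong₂ _+_ (cong u (+-assoc a 1ℤ (+ h)))
          (trans (cong v (lem a (+ h))) (trans (sym (wrap pv _)) (cong (λ z → v (z + + h)) (lem₂ a (+ h)))))
          where
          lem : ∀ a h → a + 1ℤ - (1ℤ + h) ≡ a - h
          lem = solve-∀
          lem₂ : ∀ a h → a - h + h ≡ a
          lem₂ = solve-∀

        e₂ : ∀ a → conv m (ind D) s a + K (a + 1ℤ) ≡ 0ℤ
        e₂ a = trans (cong₂ _+_ (conv-+ʳ m (ind D) u v a) (K⁺ a)) (trans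
          (lem (conv m (ind D) u a) _ _ _)
          (trans (sym (cong₂ _+_ (conv-insert D 1+h∉D pu a) (conv-insert D h∉D pv a))) (eq₂ a)))
          where
          lem : ∀ a b c d → (a + b) + (c + d) ≡ (a + c) + (b + d)
          lem = solve-∀

        K-invariant : ∀ a → K (a + 1ℤ) ≡ K a
        K-invariant a = +-cancelˡ (conv m (ind D) s a) _ _ (trans (e₂ a) (sym (e₁ a)))

        ΣK≡Σs : sumTo m K ≡ sumTo m s
        ΣK≡Σs = trans (sumTo-+ m _ _) (trans (cong₂ _+_ (sumTo-shift pu (+ h)) (sumTo-shift pv (- (1ℤ + + h))))
          (sym (sumTo-+ m u v)))

        Σs≡0 : sumTo m s ≡ 0ℤ
        Σs≡0 = nonZero-product {+ suc e} (λ ()) (begin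
          + suc e * sumTo m s                  ≡⟨ lem (+ e) (sumTo m s) ⟩
          + e * sumTo m s + sumTo m s          ≡⟨ cong₂ (λ y z → y * sumTo m s + z) size-D ΣK≡Σs ⟨
          size D * sumTo m s + sumTo m K       ≡⟨ cong (_+ sumTo m K) (sumTo-conv m m (ind D) ps) ⟨
          sumTo m (conv m (ind D) s) + sumTo m K ≡⟨ sumTo-+ m _ _ ⟨
          sumTo m (λ a → conv m (ind D) s a + K a) ≡⟨ trans (sumTo-cong m e₁) (sumTo-zero m) ⟩
          0ℤ                                   ∎)
          where
          open ≡-Reasoning
          lem : ∀ e x → (1ℤ + e) * x ≡ e * x + x
          lem = solve-∀

        -- `K` is constant and has the same sum as `s`. Once it is 0, the extra points drop out and
        -- only the operator of `D` is left.
        K≡0 : ∀ a → K a ≡ 0ℤ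
        K≡0 a = trans (shift-invariant⇒const K-invariant a) (nonZero-product {+ m} (λ ())
          (trans (sym (sumTo-const m (K 0ℤ)))
            (trans (sumTo-cong m λ x → sym (shift-invariant⇒const K-invariant x)) (trans ΣK≡Σs Σs≡0))))

        s≡0 : ∀ a → s a ≡ 0ℤ
        s≡0 = D-injective ps Σs≡0 λ a →
          trans (sym (+-identityʳ _)) (trans (cong (_+_ (conv m (ind D) s a)) (sym (K≡0 a))) (e₁ a))

        -- At a + 1 + h the equation K = 0 reads u (a + 1) = - v a, and s = 0 gives - v a = u a.
        u-invariant : ∀ a → u (a + 1ℤ) ≡ u a
        u-invariant a = begin
          u (a + 1ℤ)              ≡⟨ wrap pu (a + 1ℤ) ⟨
          u (a + 1ℤ + + h + + h)  ≡⟨ lem₀ (u (a + 1ℤ + + h + + h)) (v (a + 1ℤ + + h - (1ℤ + + h))) ⟩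
          K (a + 1ℤ + + h) - v (a + 1ℤ + + h - (1ℤ + + h))
            ≡⟨ cong₂ _-_ (K≡0 (a + 1ℤ + + h)) (cong v (lem a (+ h))) ⟩
          0ℤ - v a                ≡⟨ cong (λ z → z - v a) (s≡0 a) ⟨
          s a - v a               ≡⟨ lem₀ (u a) (v a) ⟨
          u a                     ∎
          where
          open ≡-Reasoning
          lem₀ : ∀ x y → x ≡ (x + y) - y
          lem₀ = solve-∀
          lem : ∀ a h → a + 1ℤ + h - (1ℤ + h) ≡ a
          lem = solve-∀

        t-const : ∀ a → u a - v a ≡ u 0ℤ - v 0ℤ
        t-const = shift-invariant⇒const λ a → cong₂ _-_ (u-invariant a) (begin
          v (a + 1ℤ)    ≡⟨ x+y≡0⇒y≡-x (s≡0 (a + 1ℤ)) ⟩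
          - u (a + 1ℤ)  ≡⟨ cong -_ (u-invariant a) ⟩
          - u a         ≡⟨ x+y≡0⇒y≡-x (s≡0 a) ⟨
          v a           ∎)
          where open ≡-Reasoning

    nutPair-h : ∀ {d} → + (2 ℕ.+ (e ℕ.+ e)) ≡ + d → NutPair m d
    nutPair-h eq = record
      { A = A ; B = B
      ; A-even = λ z → cong₂ _+_ (D-even z) (trans (δ-flip m (+ h) z)
          (δ-cong m (subst (+ m ∣_) (lem₁ z (+ h)) ∣-refl)))
      ; 0∉A = cong₂ _+_ 0∉D (δ-no λ d → ∤-small {m} _ (ℕ.m<m+n h ℕ.z<s) refl d)
      ; sizes = trans (cong₂ _+_ (trans (size-insert D h∉D) (cong (_+ 1ℤ) size-D))
          (trans (size-insert D 1+h∉D) (cong (_+ 1ℤ) size-D))) (trans (lem₂ (+ e)) eq)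
      ; character = trivial m
      ; balance = trans (conv-insert D h∉D {λ _ → 1ℤ} (λ _ → refl) 0ℤ)
          (sym (conv-insert D 1+h∉D {λ _ → 1ℤ} (λ _ → refl) 0ℤ))
      ; unique = λ u v pu pv eq₁ eq₂ → antisymmetric-constant (s≡0 pu pv eq₁ eq₂) (t-const pu pv eq₁ eq₂)
      }
      where
      lem₁ : ∀ z h → h + h ≡ (z - - h) - (z - h)
      lem₁ = solve-∀
      lem₂ : ∀ e → (e + 1ℤ) + (e + 1ℤ) ≡ + 2 + (e + e)
      lem₂ = solve-∀

  module _ (0∉C : ind C 0ℤ ≡ 0ℤ) (1∉C : ind C 1ℤ ≡ 0ℤ) (1≢0 : m ∤ 1ℤ) (2≢0 : m ∤ + 2) where

    private
      h≢0 : m ∤ + h - 0ℤ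
      h≢0 d = ∤-small {m} _ (ℕ.m<m+n h ℕ.z<s) (cong ∣_∣ (+-identityʳ (+ h))) d

      A B₀ B : Subset m
      A = insertPair (lift C) C-even 1∉C 2≢0
      -- 0 is admissible in `B`, where it stands for the reflection s and not for the identity. The
      -- coset {0 , h} balances the two points ± 1 of `A`.
      B₀ = insert (lift C) 0ℤ 0∉C

      h∉B₀ : ind B₀ (+ h) ≡ 0ℤ
      h∉B₀ = cong₂ _+_ (trans (cong (ind C) (sym (+-identityˡ (+ h)))) (trans (periodic C 0ℤ) 0∉C)) (δ-no h≢0)

      B = insert B₀ (+ h) h∉B₀

      conv-A : ∀ {w} → Periodic m w → ∀ a → conv m (ind A) w a ≡ conv h (ind C) (w ⁺) a + shifts (1ℤ ∷ []) w a
      conv-A {w} pw a = trans (conv-insertPair (lift C) C-even 1∉C 2≢0 pw a)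
        (cong₂ _+_ (conv-double h (periodic C) w a) (sym (+-identityʳ _)))

      conv-B : ∀ {w} → Periodic m w → ∀ a → conv m (ind B) w a ≡ conv h (ind C) (w ⁺) a + (w ⁺) a
      conv-B {w} pw a = trans (conv-insert B₀ h∉B₀ pw a) (trans
        (cong (_+ w (a + + h)) (trans (conv-insert (lift C) 0∉C pw a)
          (cong₂ _+_ (conv-double h (periodic C) w a) (cong w (+-identityʳ a)))))
        (+-assoc (conv h (ind C) (w ⁺) a) _ _))

      corr-B : ∀ {w} → Periodic m w → ∀ a → corr m (ind B) w a ≡ conv h (ind C) (w ⁺) a + (w ⁺) a
      corr-B {w} pw a = trans (corr-insert B₀ h∉B₀ pw a) (trans
        (cong₂ _+_ (trans (corr-insert (lift C) 0∉C pw a)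
          (cong₂ _+_ (trans (corr-even m (periodic (lift C)) C-even pw a) (conv-double h (periodic C) w a))
            (cong w (+-identityʳ a))))
          (trans (sym (wrap pw _)) (cong (λ z → w (z + + h)) (lem a (+ h)))))
        (+-assoc (conv h (ind C) (w ⁺) a) _ _))
        where
        lem : ∀ a h → a - h + h ≡ a
        lem = solve-∀

      module _ {u v : ℤ → ℤ} (pu : Periodic m u) (pv : Periodic m v)
        (eq₁ : ∀ a → conv m (ind A) u a + corr m (ind B) v a ≡ 0ℤ)
        (eq₂ : ∀ a → conv m (ind B) u a + conv m (ind A) v a ≡ 0ℤ) where

        s t G : ℤ → ℤ
        s a = u a + v a
        t a = u a - v a
        G a = 2ℤ * conv h (ind C) (s ⁺) a + (s ⁺) a

        ps : Periodic m s
        ps = periodic-+ pu pv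

        pt : Periodic m t
        pt x = cong₂ _-_ (pu x) (pv x)

        pG : Periodic h G
        pG x = cong₂ (λ y z → 2ℤ * y + z) (conv-periodic h (ind C) (⁺-periodic ps) x) (⁺-periodic ps x)

        e₁ : ∀ a → (conv h (ind C) (u ⁺) a + shifts (1ℤ ∷ []) u a) + (conv h (ind C) (v ⁺) a + (v ⁺) a) ≡ 0ℤ
        e₁ a = trans (sym (cong₂ _+_ (conv-A pu a) (corr-B pv a))) (eq₁ a)

        e₂ : ∀ a → (conv h (ind C) (u ⁺) a + (u ⁺) a) + (conv h (ind C) (v ⁺) a + shifts (1ℤ ∷ []) v a) ≡ 0ℤ
        e₂ a = trans (sym (cong₂ _+_ (conv-B pu a) (conv-A pv a))) (eq₂ a)

        s⁺≡ : ∀ a → (s ⁺) a ≡ (u ⁺) a + (v ⁺) a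
        s⁺≡ a = lem (u a) (v a) (u (a + + h)) (v (a + + h))
          where
          lem : ∀ a b c d → (a + b) + (c + d) ≡ (a + c) + (b + d)
          lem = solve-∀

        s-eq : ∀ a → G a + shifts (1ℤ ∷ []) s a ≡ 0ℤ
        s-eq a = begin
          2ℤ * conv h (ind C) (s ⁺) a + (s ⁺) a + shifts (1ℤ ∷ []) s a
            ≡⟨ cong₂ (λ y z → 2ℤ * y + (s ⁺) a + z)
                 (trans (conv-congʳ h (ind C) s⁺≡ a) (conv-+ʳ h (ind C) (u ⁺) (v ⁺) a))
                 (shifts-+ (1ℤ ∷ []) u v a) ⟩
          2ℤ * (conv h (ind C) (u ⁺) a + conv h (ind C) (v ⁺) a) + (s ⁺) a
            + (shifts (1ℤ ∷ []) u a + shifts (1ℤ ∷ []) v a)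
            ≡⟨ cong (λ y → 2ℤ * (conv h (ind C) (u ⁺) a + conv h (ind C) (v ⁺) a) + y
                 + (shifts (1ℤ ∷ []) u a + shifts (1ℤ ∷ []) v a)) (s⁺≡ a) ⟩
          2ℤ * (conv h (ind C) (u ⁺) a + conv h (ind C) (v ⁺) a) + ((u ⁺) a + (v ⁺) a)
            + (shifts (1ℤ ∷ []) u a + shifts (1ℤ ∷ []) v a)
            ≡⟨ lem (conv h (ind C) (u ⁺) a) (conv h (ind C) (v ⁺) a) ((u ⁺) a) ((v ⁺) a)
                 (shifts (1ℤ ∷ []) u a) (shifts (1ℤ ∷ []) v a) ⟩
          ((conv h (ind C) (u ⁺) a + shifts (1ℤ ∷ []) u a) + (conv h (ind C) (v ⁺) a + (v ⁺) a))
            + ((conv h (ind C) (u ⁺) a + (u ⁺) a) + (conv h (ind C) (v ⁺) a + shifts (1ℤ ∷ []) v a))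
            ≡⟨ cong₂ _+_ (e₁ a) (e₂ a) ⟩
          0ℤ ∎
          where
          open ≡-Reasoning
          lem : ∀ c d x y s t → 2ℤ * (c + d) + (x + y) + (s + t) ≡ ((c + s) + (d + y)) + ((c + x) + (d + t))
          lem = solve-∀

        t-eq : ∀ a → - (t ⁺) a + shifts (1ℤ ∷ []) t a ≡ 0ℤ
        t-eq a = begin
          - (t ⁺) a + shifts (1ℤ ∷ []) t a
            ≡⟨ cong₂ (λ y z → - y + z) (lem₀ (u a) (v a) (u (a + + h)) (v (a + + h))) (shifts-− (1ℤ ∷ []) u v a) ⟩
          - ((u ⁺) a - (v ⁺) a) + (shifts (1ℤ ∷ []) u a - shifts (1ℤ ∷ []) v a)
            ≡⟨ lem (conv h (ind C) (u ⁺) a) (conv h (ind C) (v ⁺) a) ((u ⁺) a) ((v ⁺) a)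
                 (shifts (1ℤ ∷ []) u a) (shifts (1ℤ ∷ []) v a) ⟩
          ((conv h (ind C) (u ⁺) a + shifts (1ℤ ∷ []) u a) + (conv h (ind C) (v ⁺) a + (v ⁺) a))
            - ((conv h (ind C) (u ⁺) a + (u ⁺) a) + (conv h (ind C) (v ⁺) a + shifts (1ℤ ∷ []) v a))
            ≡⟨ cong₂ _-_ (e₁ a) (e₂ a) ⟩
          0ℤ ∎
          where
          open ≡-Reasoning
          lem₀ : ∀ a b c d → (a - b) + (c - d) ≡ (a + c) - (b + d)
          lem₀ = solve-∀
          lem : ∀ c d x y s t → - (x - y) + (s - t) ≡ ((c + s) + (d + y)) - ((c + x) + (d + t))
          lem = solve-∀

        Σs⁺≡0 : sumTo h (s ⁺) ≡ 0ℤ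
        Σs⁺≡0 = nonZero-product {+ (4 ℕ.+ 4 ℕ.* c)} (λ ()) (begin
          + (4 ℕ.+ 4 ℕ.* c) * σ
            ≡⟨ cong (_* σ) (cong (_+_ (+ 4)) (pos-* 4 c)) ⟩
          (+ 4 + + 4 * + c) * σ
            ≡⟨ lem (+ c) σ ⟩
          2ℤ * σ + (2ℤ * (2ℤ * (+ c * σ)) + 2ℤ * σ)
            ≡⟨ cong (λ z → 2ℤ * σ + (2ℤ * (2ℤ * (z * σ)) + 2ℤ * σ)) size-C ⟨
          2ℤ * σ + (2ℤ * (2ℤ * (size C * σ)) + 2ℤ * σ)
            ≡⟨ cong₂ (λ y z → y + (2ℤ * (2ℤ * z) + 2ℤ * σ)) (sumTo-shifts-1 h ps⁺) (sumTo-conv h h (ind C) ps⁺) ⟨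
          sumTo h (shifts (1ℤ ∷ []) (s ⁺)) + (2ℤ * (2ℤ * sumTo h (conv h (ind C) (s ⁺))) + 2ℤ * σ)
            ≡⟨ cong (_+_ (sumTo h (shifts (1ℤ ∷ []) (s ⁺)))) (begin
                 sumTo h (λ a → 2ℤ * G a) ≡⟨ sumTo-* h 2ℤ G ⟩
                 2ℤ * sumTo h G ≡⟨ cong (2ℤ *_) (trans (sumTo-+ h _ _) (cong (_+ σ) (sumTo-* h 2ℤ _))) ⟩
                 2ℤ * (2ℤ * sumTo h (conv h (ind C) (s ⁺)) + σ) ≡⟨ *-distribˡ-+ 2ℤ (2ℤ * sumTo h (conv h (ind C) (s ⁺))) σ ⟩
                 2ℤ * (2ℤ * sumTo h (conv h (ind C) (s ⁺))) + 2ℤ * σ ∎) ⟨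
          sumTo h (shifts (1ℤ ∷ []) (s ⁺)) + sumTo h (λ a → 2ℤ * G a)
            ≡⟨ sumTo-+ h _ _ ⟨
          sumTo h (λ a → shifts (1ℤ ∷ []) (s ⁺) a + 2ℤ * G a)
            ≡⟨ trans (sumTo-cong h (split⁺ (1ℤ ∷ []) ps pG s-eq)) (sumTo-zero h) ⟩
          0ℤ ∎)
          where
          open ≡-Reasoning
          σ = sumTo h (s ⁺)
          ps⁺ = ⁺-periodic ps
          lem : ∀ c x → (+ 4 + + 4 * c) * x ≡ 2ℤ * x + (2ℤ * (2ℤ * (c * x)) + 2ℤ * x)
          lem = solve-∀

        s≡0 : ∀ a → s a ≡ 0ℤ
        s≡0 = halves≡0 h
          (shifts-descent (1ℤ ∷ []) (reflects-even-1 p) F (s ⁺) (⁺-periodic ps) Σs⁺≡0 λ a →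
            trans (cong (λ z → shifts (1ℤ ∷ []) (s ⁺) a + 2ℤ * z)
              (trans (conv-+ˡ h (λ z → 2ℤ * ind C z) (δ h 0ℤ) (s ⁺) a) (cong₂ _+_ (conv-*ˡ h 2ℤ (ind C) (s ⁺) a)
                (trans (conv-δ h 0ℤ (⁺-periodic ps) a) (cong (s ⁺) (+-identityʳ a))))))
              (split⁺ (1ℤ ∷ []) ps pG s-eq a))
          (anti-injective-1 p (⁻-antiperiodic ps) (split⁻ (1ℤ ∷ []) ps pG s-eq))
          where
          -- Convolution of `s ⁺` with `F` is `G`: the sets `A` and `B` contribute `C` twice, and
          -- the coset {0 , h} contributes the identity operator.
          F : ℤ → ℤ
          F z = 2ℤ * ind C z + δ h 0ℤ z

        pt⁺ : Periodic h (λ x → - (t ⁺) x)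
        pt⁺ x = cong -_ (⁺-periodic pt x)

        t⁻≡0 : ∀ x → (t ⁻) x ≡ 0ℤ
        t⁻≡0 = anti-injective-1 p (⁻-antiperiodic pt) (split⁻ (1ℤ ∷ []) pt pt⁺ t-eq)

        -- On `t ⁺` the equation is (S - 2 + S⁻¹) t⁺ = 0, a vanishing second difference. So the
        -- increments are constant, hence 0 by periodicity.
        t⁺-invariant : ∀ x → (t ⁺) (x + 1ℤ) ≡ (t ⁺) x
        t⁺-invariant = periodic-primitive (⁺-periodic pt) 1ℤ _ (shift-invariant⇒const λ x →
          i-j≡0⇒i≡j _ _ (begin
            ((t ⁺) (x + 1ℤ + 1ℤ) - (t ⁺) (x + 1ℤ)) - ((t ⁺) (x + 1ℤ) - (t ⁺) x)
              ≡⟨ cong (λ z → ((t ⁺) (x + 1ℤ + 1ℤ) - (t ⁺) (x + 1ℤ)) - ((t ⁺) (x + 1ℤ) - (t ⁺) z)) (lem₀ x) ⟨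
            ((t ⁺) (x + 1ℤ + 1ℤ) - (t ⁺) (x + 1ℤ)) - ((t ⁺) (x + 1ℤ) - (t ⁺) (x + 1ℤ - 1ℤ))
              ≡⟨ lem ((t ⁺) (x + 1ℤ + 1ℤ)) ((t ⁺) (x + 1ℤ)) ((t ⁺) (x + 1ℤ - 1ℤ)) ⟩
            shifts (1ℤ ∷ []) (t ⁺) (x + 1ℤ) + 2ℤ * - (t ⁺) (x + 1ℤ)
              ≡⟨ split⁺ (1ℤ ∷ []) pt pt⁺ t-eq (x + 1ℤ) ⟩
            0ℤ ∎))
          where
          open ≡-Reasoning
          lem₀ : ∀ x → x + 1ℤ - 1ℤ ≡ x
          lem₀ = solve-∀
          lem : ∀ a b c → (a - b) - (b - c) ≡ ((a + c) + 0ℤ) + 2ℤ * - b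
          lem = solve-∀

        t-const : ∀ a → t a ≡ t 0ℤ
        t-const a = double-cancel (trans (halves t a) (trans
          (cong₂ _+_ (shift-invariant⇒const t⁺-invariant a) (trans (t⁻≡0 a) (sym (t⁻≡0 0ℤ))))
          (sym (halves t 0ℤ))))

    nutPair-0h : ∀ {d} → + (4 ℕ.+ 4 ℕ.* c) ≡ + d → NutPair m d
    nutPair-0h eq = record
      { A = A ; B = B
      ; A-even = insertPair-even (lift C) C-even 1∉C 2≢0
      ; 0∉A = insertPair-∌ (lift C) C-even 1∉C 2≢0 0∉C (λ d → 1≢0 (∣m⇒∣-m d)) 1≢0
      ; sizes = trans (cong₂ _+_ (trans (size-insertPair (lift C) C-even 1∉C 2≢0) (cong (_+ + 2) size-C⇑))
          (trans (size-insert B₀ h∉B₀) (cong (_+ 1ℤ) (trans (size-insert (lift C) 0∉C) (cong (_+ 1ℤ) size-C⇑)))))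
          (trans (lem (+ c)) (trans (sym (cong (_+_ (+ 4)) (pos-* 4 c))) eq))
      ; character = trivial m
      ; balance = trans (conv-A {λ _ → 1ℤ} (λ _ → refl) 0ℤ) (sym (conv-B {λ _ → 1ℤ} (λ _ → refl) 0ℤ))
      ; unique = λ u v pu pv eq₁ eq₂ → antisymmetric-constant (s≡0 pu pv eq₁ eq₂) (t-const pu pv eq₁ eq₂)
      }
      where
      size-C⇑ : size (lift C) ≡ + c + + c
      size-C⇑ = trans (size-lift C) (cong₂ _+_ size-C size-C)
      lem : ∀ c → (c + c + + 2) + (c + c + 1ℤ + 1ℤ) ≡ + 4 + + 4 * c
      lem = solve-∀

-- The alternating character and sets of odd size

alternate : ℕ → ℤ
alternate zero    = 1ℤ
alternate (suc n) = - alternate n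

alternating : ∀ H → Character (H ℕ.+ H)
alternating H = record { χ = χ ; χ-+ = χ-+ ; χ² = λ x → square ∣ x ∣ ; χ-per = χ-per }
  where
  χ : ℤ → ℤ
  χ x = alternate ∣ x ∣
  square : ∀ n → alternate n * alternate n ≡ 1ℤ
  square zero    = refl
  square (suc n) = trans (lem (alternate n)) (square n)
    where
    lem : ∀ x → - x * - x ≡ x * x
    lem = solve-∀
  χ-suc : ∀ x → χ (x + 1ℤ) ≡ - χ x
  χ-suc (+ n)          = cong χ (+n+1 n)
  χ-suc -[1+ zero ]    = refl
  χ-suc -[1+ suc n ]   = sym (neg-involutive (alternate (suc n)))
  χ-+ : ∀ x y → χ (x + y) ≡ χ x * χ y
  χ-+ x = ℤ-induction (λ y → χ (x + y) ≡ χ x * χ y)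
    (trans (cong χ (+-identityʳ x)) (sym (*-identityʳ (χ x))))
    (λ y eq → trans (step y) (trans (cong -_ eq) (sym (stepʳ y))))
    (λ y eq → neg-injective (trans (sym (step y)) (trans eq (stepʳ y))))
    where
    step : ∀ y → χ (x + (y + 1ℤ)) ≡ - χ (x + y)
    step y = trans (cong χ (sym (+-assoc x y 1ℤ))) (χ-suc (x + y))
    stepʳ : ∀ y → χ x * χ (y + 1ℤ) ≡ - (χ x * χ y)
    stepʳ y = trans (cong (χ x *_) (χ-suc y)) (sym (neg-distribʳ-* (χ x) (χ y)))
  χ-per : Periodic (H ℕ.+ H) χ
  χ-per x = trans (χ-+ x (+ H + + H)) (trans (cong (χ x *_) (trans (χ-+ (+ H) (+ H)) (square H))) (*-identityʳ (χ x)))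

2∤odd : ∀ t → ¬ 2ℤ ∣ + odd t
2∤odd t d = ∤-small {2} 0 ℕ.≤-refl refl (subst (2ℤ ∣_) (lem (+ t)) (∣m∣n⇒∣m-n d (2∣double (+ t))))
  where
  lem : ∀ t → 1ℤ + (t + t) - 2ℤ * t ≡ 1ℤ
  lem = solve-∀

character-odd : ∀ {h} (ψ : Character h) x → 2ℤ ∣ Character.χ ψ x - 1ℤ
character-odd ψ x with i*j≡0⇒i≡0∨j≡0 (Character.χ ψ x - 1ℤ)
  (trans (lem (Character.χ ψ x)) (trans (cong (_- 1ℤ) (Character.χ² ψ x)) refl))
  where
  lem : ∀ a → (a - 1ℤ) * (a + 1ℤ) ≡ a * a - 1ℤ
  lem = solve-∀
... | inj₁ eq = subst (2ℤ ∣_) (sym eq) (divides 0ℤ refl)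
... | inj₂ eq = subst (2ℤ ∣_) (trans (cong (_- 2ℤ) (sym eq)) (lem (Character.χ ψ x))) (divides -1ℤ refl)
  where
  lem : ∀ a → a + 1ℤ - 2ℤ ≡ a - 1ℤ
  lem = solve-∀

-- Values of a character are odd, so the twisted sum has the parity of the size. This is why the
-- twisted families take `E` of odd size.
odd-size-unbalanced : ∀ {h} (ψ : Character h) (E : Subset h) t → size E ≡ + odd t →
  sumTo h (λ z → Character.χ ψ z * ind E z) ≢ 0ℤ
odd-size-unbalanced {h} ψ E t eq Σ≡0 = 2∤odd t (subst (2ℤ ∣_) (trans difference eq) (sumTo-∣ h even))
  where
  open Character ψ
  f = ind E
  even : ∀ z → 2ℤ ∣ f z + -1ℤ * (χ z * f z)
  even z = subst (2ℤ ∣_) (lem (χ z) (f z)) (∣m⇒∣m*n (- f z) (character-odd ψ z))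
    where
    lem : ∀ x f → (x - 1ℤ) * - f ≡ f + -1ℤ * (x * f)
    lem = solve-∀
  difference : sumTo h (λ z → f z + -1ℤ * (χ z * f z)) ≡ size E
  difference = trans (sumTo-+ h f _)
    (trans (cong (_+_ (size E)) (trans (sumTo-* h -1ℤ _) (cong (-1ℤ *_) Σ≡0))) (+-identityʳ _))

a+a≤1+b+b⇒a≤b : ∀ a b → a ℕ.+ a ℕ.≤ suc (b ℕ.+ b) → a ℕ.≤ b
a+a≤1+b+b⇒a≤b a b le with a ℕ.≤? b
... | yes a≤b = a≤b
... | no  a≰b = ⊥-elim (ℕ.<⇒≱
  (ℕ.≤-trans (ℕ.≤-reflexive (cong suc (sym (ℕ.+-suc b b)))) (ℕ.+-mono-≤ (ℕ.≰⇒> a≰b) (ℕ.≰⇒> a≰b))) le)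

1+a+a≤b+b⇒a<b : ∀ a b → suc (a ℕ.+ a) ℕ.≤ b ℕ.+ b → a ℕ.< b
1+a+a≤b+b⇒a<b a b le with a ℕ.<? b
... | yes a<b = a<b
... | no  a≮b = ⊥-elim (ℕ.<⇒≱ le (ℕ.+-mono-≤ (ℕ.≮⇒≥ a≮b) (ℕ.≮⇒≥ a≮b)))

cancel-1 : ∀ {m} x → + m ∣ + 1 * x → + m ∣ x
cancel-1 {m} x = subst (+ m ∣_) (*-identityˡ x)

cancel-2 : ∀ p x → + odd p ∣ + 2 * x → + odd p ∣ x
cancel-2 p x d = let j , l , eq = invertible-2 p in
  subst (+ odd p ∣_)
    (trans (lem j (+ 2) l (+ odd p) x) (trans (cong (λ z → z * x - l * x * + odd p) eq) (lem₂ l (+ odd p) x)))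
    (∣m∣n⇒∣m-n (∣n⇒∣m*n j d) (divides (l * x) refl))
  where
  lem : ∀ j g l m x → j * (g * x) - l * x * m ≡ j * g * x - l * x * m
  lem = solve-∀
  lem₂ : ∀ l m x → (1ℤ + l * m) * x - l * x * m ≡ x
  lem₂ = solve-∀

-- The residues are 2, 4, ..., 2 t and the odd numbers h - 2 t, ..., h - 2. From t < p follows h - 2
-- t ≥ 3, so 0 and ± 1 stay free; with 1 + t < p so do ± 3.
module Evens (p t : ℕ) (t<p : t ℕ.< p) where

  private
    h = odd p
    2t<2p : t ℕ.+ t ℕ.< p ℕ.+ p
    2t<2p = ℕ.+-mono-< t<p t<p

  evens : Multiples h 2 0 t
  evens = multiples h 2 0 t (cancel-2 p) (ℕ.m<n⇒m<1+n 2t<2p)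

  open Multiples evens public

  private
    1+double< : ∀ {i} → i ℕ.≤ t → suc (i ℕ.+ i) ℕ.< h
    1+double< i≤t = ℕ.s<s (ℕ.≤-<-trans (ℕ.+-mono-≤ i≤t i≤t) 2t<2p)

    2i<h : ∀ {i} → suc i ℕ.≤ t → suc (suc (i ℕ.+ i)) ℕ.< h
    2i<h {i} i<t = ℕ.s<s (ℕ.≤-<-trans (ℕ.≤-trans (ℕ.≤-trans (ℕ.≤-reflexive (sym (ℕ.+-suc i i))) (ℕ.n≤1+n _)) (ℕ.+-mono-≤ i<t i<t)) 2t<2p)

  0∉ : ind set 0ℤ ≡ 0ℤ
  0∉ = ∉ λ { (suc i) _ i<t →
      ∤-small _ (2i<h i<t) (cong ∣_∣ (lem₁ (+ i))) , ∤-small _ (2i<h i<t) (cong ∣_∣ (lem₂ (+ i))) }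
    where
    lem₁ : ∀ i → 0ℤ - + 2 * (1ℤ + i) ≡ - (+ 2 + (i + i))
    lem₁ = solve-∀
    lem₂ : ∀ i → 0ℤ + + 2 * (1ℤ + i) ≡ + 2 + (i + i)
    lem₂ = solve-∀

  1∉ : ind set 1ℤ ≡ 0ℤ
  1∉ = ∉ λ { (suc i) _ i<t →
      ∤-small _ (ℕ.<-trans (ℕ.n<1+n _) (2i<h i<t)) (cong ∣_∣ (lem₁ (+ i)))
    , ∤-small _ (subst (λ x → suc (suc x) ℕ.< h) (ℕ.+-suc i i) (1+double< i<t)) (cong ∣_∣ (lem₂ (+ i))) }
    where
    lem₁ : ∀ i → 1ℤ - + 2 * (1ℤ + i) ≡ - (1ℤ + (i + i))
    lem₁ = solve-∀
    lem₂ : ∀ i → 1ℤ + + 2 * (1ℤ + i) ≡ + 3 + (i + i)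
    lem₂ = solve-∀

  3∉ : suc t ℕ.< p → ind set (+ 3) ≡ 0ℤ
  3∉ 1+t<p = ∉ λ { (suc i) _ i<t → minus i i<t , ∤-small _ (bound i<t) (cong ∣_∣ (lem₂ (+ i))) }
    where
    lem₁ : ∀ i → + 3 - + 2 * (+ 2 + i) ≡ - (1ℤ + (i + i))
    lem₁ = solve-∀
    lem₂ : ∀ i → + 3 + + 2 * (1ℤ + i) ≡ + 5 + (i + i)
    lem₂ = solve-∀
    bound : ∀ {i} → suc i ℕ.≤ t → 5 ℕ.+ (i ℕ.+ i) ℕ.< h
    bound {i} i<t = ℕ.s<s (ℕ.≤-<-trans
      (ℕ.≤-trans (ℕ.≤-reflexive (eq i)) (ℕ.+-mono-≤ (ℕ.s≤s i<t) (ℕ.s≤s i<t)))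
      (ℕ.+-mono-< 1+t<p 1+t<p))
      where
      eq : ∀ i → 4 ℕ.+ (i ℕ.+ i) ≡ suc (suc i) ℕ.+ suc (suc i)
      eq = ℕ-Solver.solve-∀
    minus : ∀ i → suc i ℕ.≤ t → h ∤ + 3 - + 2 * + suc i
    minus zero    i<t = ∤-small {h} 0 (ℕ.<-trans (ℕ.n<1+n 1) (2i<h i<t)) refl
    minus (suc i) i<t = ∤-small _ (1+double< (ℕ.≤-trans (ℕ.≤-trans (ℕ.n≤1+n i) (ℕ.n≤1+n (suc i))) i<t)) (cong ∣_∣ (lem₁ (+ i)))

-- The subset {H} ∪ ± {s + 1, …, H - 1} of the period 2H, where H = s + t + 1

module Middle (s t : ℕ) where

  private
    H h : ℕ
    H = suc (s ℕ.+ t)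
    h = H ℕ.+ H

    M : Multiples h 1 s t
    M = multiples h 1 s t cancel-1 (ℕ.+-mono-< (ℕ.n<1+n _) (ℕ.n<1+n _))

    module M = Multiples M

    H∉M : ind M.set (+ H) ≡ 0ℤ
    H∉M = M.∉ λ i s<i i≤ → minus i i≤ , plus i i≤
      where
      minus : ∀ i → i ℕ.≤ s ℕ.+ t → h ∤ + H - + 1 * + i
      minus i i≤ with <⇒∃ i≤
      ... | j , eq = ∤-small j (ℕ.≤-<-trans (ℕ.≤-trans (ℕ.s≤s (ℕ.m≤n+m j i)) (ℕ.≤-reflexive (cong suc (sym eq)))) (ℕ.m<m+n H ℕ.z<s))
        (cong ∣_∣ (trans (cong (λ x → 1ℤ + + x - + 1 * + i) eq) (lem (+ i) (+ j))))
        where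
        lem : ∀ i j → 1ℤ + (i + j) - + 1 * i ≡ 1ℤ + j
        lem = solve-∀
      plus : ∀ i → i ℕ.≤ s ℕ.+ t → h ∤ + H + + 1 * + i
      plus i i≤ = ∤-small (s ℕ.+ t ℕ.+ i) (ℕ.+-monoʳ-< H (ℕ.s≤s i≤)) (cong ∣_∣ (lem (+ H) (+ i)))
        where
        lem : ∀ H i → H + + 1 * i ≡ H + i
        lem = solve-∀


  middle : Subset h
  middle = insert M.set (+ H) H∉M

  middle-even : Even (ind middle)
  middle-even z = cong₂ _+_ (M.even z) (trans (δ-flip h (+ H) z) (δ-cong h (subst (+ h ∣_) (lem z (+ H)) ∣-refl)))
    where
    lem : ∀ z h → h + h ≡ (z - - h) - (z - h)
    lem = solve-∀

  size-middle : size middle ≡ + odd t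
  size-middle = trans (size-insert M.set H∉M) (trans (cong (_+ 1ℤ) M.size≡) (+n+1 (t ℕ.+ t)))

  ∈-middle : ∀ i → s ℕ.< i → i ℕ.≤ s ℕ.+ t → ind middle (+ i) ≡ 1ℤ
  ∈-middle i s<i i≤ = cong₂ _+_ (trans (cong (ind M.set) (sym (*-identityˡ (+ i)))) (M.∈ i s<i i≤))
    (δ-no λ d → h∤H-i i i≤ (subst (+ h ∣_) (lem (+ i) (+ H)) (∣m⇒∣-m d)))
    where
    lem : ∀ i H → - (i - H) ≡ H - i
    lem = solve-∀
    h∤H-i : ∀ i → i ℕ.≤ s ℕ.+ t → h ∤ + H - + i
    h∤H-i i i≤ with <⇒∃ i≤
    ... | j , eq = ∤-small j (ℕ.≤-<-trans (ℕ.≤-trans (ℕ.s≤s (ℕ.m≤n+m j i)) (ℕ.≤-reflexive (cong suc (sym eq)))) (ℕ.m<m+n H ℕ.z<s))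
        (cong ∣_∣ (trans (cong (λ x → 1ℤ + + x - + i) eq) (lem′ (+ i) (+ j))))
      where
      lem′ : ∀ i j → 1ℤ + (i + j) - i ≡ 1ℤ + j
      lem′ = solve-∀

  H∈middle : ind middle (+ H) ≡ 1ℤ
  H∈middle = cong₂ _+_ H∉M (δ-self h (+ H))

  ∉-middle : ∀ j → j ℕ.≤ s → ind middle (+ j) ≡ 0ℤ
  ∉-middle j j≤s = cong₂ _+_ (M.∉ λ i s<i i≤ → minus i s<i i≤ , plus i s<i i≤) (δ-no at-H)
    where
    at-H : h ∤ + j - + H
    at-H d with <⇒∃ (ℕ.≤-trans j≤s (ℕ.m≤m+n s t))
    ... | l , eq = ∤-small l (ℕ.≤-<-trans (ℕ.≤-trans (ℕ.s≤s (ℕ.m≤n+m l j)) (ℕ.≤-reflexive (cong suc (sym eq)))) (ℕ.m<m+n H ℕ.z<s))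
      (cong ∣_∣ (trans (cong (λ x → + j - (1ℤ + + x)) eq) (lem (+ j) (+ l)))) d
      where
      lem : ∀ j l → j - (1ℤ + (j + l)) ≡ - (1ℤ + l)
      lem = solve-∀
    minus : ∀ i → s ℕ.< i → i ℕ.≤ s ℕ.+ t → h ∤ + j - + 1 * + i
    minus i s<i i≤ with <⇒∃ (ℕ.≤-trans (ℕ.s≤s j≤s) s<i)
    ... | l , refl = ∤-small l (ℕ.≤-<-trans (ℕ.≤-trans (ℕ.s≤s (ℕ.m≤n+m l j)) i≤) (ℕ.≤-trans (ℕ.n<1+n _) (ℕ.m≤m+n H H)))
      (cong ∣_∣ (lem (+ j) (+ l)))
      where
      lem : ∀ j l → j - + 1 * (1ℤ + (j + l)) ≡ - (1ℤ + l)
      lem = solve-∀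
    plus : ∀ i → s ℕ.< i → i ℕ.≤ s ℕ.+ t → h ∤ + j + + 1 * + i
    plus (suc i) s<i i≤ = ∤-small (j ℕ.+ i)
      (ℕ.≤-<-trans (ℕ.≤-reflexive (sym (ℕ.+-suc j i)))
        (ℕ.+-mono-≤-< (ℕ.≤-trans (ℕ.≤-trans j≤s (ℕ.m≤m+n s t)) (ℕ.n≤1+n _)) (ℕ.s≤s i≤)))
      (cong ∣_∣ (lem (+ j) (+ i)))
      where
      lem : ∀ j i → j + + 1 * (1ℤ + i) ≡ 1ℤ + (j + i)
      lem = solve-∀

  -- H + 1 ≡ - (s + t) modulo 2 H, and s + t belongs to the block {s + 1, ..., s + t} once t > 0.
  last∈middle : 0 ℕ.< t → ind middle (+ H + 1ℤ) ≡ 1ℤ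
  last∈middle 0<t = trans (sym (middle-even (+ H + 1ℤ)))
    (trans (periodic-≡ (periodic middle) (subst (+ h ∣_) (lem (+ s + + t)) (divides -1ℤ (sym (-1*i≡-i (+ h))))))
      (∈-middle (s ℕ.+ t) (ℕ.m<m+n s 0<t) ℕ.≤-refl))
    where
    lem : ∀ x → - ((1ℤ + x) + (1ℤ + x)) ≡ - ((1ℤ + x) + 1ℤ) - x
    lem = solve-∀

-- Pairs for each residue of the degree modulo 8

private
  -- The form that `B-def` of `CosetFamily` asks for, with (η , ε) = (1 , 1); the next two are (1 ,
  -- -1) and (-1 , -1).
  insert-delete : ∀ f a b → f + a - b ≡ f + 1ℤ * (a + - 1ℤ * b)
  insert-delete = solve-∀

  insert-insert : ∀ f a b → f + a + b ≡ f + 1ℤ * (a + - -1ℤ * b)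
  insert-insert = solve-∀

  delete-delete : ∀ f a b → f - a - b ≡ f + -1ℤ * (a + - -1ℤ * b)
  delete-delete = solve-∀

  1<m⇒m∤1 : ∀ {m} → 1 ℕ.< m → m ∤ 1ℤ
  1<m⇒m∤1 1<m = ∤-small 0 1<m refl

x+1-x : ∀ x → x + 1ℤ - x ≡ 1ℤ
x+1-x = solve-∀

-- E = ± {1, ..., t}, and in `B` the point 1 is replaced by 0. The trivial character suffices, so
-- `h` may have either parity.
nutPair-8t : ∀ h t .{{_ : NonZero h}} → 0 ℕ.< t → t ℕ.+ t ℕ.< h →
  NutPair (h ℕ.+ h) (((t ℕ.+ t) ℕ.+ (t ℕ.+ t)) ℕ.+ ((t ℕ.+ t) ℕ.+ (t ℕ.+ t)))
nutPair-8t h@(suc h-1) t@(suc t-1) 0<t 2t<h = CosetFamily.nutPair h set even 0∉E straight 0 1ℤ refl (trivial h) refl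
  unbalanced B (λ z → insert-delete (ind set z) (δ m 0ℤ z) (δ m 1ℤ z))
  (trans (cong (λ x → + 4 * x + 1ℤ * (1ℤ - 1ℤ)) size≡) (lem (+ t)))
  where
  m = h ℕ.+ h
  open Multiples (multiples h 1 0 t cancel-1 2t<h)
  t<h : t ℕ.< h
  t<h = ℕ.≤-<-trans (ℕ.m≤m+n t t) 2t<h
  0∉E : ind set 0ℤ ≡ 0ℤ
  0∉E = ∉ λ { (suc i) _ i≤t →
      ∤-small _ (ℕ.≤-<-trans i≤t t<h) (cong ∣_∣ (lem₁ (+ i))) , ∤-small _ (ℕ.≤-<-trans i≤t t<h) (cong ∣_∣ (lem₂ (+ i))) }
    where
    lem₁ : ∀ i → 0ℤ - + 1 * (1ℤ + i) ≡ - (1ℤ + i)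
    lem₁ = solve-∀
    lem₂ : ∀ i → 0ℤ + + 1 * (1ℤ + i) ≡ 1ℤ + i
    lem₂ = solve-∀
  1<m : 1 ℕ.< m
  1<m = ℕ.+-mono-≤ {1} {h} {1} {h} (ℕ.s≤s ℕ.z≤n) (ℕ.s≤s ℕ.z≤n)
  E⁺ : Subset m
  E⁺ = insert (lift set) 0ℤ 0∉E
  B : Subset m
  B = delete E⁺ 1ℤ (cong₂ _+_ (∈ 1 ℕ.z<s (ℕ.s≤s ℕ.z≤n)) (δ-no (1<m⇒m∤1 1<m)))
  unbalanced : sumTo h (λ z → 1ℤ * ind set z) ≢ 0ℤ
  unbalanced eq with trans (sym size≡) (trans (sumTo-cong h λ z → sym (*-identityˡ (ind set z))) eq)
  ... | ()
  lem : ∀ t → + 4 * (t + t) + 1ℤ * (1ℤ - 1ℤ) ≡ ((t + t) + (t + t)) + ((t + t) + (t + t))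
  lem = solve-∀

-- As h = 2 H, the point `H` is its own negative modulo `h` and gives `E` the odd size 2 t + 1; and
-- the alternating character is h-periodic.
module EvenHalf (s t : ℕ) where

  private
    H h m : ℕ
    H = suc (s ℕ.+ t)
    h = H ℕ.+ H
    m = h ℕ.+ h

    open Middle s t

    E : Subset h
    E = middle

    1<m : 1 ℕ.< m
    1<m = ℕ.s≤s (ℕ.≤-trans (ℕ.≤-trans (ℕ.s≤s ℕ.z≤n) (ℕ.m≤n+m H (s ℕ.+ t))) (ℕ.m≤m+n (s ℕ.+ t ℕ.+ H) h))

    1+h<m : 1 ℕ.+ h ℕ.< m
    1+h<m = ℕ.+-monoˡ-< h (ℕ.s≤s (ℕ.≤-trans (ℕ.s≤s ℕ.z≤n) (ℕ.m≤n+m H (s ℕ.+ t))))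

    s+1∈ : ∀ t → ind (Middle.middle s t) (+ s + 1ℤ) ≡ 1ℤ
    s+1∈ zero    = trans (cong (ind (Middle.middle s zero)) (trans (+n+1 s) (cong (λ x → + suc x) (sym (ℕ.+-identityʳ s)))))
      (Middle.H∈middle s zero)
    s+1∈ (suc t) = trans (cong (ind (Middle.middle s (suc t))) (+n+1 s))
      (Middle.∈-middle s (suc t) (suc s) ℕ.≤-refl (subst (suc s ℕ.≤_) (sym (ℕ.+-suc s t)) (ℕ.s≤s (ℕ.m≤m+n s t))))

  -- `H` and H + 1 + h leave `B`, so d = 4 (2 t + 1) - 2. The second point lies in the coset of H +
  -- 1, which is in `E` because t > 0.
  nutPair-8t+2 : 0 ℕ.< t → let a = t ℕ.+ t in NutPair m (suc (a ℕ.+ a) ℕ.+ suc (a ℕ.+ a))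
  nutPair-8t+2 0<t = CosetFamily.nutPair h E middle-even (∉-middle 0 ℕ.z≤n) twisted H -1ℤ refl (alternating H) refl
    (odd-size-unbalanced (alternating H) E t size-middle) B
    (λ z → delete-delete (ind E z) (δ m (+ H) z) (δ m (+ H + (1ℤ + + h)) z))
    (trans (cong (λ x → + 4 * x + -1ℤ * (1ℤ - -1ℤ)) size-middle) (lem (+ t)))
    where
    E⁻ : Subset m
    E⁻ = delete (lift E) (+ H) H∈middle
    lem₀ : ∀ x h → x + (1ℤ + h) - x ≡ 1ℤ + h
    lem₀ = solve-∀
    B : Subset m
    B = delete E⁻ (+ H + (1ℤ + + h)) (cong₂ _-_
      (trans (cong (ind E) (sym (+-assoc (+ H) 1ℤ (+ h)))) (trans (periodic E (+ H + 1ℤ)) (last∈middle 0<t)))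
      (δ-no (∤-small h 1+h<m (cong ∣_∣ (lem₀ (+ H) (+ h))))))
    lem : ∀ t → + 4 * (1ℤ + (t + t)) + -1ℤ * (1ℤ - -1ℤ) ≡
      (1ℤ + ((t + t) + (t + t))) + (1ℤ + ((t + t) + (t + t)))
    lem = solve-∀

  -- `s` is the last absent and s + 1 the first present point, so the exchange of neighbours takes
  -- place at the edge of the block.
  nutPair-8t+4 : NutPair m ((odd t ℕ.+ odd t) ℕ.+ (odd t ℕ.+ odd t))
  nutPair-8t+4 = CosetFamily.nutPair h E middle-even (∉-middle 0 ℕ.z≤n) straight s 1ℤ refl (trivial h) refl
    (odd-size-unbalanced (trivial h) E t size-middle) B
    (λ z → insert-delete (ind E z) (δ m (+ s) z) (δ m (+ s + 1ℤ) z))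
    (trans (cong (λ x → + 4 * x + 1ℤ * (1ℤ - 1ℤ)) size-middle) (lem (+ odd t)))
    where
    E⁺ : Subset m
    E⁺ = insert (lift E) (+ s) (∉-middle s ℕ.≤-refl)
    B : Subset m
    B = delete E⁺ (+ s + 1ℤ) (cong₂ _+_ (s+1∈ t) (δ-no (∤-small 0 1<m (cong ∣_∣ (x+1-x (+ s))))))
    lem : ∀ x → + 4 * x + 1ℤ * (1ℤ - 1ℤ) ≡ (x + x) + (x + x)
    lem = solve-∀

  -- 0 and 1 + h join `B`, so d = 4 (2 t + 1) + 2. The second point lies in the coset of 1, which is
  -- absent because s > 0.
  nutPair-8t+6 : 0 ℕ.< s → NutPair m (suc (odd t ℕ.+ odd t) ℕ.+ suc (odd t ℕ.+ odd t))
  nutPair-8t+6 0<s = CosetFamily.nutPair h E middle-even (∉-middle 0 ℕ.z≤n) twisted 0 1ℤ refl (alternating H) refl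
    (odd-size-unbalanced (alternating H) E t size-middle) B
    (λ z → insert-insert (ind E z) (δ m 0ℤ z) (δ m (1ℤ + + h) z))
    (trans (cong (λ x → + 4 * x + 1ℤ * (1ℤ - -1ℤ)) size-middle) (lem (+ odd t)))
    where
    E⁺ : Subset m
    E⁺ = insert (lift E) 0ℤ (∉-middle 0 ℕ.z≤n)
    B : Subset m
    B = insert E⁺ (1ℤ + + h) (cong₂ _+_ (trans (periodic E 1ℤ) (∉-middle 1 0<s))
      (δ-no (∤-small h 1+h<m (cong ∣_∣ (+-identityʳ (1ℤ + + h))))))
    lem : ∀ x → + 4 * x + 1ℤ * (1ℤ - -1ℤ) ≡ (1ℤ + (x + x)) + (1ℤ + (x + x))
    lem = solve-∀

nutPair-odd : ∀ p t → suc t ℕ.< p → NutPair (odd p) ((suc t ℕ.+ suc t) ℕ.+ (suc t ℕ.+ suc t))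
nutPair-odd p t 1+t<p = OddOrder.nutPair p set even size≡ 0∉ 1∉ (3∉ 1+t<p)
  (∤-small 0 (ℕ.≤-trans (ℕ.s≤s (ℕ.s≤s ℕ.z≤n)) 5≤m) refl)
  (∤-small 1 (ℕ.≤-trans (ℕ.s≤s (ℕ.s≤s (ℕ.s≤s ℕ.z≤n))) 5≤m) refl)
  m∤6
  (cong +_ (lem t))
  where
  open Evens p t (ℕ.<-trans (ℕ.n<1+n t) 1+t<p)
  2≤p : 2 ℕ.≤ p
  2≤p = ℕ.≤-trans (ℕ.s≤s (ℕ.s≤s ℕ.z≤n)) 1+t<p
  5≤m : 5 ℕ.≤ odd p
  5≤m = ℕ.s≤s (ℕ.+-mono-≤ 2≤p 2≤p)
  m∤6 : odd p ∤ + 6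
  -- 2 is invertible modulo the odd m, so m ∣ 6 would give m ∣ 3, but m ≥ 5.
  m∤6 d = ∤-small {odd p} 2 (ℕ.≤-trans (ℕ.n≤1+n 4) 5≤m) refl (cancel-2 p (+ 3) d)
  lem : ∀ t → 4 ℕ.+ ((t ℕ.+ t) ℕ.+ (t ℕ.+ t)) ≡ (suc t ℕ.+ suc t) ℕ.+ (suc t ℕ.+ suc t)
  lem = ℕ-Solver.solve-∀

module OddHalf (q : ℕ) where

  private
    p h m : ℕ
    p = suc q
    h = odd p
    m = h ℕ.+ h

    6≤m : 6 ℕ.≤ m
    6≤m = ℕ.+-mono-≤ 3≤h 3≤h
      where
      3≤h : 3 ℕ.≤ h
      3≤h = ℕ.s≤s (ℕ.+-mono-≤ {1} {p} {1} {p} (ℕ.s≤s ℕ.z≤n) (ℕ.s≤s ℕ.z≤n))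

    1≢0 : m ∤ 1ℤ
    1≢0 = ∤-small 0 (ℕ.≤-trans (ℕ.m≤n+m 2 4) 6≤m) refl

    2≢0 : m ∤ + 2
    2≢0 = ∤-small 1 (ℕ.≤-trans (ℕ.m≤n+m 3 3) 6≤m) refl

    m-explicit : ∀ q → 6 ℕ.+ (4 ℕ.* q) ≡ suc (suc q ℕ.+ suc q) ℕ.+ suc (suc q ℕ.+ suc q)
    m-explicit = ℕ-Solver.solve-∀

    ∤-below : ∀ n k {z} → suc n ℕ.+ suc k ≡ 6 ℕ.+ 4 ℕ.* q → ∣ z ∣ ≡ suc n → m ∤ z
    ∤-below n k eq = ∤-small n (ℕ.≤-trans
      (ℕ.≤-trans (ℕ.m≤m+n (suc (suc n)) k) (ℕ.≤-reflexive (trans (sym (ℕ.+-suc (suc n) k)) eq)))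
      (ℕ.≤-reflexive (m-explicit q)))

  module _ (t : ℕ) (t<p : t ℕ.< p) where

    open Evens p t t<p

    private
      D : Subset m
      D = insertPair (lift set) even 1∉ 2≢0

      D-even : Even (ind D)
      D-even = insertPair-even (lift set) even 1∉ 2≢0

      size-D : size D ≡ + 2 + + ((t ℕ.+ t) ℕ.+ (t ℕ.+ t))
      size-D = trans (size-insertPair (lift set) even 1∉ 2≢0)
        (trans (cong (_+ + 2) (trans (size-lift set) (cong₂ _+_ size≡ size≡))) (+-comm (+ ((t ℕ.+ t) ℕ.+ (t ℕ.+ t))) (+ 2)))

      conv-D : ∀ {w} → Periodic m w → ∀ a →
        conv m (ind D) w a ≡ conv h (ind set) (Halves._⁺ h w) a + (w (a + 1ℤ) + w (a - 1ℤ))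
      conv-D {w} pw a = trans (conv-insertPair (lift set) even 1∉ 2≢0 pw a)
        (cong (_+ (w (a + 1ℤ) + w (a - 1ℤ))) (conv-double h (periodic set) w a))

      h∉ : ind set (+ h) ≡ 0ℤ
      h∉ = trans (cong (ind set) (sym (+-identityˡ (+ h)))) (trans (periodic set 0ℤ) 0∉)

      1+h∉ : ind set (1ℤ + + h) ≡ 0ℤ
      1+h∉ = trans (periodic set 1ℤ) 1∉

      0∉D : ind D 0ℤ ≡ 0ℤ
      0∉D = insertPair-∌ (lift set) even 1∉ 2≢0 0∉ (λ d → 1≢0 (∣m⇒∣-m d)) 1≢0

      h∉D : ind D (+ h) ≡ 0ℤ
      h∉D = insertPair-∌ (lift set) even 1∉ 2≢0 h∉
        (∤-below (suc (q ℕ.+ q)) (3 ℕ.+ (q ℕ.+ q)) (lem₁ q) (cong ∣_∣ (lem₂ (+ q))))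
        (∤-below (3 ℕ.+ (q ℕ.+ q)) (1 ℕ.+ (q ℕ.+ q)) (lem₃ q) (cong ∣_∣ (lem₄ (+ q))))
        where
        lem₁ : ∀ q → 2 ℕ.+ (q ℕ.+ q) ℕ.+ (4 ℕ.+ (q ℕ.+ q)) ≡ 6 ℕ.+ 4 ℕ.* q
        lem₁ = ℕ-Solver.solve-∀
        lem₂ : ∀ q → 1ℤ + (1ℤ + q + (1ℤ + q)) - 1ℤ ≡ + 2 + (q + q)
        lem₂ = solve-∀
        lem₃ : ∀ q → 4 ℕ.+ (q ℕ.+ q) ℕ.+ (2 ℕ.+ (q ℕ.+ q)) ≡ 6 ℕ.+ 4 ℕ.* q
        lem₃ = ℕ-Solver.solve-∀
        lem₄ : ∀ q → 1ℤ + (1ℤ + q + (1ℤ + q)) + 1ℤ ≡ + 4 + (q + q)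
        lem₄ = solve-∀

      1+h∉D : ind D (1ℤ + + h) ≡ 0ℤ
      1+h∉D = insertPair-∌ (lift set) even 1∉ 2≢0 1+h∉
        (∤-below (2 ℕ.+ (q ℕ.+ q)) (2 ℕ.+ (q ℕ.+ q)) (lem₁ q) (cong ∣_∣ (lem₂ (+ q))))
        (∤-below (4 ℕ.+ (q ℕ.+ q)) (q ℕ.+ q) (lem₃ q) (cong ∣_∣ (lem₄ (+ q))))
        where
        lem₁ : ∀ q → 3 ℕ.+ (q ℕ.+ q) ℕ.+ (3 ℕ.+ (q ℕ.+ q)) ≡ 6 ℕ.+ 4 ℕ.* q
        lem₁ = ℕ-Solver.solve-∀
        lem₂ : ∀ q → 1ℤ + (1ℤ + (1ℤ + q + (1ℤ + q))) - 1ℤ ≡ + 3 + (q + q)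
        lem₂ = solve-∀
        lem₃ : ∀ q → 5 ℕ.+ (q ℕ.+ q) ℕ.+ (1 ℕ.+ (q ℕ.+ q)) ≡ 6 ℕ.+ 4 ℕ.* q
        lem₃ = ℕ-Solver.solve-∀
        lem₄ : ∀ q → 1ℤ + (1ℤ + (1ℤ + q + (1ℤ + q))) + 1ℤ ≡ + 5 + (q + q)
        lem₄ = solve-∀

    nutPair-8t+4 : NutPair m ((odd t ℕ.+ odd t) ℕ.+ (odd t ℕ.+ odd t))
    nutPair-8t+4 = TwiceOdd.nutPair-0h p set even size≡ 0∉ 1∉ 1≢0 2≢0 (cong +_ (lem t))
      where
      lem : ∀ t → 4 ℕ.+ 4 ℕ.* (t ℕ.+ t) ≡ (suc (t ℕ.+ t) ℕ.+ suc (t ℕ.+ t)) ℕ.+ (suc (t ℕ.+ t) ℕ.+ suc (t ℕ.+ t))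
      lem = ℕ-Solver.solve-∀

    nutPair-8t+6 : NutPair m (suc (odd t ℕ.+ odd t) ℕ.+ suc (odd t ℕ.+ odd t))
    nutPair-8t+6 = TwiceOdd.nutPair-h p set even size≡ (1ℤ ∷ []) (reflects-even-1 p) (anti-injective-1 p)
      D D-even (λ {w} pw a → trans (conv-D pw a)
        (cong (_+_ (conv h (ind set) (Halves._⁺ h w) a)) (sym (+-identityʳ (w (a + 1ℤ) + w (a - 1ℤ))))))
      size-D 0∉D h∉D 1+h∉D (cong +_ (lem t))
      where
      lem : ∀ t → 2 ℕ.+ ((2 ℕ.+ ((t ℕ.+ t) ℕ.+ (t ℕ.+ t))) ℕ.+ (2 ℕ.+ ((t ℕ.+ t) ℕ.+ (t ℕ.+ t)))) ≡
        suc (suc (t ℕ.+ t) ℕ.+ suc (t ℕ.+ t)) ℕ.+ suc (suc (t ℕ.+ t) ℕ.+ suc (t ℕ.+ t))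
      lem = ℕ-Solver.solve-∀

    -- Degrees 2 modulo 8 take ± 3 besides ± 1: the cosets have 4 t elements, `D₃` has 4 t + 4, and
    -- the extra point in each of `A` and `B` gives d = 2 (4 t + 5).
    nutPair-8t+10 : suc t ℕ.< p → let a = suc t ℕ.+ suc t in NutPair m (suc (a ℕ.+ a) ℕ.+ suc (a ℕ.+ a))
    nutPair-8t+10 1+t<p = TwiceOdd.nutPair-h p set even size≡ (1ℤ ∷ + 3 ∷ []) (reflects-even-13 p) (anti-injective-13 p)
      D₃ (insertPair-even D D-even 3∉D 6≢0) conv-D₃ size-D₃
      (insertPair-∌ D D-even 3∉D 6≢0 0∉D (λ d → 3≢0 (∣m⇒∣-m d)) 3≢0)
      (insertPair-∌ D D-even 3∉D 6≢0 h∉D (h-3 q 0<q) (∤-below (5 ℕ.+ (q ℕ.+ q)) (ℕ.pred (q ℕ.+ q)) (below q 0<q) (cong ∣_∣ (lem₁ (+ q)))))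
      (insertPair-∌ D D-even 3∉D 6≢0 1+h∉D
        (∤-below (q ℕ.+ q) (4 ℕ.+ (q ℕ.+ q)) (lem₂ q) (cong ∣_∣ (lem₃ (+ q))))
        (below′ q 0<q))
      (cong +_ (lem t))
      where
      -- This means h ≥ 5. Then h + 4 < 2 h, so that h ± 3 and h + 1 ± 3 are nonzero modulo 2 h.
      0<q : 0 ℕ.< q
      0<q = ℕ.≤-pred (ℕ.≤-trans (ℕ.s≤s (ℕ.s≤s ℕ.z≤n)) 1+t<p)
      10≤m : 10 ℕ.≤ m
      10≤m = ℕ.≤-trans (ℕ.+-monoʳ-≤ 6 (ℕ.*-monoʳ-≤ 4 0<q)) (ℕ.≤-reflexive (m-explicit q))
      3≢0 : m ∤ + 3
      3≢0 = ∤-small 2 (ℕ.≤-trans (ℕ.m≤n+m 4 6) 10≤m) refl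
      6≢0 : m ∤ + 6
      6≢0 = ∤-small 5 (ℕ.≤-trans (ℕ.m≤n+m 7 3) 10≤m) refl
      3∉D : ind D (+ 3) ≡ 0ℤ
      3∉D = insertPair-∌ (lift set) even 1∉ 2≢0 (3∉ 1+t<p) 2≢0 (∤-small 3 (ℕ.≤-trans (ℕ.m≤n+m 5 5) 10≤m) refl)
      D₃ : Subset m
      D₃ = insertPair D D-even 3∉D 6≢0
      conv-D₃ : ∀ {w} → Periodic m w → ∀ a →
        conv m (ind D₃) w a ≡ conv h (ind set) (Halves._⁺ h w) a + shifts (1ℤ ∷ + 3 ∷ []) w a
      conv-D₃ {w} pw a = trans (conv-insertPair D D-even 3∉D 6≢0 pw a)
        (trans (cong (_+ (w (a + + 3) + w (a - + 3))) (conv-D pw a))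
          (reassoc (conv h (ind set) (Halves._⁺ h w) a) (w (a + 1ℤ)) (w (a - 1ℤ)) (w (a + + 3)) (w (a - + 3))))
        where
        reassoc : ∀ c x y z u → (c + (x + y)) + (z + u) ≡ c + ((x + y) + ((z + u) + 0ℤ))
        reassoc = solve-∀
      size-D₃ : size D₃ ≡ + 2 + + ((t ℕ.+ t) ℕ.+ (t ℕ.+ t)) + + 2
      size-D₃ = trans (size-insertPair D D-even 3∉D 6≢0) (cong (_+ + 2) size-D)
      h-3 : ∀ q → 0 ℕ.< q → suc (suc q ℕ.+ suc q) ℕ.+ suc (suc q ℕ.+ suc q) ∤ + suc (suc q ℕ.+ suc q) - + 3
      h-3 (suc r) _ = ∤-small (suc (r ℕ.+ r)) (ℕ.≤-trans (ℕ.m≤m+n (3 ℕ.+ (r ℕ.+ r)) (7 ℕ.+ (r ℕ.+ r))) (ℕ.≤-reflexive (eq₁ r)))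
        (cong ∣_∣ (eq₂ (+ r)))
        where
        eq₁ : ∀ r → 3 ℕ.+ (r ℕ.+ r) ℕ.+ (7 ℕ.+ (r ℕ.+ r)) ≡ suc (suc (suc r) ℕ.+ suc (suc r)) ℕ.+ suc (suc (suc r) ℕ.+ suc (suc r))
        eq₁ = ℕ-Solver.solve-∀
        eq₂ : ∀ r → 1ℤ + (+ 2 + r + (+ 2 + r)) - + 3 ≡ + 2 + (r + r)
        eq₂ = solve-∀
      below : ∀ q → 0 ℕ.< q → 6 ℕ.+ (q ℕ.+ q) ℕ.+ suc (ℕ.pred (q ℕ.+ q)) ≡ 6 ℕ.+ 4 ℕ.* q
      below (suc r) _ = eq r
        where
        eq : ∀ r → 6 ℕ.+ (suc r ℕ.+ suc r) ℕ.+ (suc r ℕ.+ suc r) ≡ 6 ℕ.+ 4 ℕ.* suc r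
        eq = ℕ-Solver.solve-∀
      below′ : ∀ q → 0 ℕ.< q →
        suc (suc q ℕ.+ suc q) ℕ.+ suc (suc q ℕ.+ suc q) ∤ 1ℤ + + suc (suc q ℕ.+ suc q) + + 3
      below′ (suc r) _ = ∤-small (8 ℕ.+ (r ℕ.+ r)) (ℕ.≤-trans (ℕ.m≤m+n (10 ℕ.+ (r ℕ.+ r)) (r ℕ.+ r)) (ℕ.≤-reflexive (eq₁ r)))
        (cong ∣_∣ (eq₂ (+ r)))
        where
        eq₁ : ∀ r → 10 ℕ.+ (r ℕ.+ r) ℕ.+ (r ℕ.+ r) ≡ suc (suc (suc r) ℕ.+ suc (suc r)) ℕ.+ suc (suc (suc r) ℕ.+ suc (suc r))
        eq₁ = ℕ-Solver.solve-∀
        eq₂ : ∀ r → 1ℤ + (1ℤ + (+ 2 + r + (+ 2 + r))) + + 3 ≡ + 9 + (r + r)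
        eq₂ = solve-∀
      lem₁ : ∀ q → 1ℤ + (1ℤ + q + (1ℤ + q)) + + 3 ≡ + 6 + (q + q)
      lem₁ = solve-∀
      lem₂ : ∀ q → suc (q ℕ.+ q) ℕ.+ (5 ℕ.+ (q ℕ.+ q)) ≡ 6 ℕ.+ 4 ℕ.* q
      lem₂ = ℕ-Solver.solve-∀
      lem₃ : ∀ q → 1ℤ + (1ℤ + (1ℤ + q + (1ℤ + q))) - + 3 ≡ 1ℤ + (q + q)
      lem₃ = solve-∀
      lem : ∀ t → 2 ℕ.+ ((2 ℕ.+ ((t ℕ.+ t) ℕ.+ (t ℕ.+ t)) ℕ.+ 2) ℕ.+ (2 ℕ.+ ((t ℕ.+ t) ℕ.+ (t ℕ.+ t)) ℕ.+ 2)) ≡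
        suc ((suc t ℕ.+ suc t) ℕ.+ (suc t ℕ.+ suc t)) ℕ.+ suc ((suc t ℕ.+ suc t) ℕ.+ (suc t ℕ.+ suc t))
      lem = ℕ-Solver.solve-∀

-- All orders and degrees

parity : ∀ n → (Σ ℕ λ p → n ≡ p ℕ.+ p) ⊎ (Σ ℕ λ p → n ≡ odd p)
parity zero    = inj₁ (0 , refl)
parity (suc n) with parity n
... | inj₁ (p , eq) = inj₂ (p , cong suc eq)
... | inj₂ (p , eq) = inj₁ (suc p , cong suc (trans eq (sym (ℕ.+-suc p p))))

≤-suc : ∀ {a b} → suc a ℕ.≤ b → a ℕ.≤ b
≤-suc = ℕ.≤-trans (ℕ.n≤1+n _)

-- Here n = 2 m and d = 2 k. The parities of `m`, of `k` and of their halves select the family, and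
-- halving k + 2 ≤ m along the way yields the room that the family asks for.
nutPair-exists : ∀ m k → 2 ℕ.≤ k → suc (suc k) ℕ.≤ m →
  (Σ ℕ λ h → m ≡ h ℕ.+ h) ⊎ (Σ ℕ λ a → k ≡ a ℕ.+ a) → NutPair m (k ℕ.+ k)
nutPair-exists m k 2≤k k+2≤m even with parity m | parity k
... | inj₂ (p , refl) | inj₂ (a , refl) = ⊥-elim (impossible even)
  where
  odd≢double : ∀ x y → odd x ≢ y ℕ.+ y
  odd≢double x y eq = 2∤odd x (subst (2ℤ ∣_) (trans (lem (+ y)) (cong +_ (sym eq))) (2∣double (+ y)))
    where
    lem : ∀ y → 2ℤ * y ≡ y + y
    lem = solve-∀
  impossible : _ → ⊥
  impossible (inj₁ (h , eq)) = odd≢double p h eq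
  impossible (inj₂ (b , eq)) = odd≢double a b eq
... | inj₂ (p , refl) | inj₁ (suc t , refl) = nutPair-odd p t
  (a+a≤1+b+b⇒a≤b (suc (suc t)) p (subst (λ x → suc (suc x) ℕ.≤ odd p) (sym (ℕ.+-suc t (suc t))) k+2≤m))
... | inj₁ (h , refl) | inj₁ (a , refl) with parity a
...   | inj₁ (suc t , refl) = nutPair-8t h (suc t) {{ℕ.>-nonZero (ℕ.≤-<-trans ℕ.z≤n a<h)}} ℕ.z<s a<h
  where
  a<h : suc t ℕ.+ suc t ℕ.< h
  a<h = 1+a+a≤b+b⇒a<b _ h (≤-suc k+2≤m)
...   | inj₂ (t , refl) with parity h
...     | inj₁ (H , refl) with <⇒∃ (1+a+a≤b+b⇒a<b t H (≤-suc (1+a+a≤b+b⇒a<b (odd t) (H ℕ.+ H) (≤-suc k+2≤m))))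
...       | s , refl = subst (λ x → NutPair ((suc x ℕ.+ suc x) ℕ.+ (suc x ℕ.+ suc x)) ((odd t ℕ.+ odd t) ℕ.+ (odd t ℕ.+ odd t)))
  (ℕ.+-comm s t) (EvenHalf.nutPair-8t+4 s t)
nutPair-exists m k 2≤k k+2≤m even | inj₁ (h , refl) | inj₁ (a , refl) | inj₂ (t , refl) | inj₂ (suc q , refl) =
  OddHalf.nutPair-8t+4 q t
    (1+a+a≤b+b⇒a<b t (suc q) (ℕ.≤-pred (1+a+a≤b+b⇒a<b (odd t) (odd (suc q)) (≤-suc k+2≤m))))
nutPair-exists m k 2≤k k+2≤m even | inj₁ (h , refl) | inj₁ (a , refl) | inj₂ (t , refl) | inj₂ (zero , refl) =
  ⊥-elim (ℕ.<⇒≱ (ℕ.s≤s (ℕ.s≤s ℕ.z≤n)) (1+a+a≤b+b⇒a<b (odd t) 1 (≤-suc k+2≤m)))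
nutPair-exists m k 2≤k k+2≤m even | inj₁ (h , refl) | inj₂ (a , refl) = cases (parity a) (parity h)
  where
  1+a<h : suc a ℕ.< h
  1+a<h = 1+a+a≤b+b⇒a<b (suc a) h (subst (λ x → suc (suc x) ℕ.≤ h ℕ.+ h) (sym (ℕ.+-suc a a)) k+2≤m)
  cases : _ → _ → NutPair (h ℕ.+ h) (odd a ℕ.+ odd a)
  -- a = 0 would mean d = 2.
  cases (inj₁ (zero , refl)) _ = ⊥-elim (ℕ.<⇒≱ ℕ.≤-refl 2≤k)
  cases (inj₁ (suc t , refl)) (inj₁ (H , refl)) with <⇒∃ (1+a+a≤b+b⇒a<b (suc t) H (≤-suc 1+a<h))
  ... | s , refl = subst (λ x → NutPair ((suc x ℕ.+ suc x) ℕ.+ (suc x ℕ.+ suc x)) (odd (suc t ℕ.+ suc t) ℕ.+ odd (suc t ℕ.+ suc t)))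
    (ℕ.+-comm s (suc t)) (EvenHalf.nutPair-8t+2 s (suc t) ℕ.z<s)
  cases (inj₁ (suc t , refl)) (inj₂ (zero , refl)) = ⊥-elim (ℕ.<⇒≱ 1+a<h (ℕ.s≤s ℕ.z≤n))
  cases (inj₁ (suc t , refl)) (inj₂ (suc q , refl)) = OddHalf.nutPair-8t+10 q t (≤-suc 1+t<p) 1+t<p
    where
    1+t<p : suc t ℕ.< suc q
    1+t<p = 1+a+a≤b+b⇒a<b (suc t) (suc q) (ℕ.≤-pred 1+a<h)
  cases (inj₂ (t , refl)) (inj₁ (H , refl))
    with <⇒∃ (1+a+a≤b+b⇒a<b (suc t) H (subst (λ x → suc (suc x) ℕ.≤ H ℕ.+ H) (sym (ℕ.+-suc t t)) 1+a<h))
  -- Here the bound leaves H ≥ t + 2, one more than the block and its centre occupy; this unit is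
  -- the condition 0 < s of the family.
  ... | s , refl = subst (λ x → NutPair ((suc x ℕ.+ suc x) ℕ.+ (suc x ℕ.+ suc x)) (odd (odd t) ℕ.+ odd (odd t)))
    (cong suc (ℕ.+-comm s t)) (EvenHalf.nutPair-8t+6 (suc s) t ℕ.z<s)
  cases (inj₂ (t , refl)) (inj₂ (zero , refl)) = ⊥-elim (ℕ.<⇒≱ 1+a<h (ℕ.s≤s ℕ.z≤n))
  cases (inj₂ (t , refl)) (inj₂ (suc q , refl)) = OddHalf.nutPair-8t+6 q t
    (1+a+a≤b+b⇒a<b t (suc q) (≤-suc (ℕ.≤-pred 1+a<h)))

-- The dihedral group as ℤ/m ⋊ {±1}: (a , false) is rᵃ and (a , true) is rᵃs.

reflect : Bool → ℤ → ℤ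
reflect false a = a
reflect true  a = - a

module Semidirect (m : ℕ) .{{_ : NonZero m}} where

  infix 4 _≈_
  infixr 4 _,_
  record _≈_ (x y : ℤ × Bool) : Set where
    constructor _,_
    field
      congruent : + m ∣ proj₁ x - proj₁ y
      same-type : proj₂ x ≡ proj₂ y
  open _≈_ using (congruent)

  ≡⇒≈ : ∀ {x y} → x ≡ y → x ≈ y
  ≡⇒≈ {a , s} refl = ∣0 a , refl

  ≈-sym : ∀ {x y} → x ≈ y → y ≈ x
  ≈-sym {a , _} {b , _} (d , eq) = subst (+ m ∣_) (lem a b) (∣m⇒∣-m d) , sym eq
    where
    lem : ∀ a b → - (a - b) ≡ b - a
    lem = solve-∀

  ≈-trans : ∀ {x y z} → x ≈ y → y ≈ z → x ≈ z
  ≈-trans {a , _} {b , _} {c , _} (d , eq) (d′ , eq′) =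
    subst (+ m ∣_) (lem a b c) (∣m∣n⇒∣m+n d d′) , trans eq eq′
    where
    lem : ∀ a b c → (a - b) + (b - c) ≡ a - c
    lem = solve-∀

  infixl 7 _∙_
  _∙_ : ℤ × Bool → ℤ × Bool → ℤ × Bool
  (a , s) ∙ (b , t) = a + reflect s b , s xor t

  infix 8 _⁻¹
  _⁻¹ : ℤ × Bool → ℤ × Bool
  (a , false) ⁻¹ = - a , false
  (a , true)  ⁻¹ = a , true

  ∙-cong : ∀ {x x′ y y′} → x ≈ x′ → y ≈ y′ → x ∙ y ≈ x′ ∙ y′
  ∙-cong {a , false} {a′ , _} {b , _} {b′ , _} (d , refl) (e , refl) =
    subst (+ m ∣_) (lem a a′ b b′) (∣m∣n⇒∣m+n d e) , refl
    where
    lem : ∀ a a′ b b′ → (a - a′) + (b - b′) ≡ (a + b) - (a′ + b′)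
    lem = solve-∀
  ∙-cong {a , true} {a′ , _} {b , _} {b′ , _} (d , refl) (e , refl) =
    subst (+ m ∣_) (lem a a′ b b′) (∣m∣n⇒∣m-n d e) , refl
    where
    lem : ∀ a a′ b b′ → (a - a′) - (b - b′) ≡ (a - b) - (a′ - b′)
    lem = solve-∀

  ⁻¹-cong : ∀ {x y} → x ≈ y → x ⁻¹ ≈ y ⁻¹
  ⁻¹-cong {a , false} {b , _} (d , refl) = subst (+ m ∣_) (lem a b) (∣m⇒∣-m d) , refl
    where
    lem : ∀ a b → - (a - b) ≡ - a - - b
    lem = solve-∀
  ⁻¹-cong {a , true} {b , _} (d , refl) = d , refl

  reflect-∙ : ∀ s t a b c → (a + reflect s b) + reflect (s xor t) c ≡ a + reflect s (b + reflect t c)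
  reflect-∙ false false = lem where
    lem : ∀ a b c → a + b + c ≡ a + (b + c)
    lem = solve-∀
  reflect-∙ false true = lem where
    lem : ∀ a b c → a + b + - c ≡ a + (b + - c)
    lem = solve-∀
  reflect-∙ true false = lem where
    lem : ∀ a b c → a + - b + - c ≡ a + - (b + c)
    lem = solve-∀
  reflect-∙ true true = lem where
    lem : ∀ a b c → a + - b + c ≡ a + - (b + - c)
    lem = solve-∀

  ∙-assoc : ∀ x y z → x ∙ y ∙ z ≡ x ∙ (y ∙ z)
  ∙-assoc (a , s) (b , t) (c , u) = cong₂ _,_ (reflect-∙ s t a b c) (xor-assoc s t u)

  ε : ℤ × Bool
  ε = 0ℤ , false

  identityˡ : ∀ x → ε ∙ x ≡ x
  identityˡ (a , s) = cong (_, s) (+-identityˡ a)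

  identityʳ : ∀ x → x ∙ ε ≡ x
  identityʳ (a , false) = cong (_, false) (+-identityʳ a)
  identityʳ (a , true)  = cong (_, true) (+-identityʳ a)

  inverseˡ : ∀ x → x ⁻¹ ∙ x ≡ ε
  inverseˡ (a , false) = cong (_, false) (+-inverseˡ a)
  inverseˡ (a , true)  = cong (_, false) (+-inverseʳ a)

  inverseʳ : ∀ x → x ∙ x ⁻¹ ≡ ε
  inverseʳ (a , false) = cong (_, false) (+-inverseʳ a)
  inverseʳ (a , true)  = cong (_, false) (+-inverseʳ a)

  group : Group 0ℓ 0ℓ
  group = record
    { Carrier = ℤ × Bool ; _≈_ = _≈_ ; _∙_ = _∙_ ; ε = ε ; _⁻¹ = _⁻¹
    ; isGroup = record
      { isMonoid = record
        { isSemigroup = record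
          { isMagma = record
            { isEquivalence = record { refl = ≡⇒≈ refl ; sym = ≈-sym ; trans = ≈-trans }
            ; ∙-cong = ∙-cong
            }
          ; assoc = λ x y z → ≡⇒≈ (∙-assoc x y z)
          }
        ; identity = (λ x → ≡⇒≈ (identityˡ x)) , (λ x → ≡⇒≈ (identityʳ x))
        }
      ; inverse = (λ x → ≡⇒≈ (inverseˡ x)) , (λ x → ≡⇒≈ (inverseʳ x))
      ; ⁻¹-cong = ⁻¹-cong
      }
    }

  residue : ℤ → ℕ
  residue a = a %ℕ m

  residue-∣ : ∀ a → + m ∣ + residue a - a
  residue-∣ a = divides (- (a /ℕ m)) (trans (cong (λ x → + residue a - x) (a≡a%ℕn+[a/ℕn]*n a m))
    (lem (+ residue a) (a /ℕ m) (+ m)))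
    where
    lem : ∀ r q m → r - (r + q * m) ≡ - q * m
    lem = solve-∀

  small-unique-≤ : ∀ {k l} → k ℕ.< m → l ℕ.≤ k → + m ∣ + k - + l → k ≡ l
  small-unique-≤ {k} {l} k<m l≤k d with <⇒∃ l≤k
  ... | zero  , refl = ℕ.+-identityʳ l
  ... | suc j , refl = ⊥-elim (∤-small j (ℕ.≤-<-trans (ℕ.m≤n+m (suc j) l) k<m) (cong ∣_∣ (lem (+ l) (+ suc j))) d)
    where
    lem : ∀ l j → l + j - l ≡ j
    lem = solve-∀

  small-unique : ∀ {k l} → k ℕ.< m → l ℕ.< m → + m ∣ + k - + l → k ≡ l
  small-unique {k} {l} k<m l<m d with ℕ.≤-total l k
  ... | inj₁ l≤k = small-unique-≤ k<m l≤k d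
  ... | inj₂ k≤l = sym (small-unique-≤ l<m k≤l (congruent (≈-sym {+ k , true} {+ l , true} (d , refl))))

  residue-cong : ∀ a b → + m ∣ a - b → residue a ≡ residue b
  residue-cong a b d = small-unique (n%ℕd<d a m) (n%ℕd<d b m)
    (subst (+ m ∣_) (lem (+ residue a) a b (+ residue b))
      (∣m∣n⇒∣m-n (∣m∣n⇒∣m+n (residue-∣ a) d) (residue-∣ b)))
    where
    lem : ∀ r a b s → (r - a) + (a - b) - (s - b) ≡ r - s
    lem = solve-∀

  toVertex : Fin m ⊎ Fin m → ℤ × Bool
  toVertex (inj₁ i) = + toℕ i , false
  toVertex (inj₂ i) = + toℕ i , true

  fromVertex : ℤ × Bool → Fin m ⊎ Fin m
  fromVertex (a , false) = inj₁ (fromℕ< (n%ℕd<d a m))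
  fromVertex (a , true)  = inj₂ (fromℕ< (n%ℕd<d a m))

  fromℕ<-residue : ∀ a b → + m ∣ a - b → fromℕ< (n%ℕd<d a m) ≡ fromℕ< (n%ℕd<d b m)
  fromℕ<-residue a b d = toℕ-injective
    (trans (toℕ-fromℕ< (n%ℕd<d a m)) (trans (residue-cong a b d) (sym (toℕ-fromℕ< (n%ℕd<d b m)))))

  fromVertex-cong : ∀ {x y} → x ≈ y → fromVertex x ≡ fromVertex y
  fromVertex-cong {a , false} {b , _} (d , refl) = cong inj₁ (fromℕ<-residue a b d)
  fromVertex-cong {a , true}  {b , _} (d , refl) = cong inj₂ (fromℕ<-residue a b d)

  to∘fromVertex : ∀ x → toVertex (fromVertex x) ≈ x
  to∘fromVertex (a , false) = subst (λ k → + m ∣ + k - a) (sym (toℕ-fromℕ< (n%ℕd<d a m))) (residue-∣ a) , refl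
  to∘fromVertex (a , true)  = subst (λ k → + m ∣ + k - a) (sym (toℕ-fromℕ< (n%ℕd<d a m))) (residue-∣ a) , refl

  fromℕ<-toℕ : ∀ i → fromℕ< (n%ℕd<d (+ toℕ i) m) ≡ i
  fromℕ<-toℕ i = toℕ-injective (trans (toℕ-fromℕ< (n%ℕd<d (+ toℕ i) m))
    (small-unique (n%ℕd<d (+ toℕ i) m) (toℕ<n i) (residue-∣ (+ toℕ i))))

  from∘toVertex : ∀ x → fromVertex (toVertex x) ≡ x
  from∘toVertex (inj₁ i) = cong inj₁ (fromℕ<-toℕ i)
  from∘toVertex (inj₂ i) = cong inj₂ (fromℕ<-toℕ i)

  order : HasOrder (Group.setoid group) (m ℕ.+ m)
  order = record
    { to        = λ i → toVertex (splitAt m i)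
    ; from      = λ x → join m m (fromVertex x)
    ; to-cong   = λ { refl → ≡⇒≈ refl }
    ; from-cong = λ x≈y → cong (join m m) (fromVertex-cong x≈y)
    ; inverse   =
        (λ { {x} refl → ≈-trans (≡⇒≈ (cong toVertex (splitAt-join m m (fromVertex x)))) (to∘fromVertex x) })
      , (λ {i} y≈ → trans (cong (join m m) (trans (fromVertex-cong y≈) (from∘toVertex (splitAt m i)))) (join-splitAt m m i))
    }

  -- The isomorphism with the presented group

  open Defs using () renaming (r to ρ; s to σ)
  open Presentation DihedralGenerator using (Word; gen; e; _·_; _⁻; _^_; Eq; presentedGroup)
  module D = Group (Dihedral m)
  open GroupProperties (Dihedral m) using (inverseˡ-unique; ⁻¹-anti-homo-∙; ⁻¹-involutive)

  eval : Word → ℤ × Bool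
  eval (gen ρ) = 1ℤ , false
  eval (gen σ) = 0ℤ , true
  eval e       = ε
  eval (u · v) = eval u ∙ eval v
  eval (u ⁻)   = eval u ⁻¹

  eval-r^ : ∀ k → eval (gen ρ ^ k) ≡ (+ k , false)
  eval-r^ zero    = refl
  eval-r^ (suc k) = cong ((1ℤ , false) ∙_) (eval-r^ k)

  eval-rel : ∀ {u v} → DihedralRelation m u v → eval u ≈ eval v
  eval-rel rᵐ≈e   = subst (_≈ ε) (sym (eval-r^ m)) (subst (+ m ∣_) (sym (+-identityʳ (+ m))) ∣-refl , refl)
  eval-rel s²≈e   = ≡⇒≈ refl
  eval-rel srs≈r⁻ = ≡⇒≈ refl

  eval-cong : ∀ {u v} → u D.≈ v → eval u ≈ eval v
  eval-cong (Eq.rel p)          = eval-rel p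
  eval-cong Eq.refl             = ≡⇒≈ refl
  eval-cong (Eq.sym p)          = ≈-sym (eval-cong p)
  eval-cong (Eq.trans p q)      = ≈-trans (eval-cong p) (eval-cong q)
  eval-cong (Eq.·-cong p q)     = ∙-cong (eval-cong p) (eval-cong q)
  eval-cong (Eq.⁻-cong p)       = ⁻¹-cong (eval-cong p)
  eval-cong (Eq.assoc u v w)    = ≡⇒≈ (∙-assoc (eval u) (eval v) (eval w))
  eval-cong (Eq.identityˡ u)    = ≡⇒≈ (identityˡ (eval u))
  eval-cong (Eq.identityʳ u)    = ≡⇒≈ (identityʳ (eval u))
  eval-cong (Eq.inverseˡ u)     = ≡⇒≈ (inverseˡ (eval u))
  eval-cong (Eq.inverseʳ u)     = ≡⇒≈ (inverseʳ (eval u))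

  open import Relation.Binary.Reasoning.Setoid D.setoid

  r^ : ℕ → Word
  r^ k = gen ρ ^ k

  s^ : Bool → Word
  s^ false = e
  s^ true  = gen σ

  r^-+ : ∀ k l → r^ (k ℕ.+ l) D.≈ r^ k · r^ l
  r^-+ zero    l = D.sym (D.identityˡ (r^ l))
  r^-+ (suc k) l = D.trans (D.∙-congˡ (r^-+ k l)) (D.sym (D.assoc (gen ρ) (r^ k) (r^ l)))

  r^-multiple : ∀ k q → r^ (k ℕ.+ q ℕ.* m) D.≈ r^ k
  r^-multiple k zero    = D.reflexive (cong r^ (ℕ.+-identityʳ k))
  r^-multiple k (suc q) = begin
    r^ (k ℕ.+ (m ℕ.+ q ℕ.* m))       ≡⟨ cong r^ (trans (sym (ℕ.+-assoc k m _)) (trans (cong (ℕ._+ q ℕ.* m) (ℕ.+-comm k m)) (ℕ.+-assoc m k _))) ⟩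
    r^ (m ℕ.+ (k ℕ.+ q ℕ.* m))       ≈⟨ r^-+ m (k ℕ.+ q ℕ.* m) ⟩
    r^ m · r^ (k ℕ.+ q ℕ.* m)        ≈⟨ D.∙-cong (Eq.rel rᵐ≈e) (r^-multiple k q) ⟩
    e · r^ k                         ≈⟨ D.identityˡ (r^ k) ⟩
    r^ k                             ∎

  r^-residue : ∀ k → r^ k D.≈ r^ (residue (+ k))
  r^-residue k = D.trans (D.reflexive (cong r^ (m≡m%n+[m/n]*n k m))) (r^-multiple (k ℕ.% m) (k ℕ./ m))

  r^-cong : ∀ k l → + m ∣ + k - + l → r^ k D.≈ r^ l
  r^-cong k l d = D.trans (r^-residue k) (D.trans (D.reflexive (cong r^ (residue-cong (+ k) (+ l) d))) (D.sym (r^-residue l)))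

  -- Multiply s r s = r⁻¹ by s on the right and use s² = e.
  s·r : gen σ · gen ρ D.≈ gen ρ ⁻ · gen σ
  s·r = begin
    gen σ · gen ρ                       ≈⟨ D.identityʳ _ ⟨
    gen σ · gen ρ · e                   ≈⟨ D.∙-congˡ (D.trans (D.sym (Eq.rel s²≈e)) (D.∙-congˡ (D.identityʳ (gen σ)))) ⟩
    gen σ · gen ρ · (gen σ · gen σ)     ≈⟨ D.assoc (gen σ · gen ρ) (gen σ) (gen σ) ⟨
    gen σ · gen ρ · gen σ · gen σ       ≈⟨ D.∙-congʳ (Eq.rel srs≈r⁻) ⟩
    gen ρ ⁻ · gen σ                     ∎

  r·r^ : ∀ k → gen ρ · r^ k D.≈ r^ k · gen ρ
  r·r^ k = begin
    r^ (suc k)        ≡⟨ cong r^ (ℕ.+-comm 1 k) ⟩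
    r^ (k ℕ.+ 1)      ≈⟨ r^-+ k 1 ⟩
    r^ k · (gen ρ · e) ≈⟨ D.∙-congˡ (D.identityʳ (gen ρ)) ⟩
    r^ k · gen ρ      ∎

  s·r^ : ∀ k → gen σ · r^ k D.≈ r^ k ⁻ · gen σ
  s·r^ zero    = begin
    gen σ · e   ≈⟨ D.identityʳ (gen σ) ⟩
    gen σ       ≈⟨ D.identityˡ (gen σ) ⟨
    e · gen σ   ≈⟨ D.∙-congʳ (inverseˡ-unique e e (D.identityˡ e)) ⟩
    e ⁻ · gen σ ∎
  s·r^ (suc k) = begin
    gen σ · (gen ρ · r^ k)        ≈⟨ D.assoc (gen σ) (gen ρ) (r^ k) ⟨
    gen σ · gen ρ · r^ k          ≈⟨ D.∙-congʳ s·r ⟩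
    gen ρ ⁻ · gen σ · r^ k        ≈⟨ D.assoc (gen ρ ⁻) (gen σ) (r^ k) ⟩
    gen ρ ⁻ · (gen σ · r^ k)      ≈⟨ D.∙-congˡ (s·r^ k) ⟩
    gen ρ ⁻ · (r^ k ⁻ · gen σ)    ≈⟨ D.assoc (gen ρ ⁻) (r^ k ⁻) (gen σ) ⟨
    gen ρ ⁻ · r^ k ⁻ · gen σ      ≈⟨ D.∙-congʳ (⁻¹-anti-homo-∙ (r^ k) (gen ρ)) ⟨
    (r^ k · gen ρ) ⁻ · gen σ      ≈⟨ D.∙-congʳ (D.⁻¹-cong (r·r^ k)) ⟨
    (gen ρ · r^ k) ⁻ · gen σ      ∎

  word : ℤ × Bool → Word
  word (a , b) = r^ (residue a) · s^ b

  word-cong : ∀ {x y} → x ≈ y → word x D.≈ word y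
  word-cong {a , b} {c , _} (d , refl) = D.reflexive (cong (λ k → r^ k · s^ b) (residue-cong a c d))

  residue-+ : ∀ a b → r^ (residue (a + b)) D.≈ r^ (residue a) · r^ (residue b)
  residue-+ a b = D.trans (r^-cong (residue (a + b)) (residue a ℕ.+ residue b) (subst (+ m ∣_) (lem (+ residue (a + b)) a b (+ residue a) (+ residue b))
      (∣m∣n⇒∣m-n (residue-∣ (a + b)) (∣m∣n⇒∣m+n (residue-∣ a) (residue-∣ b)))))
    (r^-+ (residue a) (residue b))
    where
    lem : ∀ t a b r s → (t - (a + b)) - ((r - a) + (s - b)) ≡ t - (r + s)
    lem = solve-∀

  residue-neg : ∀ a → r^ (residue (- a)) D.≈ r^ (residue a) ⁻
  residue-neg a = inverseˡ-unique _ _ (begin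
    r^ (residue (- a)) · r^ (residue a) ≈⟨ residue-+ (- a) a ⟨
    r^ (residue (- a + a))              ≈⟨ r^-cong (residue (- a + a)) 0 (subst (+ m ∣_) (cong (_-_ (+ residue (- a + a))) (+-inverseˡ a)) (residue-∣ (- a + a))) ⟩
    r^ 0                                ∎)

  s^-xor : ∀ s t → s^ (s xor t) D.≈ s^ s · s^ t
  s^-xor false t     = D.sym (D.identityˡ (s^ t))
  s^-xor true  false = D.sym (D.identityʳ (gen σ))
  s^-xor true  true  = D.trans (D.sym (Eq.rel s²≈e)) (D.∙-congˡ (D.identityʳ (gen σ)))

  s^·r^ : ∀ s a → s^ s · r^ (residue a) D.≈ r^ (residue (reflect s a)) · s^ s
  s^·r^ false a = D.trans (D.identityˡ _) (D.sym (D.identityʳ _))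
  s^·r^ true  a = D.trans (s·r^ (residue a)) (D.∙-congʳ (D.sym (residue-neg a)))

  word-∙ : ∀ x y → word (x ∙ y) D.≈ word x · word y
  word-∙ (a , s) (b , t) = begin
    r^ (residue (a + reflect s b)) · s^ (s xor t)
      ≈⟨ D.∙-cong (residue-+ a (reflect s b)) (s^-xor s t) ⟩
    (r^ (residue a) · r^ (residue (reflect s b))) · (s^ s · s^ t)
      ≈⟨ D.assoc (r^ (residue a)) (r^ (residue (reflect s b))) (s^ s · s^ t) ⟩
    r^ (residue a) · (r^ (residue (reflect s b)) · (s^ s · s^ t))
      ≈⟨ D.∙-congˡ (D.assoc (r^ (residue (reflect s b))) (s^ s) (s^ t)) ⟨
    r^ (residue a) · (r^ (residue (reflect s b)) · s^ s · s^ t)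
      ≈⟨ D.∙-congˡ (D.∙-congʳ (s^·r^ s b)) ⟨
    r^ (residue a) · (s^ s · r^ (residue b) · s^ t)
      ≈⟨ D.∙-congˡ (D.assoc (s^ s) (r^ (residue b)) (s^ t)) ⟩
    r^ (residue a) · (s^ s · (r^ (residue b) · s^ t))
      ≈⟨ D.assoc (r^ (residue a)) (s^ s) (r^ (residue b) · s^ t) ⟨
    (r^ (residue a) · s^ s) · (r^ (residue b) · s^ t) ∎

  word-ε : word ε D.≈ e
  word-ε = D.trans (D.identityʳ _) (D.sym (r^-residue 0))

  -- Every word equals a normal form rᵏ sᵇ with k < m, so the relations leave at most 2 m classes.
  -- By `eval-cong` and `eval-word` these stay distinct.
  word-eval : ∀ w → word (eval w) D.≈ w
  word-eval (gen ρ) = D.trans (D.identityʳ _) (D.trans (D.sym (r^-residue 1)) (D.identityʳ (gen ρ)))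
  word-eval (gen σ) = D.trans (D.∙-congʳ (D.sym (r^-residue 0))) (D.identityˡ (gen σ))
  word-eval e       = word-ε
  word-eval (u · v) = D.trans (word-∙ (eval u) (eval v)) (D.∙-cong (word-eval u) (word-eval v))
  -- As `word` is multiplicative, `word (eval u ⁻¹)` is a left inverse of `word (eval u)`, hence of
  -- `u`; left inverses are unique.
  word-eval (u ⁻)   = inverseˡ-unique _ _ (begin
    word (eval u ⁻¹) · u               ≈⟨ D.∙-congˡ (word-eval u) ⟨
    word (eval u ⁻¹) · word (eval u)   ≈⟨ word-∙ (eval u ⁻¹) (eval u) ⟨
    word (eval u ⁻¹ ∙ eval u)          ≡⟨ cong word (inverseˡ (eval u)) ⟩
    word ε                             ≈⟨ word-ε ⟩
    e                                  ∎)

  eval-s^ : ∀ b → eval (s^ b) ≡ (0ℤ , b)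
  eval-s^ false = refl
  eval-s^ true  = refl

  eval-word : ∀ x → eval (word x) ≈ x
  eval-word (a , b) = ≈-trans
    (≡⇒≈ (trans (cong₂ _∙_ (eval-r^ (residue a)) (eval-s^ b)) (cong (_, b) (+-identityʳ (+ residue a)))))
    (residue-∣ a , refl)

  isomorphism : Dihedral m ≅ group
  isomorphism = eval , record
    { isGroupMonomorphism = record
      { isGroupHomomorphism = record
        { isMonoidHomomorphism = record
          { isMagmaHomomorphism = record
            { isRelHomomorphism = record { cong = eval-cong }
            ; homo = λ u v → ≡⇒≈ refl
            }
          ; ε-homo = ≡⇒≈ refl
          }
        ; ⁻¹-homo = λ u → ≡⇒≈ refl
        }
      ; injective = λ {u} {v} eq → D.trans (D.sym (word-eval u)) (D.trans (word-cong eq) (word-eval v))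
      }
    ; surjective = λ x → word x , λ eq → ≈-trans (eval-cong eq) (eval-word x)
    }

-- Sums over `Fin n` and counting

sum-cong : ∀ {n} {f g : Fin n → ℤ} → (∀ i → f i ≡ g i) → sum f ≡ sum g
sum-cong {zero}  eq = refl
sum-cong {suc n} eq = cong₂ _+_ (eq zero) (sum-cong (λ i → eq (suc i)))

sum-splitAt : ∀ m {n} (f : Fin (m ℕ.+ n) → ℤ) → sum f ≡ sum (λ i → f (i ↑ˡ n)) + sum (λ j → f (m ↑ʳ j))
sum-splitAt zero    f = sym (+-identityˡ _)
sum-splitAt (suc m) f = trans (cong (_+_ (f zero)) (sum-splitAt m (f ∘ suc))) (sym (+-assoc (f zero) _ _))

sum-toℕ : ∀ n (g : ℤ → ℤ) → sum {n} (λ i → g (+ toℕ i)) ≡ sumTo n g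
sum-toℕ zero    g = refl
sum-toℕ (suc n) g = trans
  (cong (_+_ (g 0ℤ)) (trans (sum-cong {n} λ i → cong g (sym (+n+1 (toℕ i)))) (sum-toℕ n (λ z → g (z + 1ℤ)))))
  (sym (sumTo-head n g))

length-filter : ∀ {A : Set} {P : A → Set} (P? : ∀ x → Dec (P x)) {n} (f : Fin n → A) →
  + length (filter P? (tabulate f)) ≡ sum (λ i → if does (P? (f i)) then 1ℤ else 0ℤ)
length-filter P? {zero}  f = refl
length-filter P? {suc n} f with does (P? (f zero))
... | true  = cong (_+_ 1ℤ) (length-filter P? (f ∘ suc))
... | false = trans (length-filter P? (f ∘ suc)) (sym (+-identityˡ _))

-- Integers as rationals

ι : ℤ → ℚ
ι z = mkℚ z 0 (Coprime.sym (1-coprimeTo ∣ z ∣))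

-- `ι z` is built directly as a fraction in lowest terms, so its numerator computes to `z`.
ι-injective : ∀ {a b} → ι a ≡ ι b → a ≡ b
ι-injective = cong ℚ.numerator

ι-+ : ∀ a b → ι (a + b) ≡ ι a ℚ.+ ι b
ι-+ a b = ℚ.toℚᵘ-injective (ℚᵘ.≃-trans (*≡* (lem a b)) (ℚᵘ.≃-sym (ℚ.toℚᵘ-homo-+ (ι a) (ι b))))
  where
  lem : ∀ a b → (a + b) * 1ℤ ≡ (a * 1ℤ + b * 1ℤ) * 1ℤ
  lem = solve-∀

ι-* : ∀ a b → ι (a * b) ≡ ι a ℚ.* ι b
ι-* a b = ℚ.toℚᵘ-injective (ℚᵘ.≃-trans (*≡* refl) (ℚᵘ.≃-sym (ℚ.toℚᵘ-homo-* (ι a) (ι b))))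

clear-denominator : ∀ x → ι (ℚ.denominator x) ℚ.* x ≡ ι (ℚ.numerator x)
clear-denominator x@(mkℚ n d-1 _) = ℚ.toℚᵘ-injective (ℚᵘ.≃-trans (ℚ.toℚᵘ-homo-* (ι (ℚ.denominator x)) x)
  (*≡* (lem (+ suc d-1) n)))
  where
  lem : ∀ d n → (d * n) * 1ℤ ≡ n * (1ℤ * d)
  lem = solve-∀

-- Multiplying by the denominator of `x` reduces the claim to the absence of zero divisors in ℤ.
*-cancel-0 : ∀ {a x} → a ≢ 0ℤ → ι a ℚ.* x ≡ 0ℚ → x ≡ 0ℚ
*-cancel-0 {a} {x} a≢0 eq = ℚ.↥p≡0⇒p≡0 x (nonZero-product a≢0 (ι-injective (begin
  ι (a * ℚ.numerator x)                          ≡⟨ ι-* a _ ⟩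
  ι a ℚ.* ι (ℚ.numerator x)                      ≡⟨ cong (ι a ℚ.*_) (clear-denominator x) ⟨
  ι a ℚ.* (ι (ℚ.denominator x) ℚ.* x)            ≡⟨ ℚ.*-assoc (ι a) (ι (ℚ.denominator x)) x ⟨
  ι a ℚ.* ι (ℚ.denominator x) ℚ.* x              ≡⟨ cong (ℚ._* x) (ℚ.*-comm (ι a) (ι (ℚ.denominator x))) ⟩
  ι (ℚ.denominator x) ℚ.* ι a ℚ.* x              ≡⟨ ℚ.*-assoc (ι (ℚ.denominator x)) (ι a) x ⟩
  ι (ℚ.denominator x) ℚ.* (ι a ℚ.* x)            ≡⟨ cong (ι (ℚ.denominator x) ℚ.*_) eq ⟩
  ι (ℚ.denominator x) ℚ.* 0ℚ                     ≡⟨ ℚ.*-zeroʳ (ι (ℚ.denominator x)) ⟩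
  0ℚ                                             ∎)))
  where open ≡-Reasoning

*-cancel : ∀ {a x y} → a ≢ 0ℤ → ι a ℚ.* x ≡ ι a ℚ.* y → x ≡ y
*-cancel {a} {x} {y} a≢0 eq = ℚ-Group.∙-cancelʳ (ℚ.- y) x y (trans (*-cancel-0 {a} a≢0 (begin
  ι a ℚ.* (x ℚ.+ ℚ.- y)               ≡⟨ ℚ.*-distribˡ-+ (ι a) x (ℚ.- y) ⟩
  ι a ℚ.* x ℚ.+ ι a ℚ.* ℚ.- y         ≡⟨ cong₂ ℚ._+_ eq (sym (ℚ.neg-distribʳ-* (ι a) y)) ⟩
  ι a ℚ.* y ℚ.+ ℚ.- (ι a ℚ.* y)       ≡⟨ ℚ.+-inverseʳ (ι a ℚ.* y) ⟩
  0ℚ                                  ∎)) (sym (ℚ.+-inverseʳ y)))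
  where open ≡-Reasoning

-- `N` is the product of all denominators; each new one rescales the integers found so far.
clear-denominators : ∀ {n} (x : Fin n → ℚ) →
  Σ ℤ λ N → N ≢ 0ℤ × Σ (Fin n → ℤ) λ z → ∀ i → ι N ℚ.* x i ≡ ι (z i)
clear-denominators {zero}  x = 1ℤ , (λ ()) , (λ ()) , λ ()
clear-denominators {suc n} x with clear-denominators (x ∘ suc)
... | N , N≢0 , z , eq = N * D , ND≢0 , z′ , eq′
  where
  open ≡-Reasoning
  D : ℤ
  D = ℚ.denominator (x zero)
  ND≢0 : N * D ≢ 0ℤ
  ND≢0 ND≡0 with nonZero-product N≢0 ND≡0
  ... | ()
  z′ : Fin (suc n) → ℤ
  z′ zero    = N * ℚ.numerator (x zero)
  z′ (suc i) = D * z i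
  eq′ : ∀ i → ι (N * D) ℚ.* x i ≡ ι (z′ i)
  eq′ zero    = begin
    ι (N * D) ℚ.* x zero            ≡⟨ cong (ℚ._* x zero) (ι-* N D) ⟩
    ι N ℚ.* ι D ℚ.* x zero          ≡⟨ ℚ.*-assoc (ι N) (ι D) (x zero) ⟩
    ι N ℚ.* (ι D ℚ.* x zero)        ≡⟨ cong (ι N ℚ.*_) (clear-denominator (x zero)) ⟩
    ι N ℚ.* ι (ℚ.numerator (x zero)) ≡⟨ ι-* N _ ⟨
    ι (N * ℚ.numerator (x zero))    ∎
  eq′ (suc i) = begin
    ι (N * D) ℚ.* x (suc i)         ≡⟨ cong (λ w → ι w ℚ.* x (suc i)) (*-comm N D) ⟩
    ι (D * N) ℚ.* x (suc i)         ≡⟨ cong (ℚ._* x (suc i)) (ι-* D N) ⟩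
    ι D ℚ.* ι N ℚ.* x (suc i)       ≡⟨ ℚ.*-assoc (ι D) (ι N) (x (suc i)) ⟩
    ι D ℚ.* (ι N ℚ.* x (suc i))     ≡⟨ cong (ι D ℚ.*_) (eq i) ⟩
    ι D ℚ.* ι (z i)                 ≡⟨ ι-* D (z i) ⟨
    ι (D * z i)                     ∎

∑-scale : ∀ {n} N (a z : Fin n → ℤ) (x : Fin n → ℚ) → (∀ i → ι N ℚ.* x i ≡ ι (z i)) →
  ι N ℚ.* ∑ (λ i → ι (a i) ℚ.* x i) ≡ ι (sum (λ i → a i * z i))
∑-scale {zero}  N a z x eq = ℚ.*-zeroʳ (ι N)
∑-scale {suc n} N a z x eq = begin
  ι N ℚ.* (ι a₀ ℚ.* x₀ ℚ.+ rest)               ≡⟨ ℚ.*-distribˡ-+ (ι N) (ι a₀ ℚ.* x₀) rest ⟩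
  ι N ℚ.* (ι a₀ ℚ.* x₀) ℚ.+ ι N ℚ.* rest       ≡⟨ cong₂ ℚ._+_ head (∑-scale N (a ∘ suc) (z ∘ suc) (x ∘ suc) (eq ∘ suc)) ⟩
  ι (a₀ * z zero) ℚ.+ ι (sum (λ i → a (suc i) * z (suc i))) ≡⟨ ι-+ (a₀ * z zero) _ ⟨
  ι (sum (λ i → a i * z i))                    ∎
  where
  open ≡-Reasoning
  a₀ = a zero
  x₀ = x zero
  rest = ∑ (λ i → ι (a (suc i)) ℚ.* x (suc i))
  head : ι N ℚ.* (ι a₀ ℚ.* x₀) ≡ ι (a₀ * z zero)
  head = begin
    ι N ℚ.* (ι a₀ ℚ.* x₀)  ≡⟨ ℚ.*-assoc (ι N) (ι a₀) x₀ ⟨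
    ι N ℚ.* ι a₀ ℚ.* x₀    ≡⟨ cong (ℚ._* x₀) (ℚ.*-comm (ι N) (ι a₀)) ⟩
    ι a₀ ℚ.* ι N ℚ.* x₀    ≡⟨ ℚ.*-assoc (ι a₀) (ι N) x₀ ⟩
    ι a₀ ℚ.* (ι N ℚ.* x₀)  ≡⟨ cong (ι a₀ ℚ.*_) (eq zero) ⟩
    ι a₀ ℚ.* ι (z zero)    ≡⟨ ι-* a₀ (z zero) ⟨
    ι (a₀ * z zero)        ∎

∑-cong : ∀ {n} {x y : Fin n → ℚ} → (∀ i → x i ≡ y i) → ∑ x ≡ ∑ y
∑-cong {zero}  eq = refl
∑-cong {suc n} eq = cong₂ ℚ._+_ (eq zero) (∑-cong (λ i → eq (suc i)))

-- The Cayley graph of a NutPair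

module DihedrantNut (m : ℕ) .{{_ : NonZero m}} {d : ℕ} (N : NutPair m d) where

  open NutPair N
  open Semidirect m

  weight : ℤ × Bool → ℤ
  weight (a , false) = ind A a
  weight (a , true)  = ind B a

  weight-01 : ∀ x → weight x ≡ 0ℤ ⊎ weight x ≡ 1ℤ
  weight-01 (a , false) = zero-one A a
  weight-01 (a , true)  = zero-one B a

  weight-cong : ∀ {x y} → x ≈ y → weight x ≡ weight y
  weight-cong {_ , false} {_ , _} (e , refl) = periodic-≡ (periodic A) e
  weight-cong {_ , true}  {_ , _} (e , refl) = periodic-≡ (periodic B) e

  0≢1 : ∀ {a : ℤ} → a ≡ 0ℤ → a ≢ 1ℤ
  0≢1 refl ()

  connectionSet : ConnectionSet group
  connectionSet = record
    { C         = λ x → weight x ≡ 1ℤ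
    ; C?        = λ x → weight x ≟ 1ℤ
    ; C-resp    = λ x≈y x∈C → trans (sym (weight-cong x≈y)) x∈C
    ; ε∉C       = 0≢1 0∉A
    ; C-inverse = λ { {a , false} a∈A → trans (A-even a) a∈A ; {a , true} a∈B → a∈B }
    }

  graph : Graph (m ℕ.+ m)
  graph = Cay group order connectionSet

  open Graph graph using (vertex; IsRegular; degree)

  indicator : ∀ x → (if does (weight x ≟ 1ℤ) then 1ℤ else 0ℤ) ≡ weight x
  indicator x with weight x ≟ 1ℤ | weight-01 x
  ... | yes eq | _       = sym eq
  ... | no ¬eq | inj₁ eq = sym eq
  ... | no ¬eq | inj₂ eq = ⊥-elim (¬eq eq)

  indicatorℚ : ∀ x → (if does (weight x ≟ 1ℤ) then 1ℚ else 0ℚ) ≡ ι (weight x)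
  indicatorℚ x with weight x ≟ 1ℤ | weight-01 x
  ... | yes eq | _       = cong ι (sym eq)
  ... | no ¬eq | inj₁ eq = cong ι (sym eq)
  ... | no ¬eq | inj₂ eq = ⊥-elim (¬eq eq)

  sum-vertices : (F : ℤ × Bool → ℤ) →
    sum (λ i → F (vertex i)) ≡ sumTo m (λ z → F (z , false)) + sumTo m (λ z → F (z , true))
  sum-vertices F = trans (sum-splitAt m (λ i → F (vertex i))) (cong₂ _+_
    (trans (sum-cong λ i → cong (F ∘ toVertex) (splitAt-↑ˡ m i m)) (sum-toℕ m (λ z → F (z , false))))
    (trans (sum-cong λ i → cong (F ∘ toVertex) (splitAt-↑ʳ m m i)) (sum-toℕ m (λ z → F (z , true)))))

  row : ℤ × Bool → (ℤ × Bool → ℤ) → ℤ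
  row v x = sum (λ i → weight (vertex i ∙ v ⁻¹) * x (vertex i))

  module _ (x : ℤ × Bool → ℤ) (x-cong : ∀ {y z} → y ≈ z → x y ≡ x z) where

    u v : ℤ → ℤ
    u z = x (z , false)
    v z = x (- z , true)

    private
      lem₁ : ∀ z a m → (z + m) + a ≡ (z + a) + m
      lem₁ = solve-∀
      lem₂ : ∀ z a → z + a + - a ≡ z
      lem₂ = solve-∀
      lem₃ : ∀ z a → z + - a + a ≡ z
      lem₃ = solve-∀
      lem₄ : ∀ z m → z + m - z ≡ m
      lem₄ = solve-∀

    periodic-x : ∀ b → Periodic m (λ z → x (z , b))
    periodic-x b z = x-cong (subst (+ m ∣_) (sym (lem₄ z (+ m))) ∣-refl , refl)

    u-periodic : Periodic m u
    u-periodic = periodic-x false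

    v-periodic : Periodic m v
    v-periodic = periodic-- (periodic-x true)

    -- The substitution c = z + a over a full period.
    translate : ∀ (S : Subset m) b a →
      sumTo m (λ z → ind S (z + a) * x (z , b)) ≡ sumTo m (λ c → ind S c * x (c + - a , b))
    translate S b a = trans
      (sym (sumTo-shift {f = λ z → ind S (z + a) * x (z , b)}
        (λ z → cong₂ _*_ (periodic-shift (periodic S) a z) (periodic-x b z)) (- a)))
      (sumTo-cong m λ z → cong (λ y → ind S y * x (z + - a , b)) (lem₃ z a))

    -- If y is the reflection (z , true), then y r⁻ᵃ is (z + a , true): the sense of translation is
    -- reversed. Since `v` reads reflections at negated arguments, this becomes the adjoint operator
    -- of `B`.
    row-false : ∀ a → row (a , false) x ≡ conv m (ind A) u a + corr m (ind B) v a
    row-false a = trans (sum-vertices (λ y → weight (y ∙ (- a , false)) * x y)) (cong₂ _+_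
      (trans (translate A false (- a)) (sumTo-cong m λ c → cong (λ z → ind A c * u z) (lem c a)))
      (trans (translate B true (- - a)) (sumTo-cong m λ c → cong (λ z → ind B c * x (z , true)) (lem′ c a))))
      where
      lem : ∀ c a → c + - - a ≡ a + c
      lem = solve-∀
      lem′ : ∀ c a → c + - - - a ≡ - (a - c)
      lem′ = solve-∀

    -- The row of a reflection is the second equation of `NutPair` at `- a`. `A-even` turns the
    -- correlation with `A` into a convolution, so both diagonal blocks agree.
    row-true : ∀ a → row (a , true) x ≡ conv m (ind B) u (- a) + conv m (ind A) v (- a)
    row-true a = trans (sum-vertices (λ y → weight (y ∙ (a , true)) * x y)) (cong₂ _+_
      (trans (translate B false a) (sumTo-cong m λ c → cong (λ z → ind B c * u z) (+-comm c (- a))))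
      (trans (trans (translate A true (- a)) (sumTo-cong m λ c → cong (λ z → ind A c * x (z , true)) (lem c a)))
        (corr-even m (periodic A) A-even v-periodic (- a))))
      where
      lem : ∀ c a → c + - - a ≡ - (- a - c)
      lem = solve-∀

  -- The degree of a vertex is its row applied to the constant function 1.
  regular : IsRegular d
  regular w = +-injective (trans (trans (length-filter (λ y → weight (y ∙ w ⁻¹) ≟ 1ℤ) vertex)
    (sum-cong λ i → trans (indicator (vertex i ∙ w ⁻¹)) (sym (*-identityʳ _)))) (trans (counts w) sizes))
    where
    one : ℤ × Bool → ℤ
    one _ = 1ℤ
    total : ∀ (S : Subset m) → sumTo m (λ c → ind S c * 1ℤ) ≡ size S
    total S = sumTo-cong m λ c → *-identityʳ (ind S c)
    counts : ∀ w → row w one ≡ size A + size B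
    counts (a , false) = trans (row-false one (λ _ → refl) a) (cong₂ _+_ (total A) (total B))
    counts (a , true)  = trans (row-true one (λ _ → refl) a)
      (trans (cong₂ _+_ (total B) (total A)) (+-comm (size B) (size A)))

  κ : ℤ × Bool → ℤ
  κ (a , false) = χ a
  κ (a , true)  = - χ a

  κ-cong : ∀ {y z} → y ≈ z → κ y ≡ κ z
  κ-cong {_ , false} {_ , _} (e , refl) = periodic-≡ χ-per e
  κ-cong {_ , true}  {_ , _} (e , refl) = cong -_ (periodic-≡ χ-per e)

  κ² : ∀ y → κ y * κ y ≡ 1ℤ
  κ² (a , false) = χ² a
  κ² (a , true)  = trans (lem (χ a)) (χ² a)
    where
    lem : ∀ x → - x * - x ≡ x * x
    lem = solve-∀

  -- A character is an eigenfunction of every convolution, and the eigenvalue is the result at 0.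
  conv-χ : ∀ (S : Subset m) a → conv m (ind S) χ a ≡ χ a * conv m (ind S) χ 0ℤ
  conv-χ S a = trans (sumTo-cong m λ c → begin
    ind S c * χ (a + c)          ≡⟨ cong (ind S c *_) (χ-+ a c) ⟩
    ind S c * (χ a * χ c)        ≡⟨ lem (ind S c) (χ a) (χ c) ⟩
    χ a * (ind S c * χ c)        ≡⟨ cong (λ z → χ a * (ind S c * χ z)) (+-identityˡ c) ⟨
    χ a * (ind S c * χ (0ℤ + c)) ∎) (sumTo-* m (χ a) _)
    where
    open ≡-Reasoning
    lem : ∀ s x y → s * (x * y) ≡ x * (s * y)
    lem = solve-∀

  -- By `balance` χ has the same eigenvalue for `A` and `B`, and as χ is even also for the adjoint
  -- of `B`. So the contributions of χ and - χ cancel.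
  row-κ : ∀ w → row w κ ≡ 0ℤ
  row-κ (a , false) = begin
    row (a , false) κ                                           ≡⟨ row-false κ κ-cong a ⟩
    conv m (ind A) χ a + corr m (ind B) (λ z → - χ (- z)) a     ≡⟨ cong (_+_ (conv m (ind A) χ a)) corr-B ⟩
    conv m (ind A) χ a + -1ℤ * conv m (ind B) χ a               ≡⟨ cong₂ (λ s t → s + -1ℤ * t) (conv-χ A a) (conv-χ B a) ⟩
    χ a * conv m (ind A) χ 0ℤ + -1ℤ * (χ a * conv m (ind B) χ 0ℤ) ≡⟨ cong (λ t → χ a * t + -1ℤ * (χ a * conv m (ind B) χ 0ℤ)) balance ⟩
    χ a * conv m (ind B) χ 0ℤ + -1ℤ * (χ a * conv m (ind B) χ 0ℤ) ≡⟨ lem (χ a * conv m (ind B) χ 0ℤ) ⟩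
    0ℤ ∎
    where
    open ≡-Reasoning
    lem : ∀ x → x + -1ℤ * x ≡ 0ℤ
    lem = solve-∀
    lem₂ : ∀ s x → s * - x ≡ -1ℤ * (s * x)
    lem₂ = solve-∀
    corr-B : corr m (ind B) (λ z → - χ (- z)) a ≡ -1ℤ * conv m (ind B) χ a
    corr-B = trans (sumTo-cong m λ c → trans
      (cong (λ t → ind B c * - t) (trans (χ-neg (a - c)) (trans (χ-+ a (- c))
        (trans (cong (χ a *_) (χ-neg c)) (sym (χ-+ a c))))))
      (lem₂ (ind B c) (χ (a + c)))) (sumTo-* m -1ℤ _)
  row-κ (a , true) = begin
    row (a , true) κ                                            ≡⟨ row-true κ κ-cong a ⟩
    conv m (ind B) χ (- a) + conv m (ind A) (λ z → - χ (- z)) (- a) ≡⟨ cong (_+_ (conv m (ind B) χ (- a))) conv-A ⟩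
    conv m (ind B) χ (- a) + -1ℤ * conv m (ind A) χ (- a)       ≡⟨ cong₂ (λ s t → s + -1ℤ * t) (conv-χ B (- a)) (conv-χ A (- a)) ⟩
    χ (- a) * conv m (ind B) χ 0ℤ + -1ℤ * (χ (- a) * conv m (ind A) χ 0ℤ) ≡⟨ cong (λ t → χ (- a) * conv m (ind B) χ 0ℤ + -1ℤ * (χ (- a) * t)) balance ⟩
    χ (- a) * conv m (ind B) χ 0ℤ + -1ℤ * (χ (- a) * conv m (ind B) χ 0ℤ) ≡⟨ lem (χ (- a) * conv m (ind B) χ 0ℤ) ⟩
    0ℤ ∎
    where
    open ≡-Reasoning
    lem : ∀ x → x + -1ℤ * x ≡ 0ℤ
    lem = solve-∀
    conv-A : conv m (ind A) (λ z → - χ (- z)) (- a) ≡ -1ℤ * conv m (ind A) χ (- a)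
    conv-A = trans (conv-congʳ m (ind A) (λ z → trans (cong -_ (χ-neg z)) (sym (-1*i≡-i (χ z)))) (- a))
      (conv-*ʳ m -1ℤ (ind A) χ (- a))

  kernel-unique : ∀ x → (∀ {y z} → y ≈ z → x y ≡ x z) → (∀ w → row w x ≡ 0ℤ) → ∀ y → x y ≡ κ y * x ε
  kernel-unique x x-cong eq = values
    where
    solution : ∀ a → u x x-cong a ≡ χ a * x ε × v x x-cong a ≡ - (χ a * x ε)
    solution = unique (u x x-cong) (v x x-cong) (u-periodic x x-cong) (v-periodic x x-cong)
      (λ a → trans (sym (row-false x x-cong a)) (eq (a , false)))
      (λ a → trans (sym (trans (row-true x x-cong (- a))
        (cong (λ z → conv m (ind B) (u x x-cong) z + conv m (ind A) (v x x-cong) z) (neg-involutive a)))) (eq (- a , true)))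
    values : ∀ y → x y ≡ κ y * x ε
    values (a , false) = proj₁ (solution a)
    values (a , true)  = begin
      x (a , true)          ≡⟨ cong (λ z → x (z , true)) (neg-involutive a) ⟨
      x (- - a , true)      ≡⟨ proj₂ (solution (- a)) ⟩
      - (χ (- a) * x ε)     ≡⟨ cong (λ z → - (z * x ε)) (χ-neg a) ⟩
      - (χ a * x ε)         ≡⟨ neg-distribˡ-* (χ a) (x ε) ⟩
      - χ a * x ε           ∎
      where open ≡-Reasoning

  M : Matrix (m ℕ.+ m)
  M = adjacencyMatrix graph

  index : ℤ × Bool → Fin (m ℕ.+ m)
  index y = join m m (fromVertex y)

  index-vertex : ∀ i → index (vertex i) ≡ i
  index-vertex i = proj₂ (Inverse.inverse order) (≡⇒≈ refl)

  vertex-index : ∀ y → vertex (index y) ≈ y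
  vertex-index y = proj₁ (Inverse.inverse order) refl

  M-entry : ∀ i j → M i j ≡ ι (weight (vertex j ∙ vertex i ⁻¹))
  M-entry i j = indicatorℚ (vertex j ∙ vertex i ⁻¹)

  κℚ : Fin (m ℕ.+ m) → ℚ
  κℚ i = ι (κ (vertex i))

  κℚ² : ∀ i → κℚ i ℚ.* κℚ i ≡ 1ℚ
  κℚ² i = trans (sym (ι-* (κ (vertex i)) _)) (cong ι (κ² (vertex i)))

  apply : ∀ n (z : Fin (m ℕ.+ m) → ℤ) x → (∀ i → ι n ℚ.* x i ≡ ι (z i)) →
    ∀ i → ι n ℚ.* (M *ᵥ x) i ≡ ι (sum (λ j → weight (vertex j ∙ vertex i ⁻¹) * z j))
  apply n z x eq i = trans (cong (ι n ℚ.*_) (∑-cong λ j → cong (ℚ._* x j) (M-entry i j)))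
    (∑-scale n (λ j → weight (vertex j ∙ vertex i ⁻¹)) z x eq)

  κ-kernel : InEigenspace M 0ℚ κℚ
  κ-kernel i = begin
    (M *ᵥ κℚ) i                      ≡⟨ ℚ.*-identityˡ _ ⟨
    ι 1ℤ ℚ.* (M *ᵥ κℚ) i             ≡⟨ apply 1ℤ (κ ∘ vertex) κℚ (λ j → ℚ.*-identityˡ (κℚ j)) i ⟩
    ι (row (vertex i) κ)             ≡⟨ cong ι (row-κ (vertex i)) ⟩
    0ℚ                               ≡⟨ ℚ.*-zeroˡ (κℚ i) ⟨
    0ℚ ℚ.* κℚ i                      ∎
    where open ≡-Reasoning

  origin : Fin (m ℕ.+ m)
  origin = index ε

  -- A rational kernel vector is multiplied by a common denominator `n` and extended to all of ℤ ×
  -- Bool through `index`. The integral result `kernel-unique` applies, and `n` is cancelled again.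
  kernel-line : ∀ x → InEigenspace M 0ℚ x → ∀ i → x i ≡ κℚ i ℚ.* x origin
  kernel-line x kernel i with clear-denominators x
  ... | n , n≢0 , z , eq = *-cancel {n} n≢0 (begin
    ι n ℚ.* x i                      ≡⟨ eq i ⟩
    ι (z i)                          ≡⟨ cong (ι ∘ z) (index-vertex i) ⟨
    ι (y (vertex i))                 ≡⟨ cong ι (kernel-unique y y-cong rows (vertex i)) ⟩
    ι (κ (vertex i) * z origin)      ≡⟨ ι-* (κ (vertex i)) (z origin) ⟩
    κℚ i ℚ.* ι (z origin)            ≡⟨ cong (κℚ i ℚ.*_) (eq origin) ⟨
    κℚ i ℚ.* (ι n ℚ.* x origin)      ≡⟨ ℚ.*-assoc (κℚ i) (ι n) (x origin) ⟨
    κℚ i ℚ.* ι n ℚ.* x origin        ≡⟨ cong (ℚ._* x origin) (ℚ.*-comm (κℚ i) (ι n)) ⟩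
    ι n ℚ.* κℚ i ℚ.* x origin        ≡⟨ ℚ.*-assoc (ι n) (κℚ i) (x origin) ⟩
    ι n ℚ.* (κℚ i ℚ.* x origin)      ∎)
    where
    open ≡-Reasoning
    y : ℤ × Bool → ℤ
    y w = z (index w)
    y-cong : ∀ {v w} → v ≈ w → y v ≡ y w
    y-cong v≈w = cong (z ∘ join m m) (fromVertex-cong v≈w)
    weight-row-cong : ∀ w w′ → w ≈ w′ → row w y ≡ row w′ y
    weight-row-cong w w′ w≈w′ = sum-cong λ j →
      cong (_* y (vertex j)) (weight-cong (∙-cong (≡⇒≈ {vertex j} refl) (⁻¹-cong w≈w′)))
    rows-vertex : ∀ i → row (vertex i) y ≡ 0ℤ
    rows-vertex i = ι-injective (begin
      ι (row (vertex i) y)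
        ≡⟨ cong ι (sum-cong λ j → cong (λ k → weight (vertex j ∙ vertex i ⁻¹) * z k) (index-vertex j)) ⟩
      ι (sum (λ j → weight (vertex j ∙ vertex i ⁻¹) * z j))
        ≡⟨ apply n z x eq i ⟨
      ι n ℚ.* (M *ᵥ x) i   ≡⟨ cong (ι n ℚ.*_) (trans (kernel i) (ℚ.*-zeroˡ (x i))) ⟩
      ι n ℚ.* 0ℚ           ≡⟨ ℚ.*-zeroʳ (ι n) ⟩
      0ℚ                   ∎)
    rows : ∀ w → row w y ≡ 0ℤ
    rows w = trans (weight-row-cong w (vertex (index w)) (≈-sym (vertex-index w))) (rows-vertex (index w))

  κ-cancel : ∀ i x → κℚ i ℚ.* x ≡ 0ℚ → x ≡ 0ℚ
  κ-cancel i x eq = begin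
    x                           ≡⟨ ℚ.*-identityˡ x ⟨
    1ℚ ℚ.* x                    ≡⟨ cong (ℚ._* x) (κℚ² i) ⟨
    κℚ i ℚ.* κℚ i ℚ.* x         ≡⟨ ℚ.*-assoc (κℚ i) (κℚ i) x ⟩
    κℚ i ℚ.* (κℚ i ℚ.* x)       ≡⟨ cong (κℚ i ℚ.*_) eq ⟩
    κℚ i ℚ.* 0ℚ                 ≡⟨ ℚ.*-zeroʳ (κℚ i) ⟩
    0ℚ                          ∎
    where open ≡-Reasoning

  isNutGraph : 2 ℕ.≤ m ℕ.+ m → IsNutGraph graph
  isNutGraph 2≤n = record
    { nontrivial   = 2≤n
    ; multiplicity = (λ _ → κℚ) , record
      { inEigenspace = λ _ → κ-kernel
      ; independent  = λ { c eq zero → κ-cancel origin (c zero)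
          (trans (ℚ.*-comm (κℚ origin) (c zero)) (trans (sym (ℚ.+-identityʳ _)) (eq origin))) }
      ; spanning     = λ x kernel → (λ _ → x origin) , λ i →
          trans (kernel-line x kernel i) (trans (ℚ.*-comm (κℚ i) (x origin)) (sym (ℚ.+-identityʳ _)))
      }
    -- The entries of κ are ± 1, so one zero entry forces `x origin` to be 0, and with it all of
    -- `x`.
    ; full         = λ { x (kernel , j , xj≢0) i xi≡0 → xj≢0 (begin
        x j                    ≡⟨ kernel-line x kernel j ⟩
        κℚ j ℚ.* x origin      ≡⟨ cong (κℚ j ℚ.*_) (κ-cancel i (x origin) (trans (sym (kernel-line x kernel i)) xi≡0)) ⟩
        κℚ j ℚ.* 0ℚ            ≡⟨ ℚ.*-zeroʳ (κℚ j) ⟩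
        0ℚ                     ∎) }
    }
    where open ≡-Reasoning

-- Arithmetic of n and d, and the theorem

halve-∣ : ∀ k → 4 ℕ∣.∣ k ℕ.+ k → Σ ℕ λ h → k ≡ h ℕ.+ h
halve-∣ k (ℕ∣.divides q eq) = q , ℕ.*-cancelˡ-≡ k (q ℕ.+ q) 2 (trans (lem k) (trans eq (lem₂ q)))
  where
  lem : ∀ k → 2 ℕ.* k ≡ k ℕ.+ k
  lem = ℕ-Solver.solve-∀
  lem₂ : ∀ q → q ℕ.* 4 ≡ 2 ℕ.* (q ℕ.+ q)
  lem₂ = ℕ-Solver.solve-∀

double-≤ : ∀ a b → a ℕ.+ a ℕ.≤ b ℕ.+ b → a ℕ.≤ b
double-≤ a b le = a+a≤1+b+b⇒a≤b a b (ℕ.≤-trans le (ℕ.n≤1+n _))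

double : ∀ {n} → 2 ℕ∣.∣ n → Σ ℕ λ k → n ≡ k ℕ.+ k
double (ℕ∣.divides q refl) = q , lem q
  where
  lem : ∀ q → q ℕ.* 2 ≡ q ℕ.+ q
  lem = ℕ-Solver.solve-∀

mainTheorem17 : (n d : ℕ) →
    2 ℕ∣.∣ n → 2 ℕ∣.∣ d → (4 ℕ∣.∣ n ⊎ 4 ℕ∣.∣ d) →
    4 ℕ.≤ d → d ℕ.+ 4 ℕ.≤ n →
    Σ (Group 0ℓ 0ℓ) λ Γ →
    Σ (HasOrder (Group.setoid Γ) n) λ Γ-order →
    Σ (ConnectionSet Γ) λ C →
    (IsCyclic Γ ⊎ IsDihedral Γ) ×
    Graph.IsRegular (Cay Γ Γ-order C) d ×
    IsNutGraph (Cay Γ Γ-order C)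
mainTheorem17 n d 2∣n 2∣d 4∣ 4≤d d+4≤n with double 2∣n | double 2∣d
... | m , refl | k , refl =
  group , order , connectionSet , inj₂ (m , 3≤m , isomorphism) , regular , isNutGraph 2≤n
  where
  lem : ∀ k → (2 ℕ.+ k) ℕ.+ (2 ℕ.+ k) ≡ k ℕ.+ k ℕ.+ 4
  lem = ℕ-Solver.solve-∀
  2≤k : 2 ℕ.≤ k
  2≤k = double-≤ 2 k 4≤d
  k+2≤m : 2 ℕ.+ k ℕ.≤ m
  k+2≤m = double-≤ (2 ℕ.+ k) m (subst (ℕ._≤ m ℕ.+ m) (sym (lem k)) d+4≤n)
  3≤m : 3 ℕ.≤ m
  3≤m = ℕ.≤-trans (ℕ.+-monoʳ-≤ 2 (ℕ.≤-trans (ℕ.n≤1+n 1) 2≤k)) k+2≤m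
  2≤n : 2 ℕ.≤ m ℕ.+ m
  2≤n = ℕ.≤-trans (ℕ.≤-trans (ℕ.n≤1+n 2) 3≤m) (ℕ.m≤m+n m m)
  even : (Σ ℕ λ h → m ≡ h ℕ.+ h) ⊎ (Σ ℕ λ a → k ≡ a ℕ.+ a)
  even = Sum.map (halve-∣ m) (halve-∣ k) 4∣
  instance
    m≢0 : NonZero m
    m≢0 = ℕ.>-nonZero (ℕ.≤-trans (ℕ.s≤s ℕ.z≤n) 3≤m)
  open Semidirect m
  open DihedrantNut m (nutPair-exists m k 2≤k k+2≤m even)
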